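{- For every prime power $q=8n+1>9$ there exists a $(\mathbb Z_2\times\mathbb F_q,\{2^{4n+1},4^{2n}\},2)$-PDF which is the base (starter) parallel class of an HS$(2,\{2,4\},2q)$.
   Context: For a subset $B$ of an additive group, $\Delta B$ is the multiset of differences $b-b'$ over ordered pairs of distinct elements of $B$. A $(\Gamma,K,\lambda)$-PDF is a collection of subsets of $\Gamma$ partitioning $\Gamma$, with multiset of sizes $K$ (written in exponential notation: $\{k_1^{\mu_1},\dots\}$ means $k_i$ with multiplicity $\mu_i$), such that the multiset union of the $\Delta B$ equals $\lambda$ copies of $\Gamma\setminus\{0\}$. A linear space S$(2,K,v)$: $v$ points, blocks with sizes in $K$ (each element of $K$ occurring), every pair of points in exactly one block; a resolution partitions the blocks into parallel classes each partitioning the points. A PDF $\mathcal P$ in $\Gamma$ with $|\Gamma|=v$ is the base parallel class of an HS$(2,K,v)$ if $\{\mathcal P+x\mid x\in\Gamma\}$ is the set of parallel classes of a resolved S$(2,K,v)$ with point set $\Gamma$ (so the translations act sharply transitively on points and transitively on parallel classes). -}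

module Defs where

open import Data.Nat using (ℕ; zero; suc; _*_; _+_)
open import Data.Fin using (Fin; zero; suc)
open import Data.Fin.Properties using () renaming (_≟_ to _≟ᶠ_)
open import Data.Product using (_×_; _,_; Σ; ∃; ∃-syntax)
open import Data.Product.Properties using (≡-dec)
open import Data.List using (List; []; _∷_; map; concat; concatMap; filter; length; replicate; _++_)
open import Data.List.Membership.Propositional using (_∈_)
open import Data.List.Relation.Binary.Permutation.Propositional using (_↭_)
open import Data.Bool using (if_then_else_)
open import Relation.Nullary using (¬_; Dec; yes; no; ¬?)
open import Relation.Nullary.Decidable using (⌊_⌋)
open import Relation.Binary.PropositionalEquality using (_≡_; _≢_)
open import Relation.Binary.Definitions using (DecidableEquality)
open import Algebra.Structures using (IsCommutativeRing)

-- A (finite) field structure whose carrier is Fin q, with propositional equality.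
-- Every finite field of order q is isomorphic to one of these.
record FieldOn (q : ℕ) : Set where
  field
    _+F_ _*F_ : Fin q → Fin q → Fin q
    -F_ : Fin q → Fin q
    0F 1F : Fin q
    isCommutativeRing : IsCommutativeRing _≡_ _+F_ _*F_ -F_ 0F 1F
    0≢1 : 0F ≢ 1F
    inverse : ∀ x → x ≢ 0F → ∃[ y ] (x *F y ≡ 1F)

_+₂_ : Fin 2 → Fin 2 → Fin 2
zero +₂ y = y
suc zero +₂ zero = suc zero
suc zero +₂ suc zero = zero

Γ : ℕ → Set
Γ q = Fin 2 × Fin q

_≟Γ_ : ∀ {q} → DecidableEquality (Γ q)
_≟Γ_ = ≡-dec _≟ᶠ_ _≟ᶠ_

count : ∀ {q} → Γ q → List (Γ q) → ℕ
count x [] = 0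
count x (y ∷ ys) with x ≟Γ y
... | yes _ = suc (count x ys)
... | no _ = count x ys

Block : ℕ → Set
Block q = List (Γ q)

Class : ℕ → Set
Class q = List (Block q)

module _ {q : ℕ} (F : FieldOn q) where
  open FieldOn F

  0Γ : Γ q
  0Γ = zero , 0F

  addΓ : Γ q → Γ q → Γ q
  addΓ (a , x) (b , y) = (a +₂ b) , (x +F y)

  -- in Z_2, -b = b
  subΓ : Γ q → Γ q → Γ q
  subΓ (a , x) (b , y) = (a +₂ b) , (x +F (-F y))

  Δ : Block q → List (Γ q)
  Δ B = concatMap (λ b → map (λ b' → subΓ b b') (filter (λ b' → ¬? (b' ≟Γ b)) B)) B

  IsPDF : Class q → List ℕ → ℕ → Set
  IsPDF P K λ' =
    (∀ x → count x (concat P) ≡ 1)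
    × (map length P ↭ K)
    × (∀ g → count g (concatMap Δ P) ≡ (if ⌊ g ≟Γ 0Γ ⌋ then 0 else λ'))

  _+B_ : Block q → Γ q → Block q
  B +B x = map (λ b → addΓ b x) B

  _+P_ : Class q → Γ q → Class q
  P +P x = map (_+B x) P

  _≈B_ : Block q → Block q → Set
  B ≈B B' = ∀ a → (a ∈ B → a ∈ B') × (a ∈ B' → a ∈ B)

  _≈C_ : Class q → Class q → Set
  C ≈C C' = (∀ B → B ∈ C → Σ (Block q) λ B' → B' ∈ C' × B ≈B B')
          × (∀ B' → B' ∈ C' → Σ (Block q) λ B → B ∈ C × B ≈B B')

  IsParallelClass : Class q → Set
  IsParallelClass C = ∀ a → count a (concat C) ≡ 1

  -- P is the base parallel class of an HS(2,K,2q) on point set Γ: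
  -- the set {P + x | x ∈ Γ} is the set of parallel classes of a resolved
  -- S(2,K,2q) whose blocks are the blocks of the P + x.
  IsHSBase : Class q → List ℕ → Set
  IsHSBase P K =
    ((∀ B → B ∈ P → length B ∈ K) × (∀ k → k ∈ K → Σ (Block q) λ B → B ∈ P × length B ≡ k))
    × (∀ x → IsParallelClass (P +P x))
    × (∀ a b → a ≢ b → Σ (Block q) λ B → Σ (Γ q) λ x → B ∈ P × a ∈ (B +B x) × b ∈ (B +B x))
    × (∀ a b → a ≢ b → ∀ B B' x y → B ∈ P → B' ∈ P
          → a ∈ (B +B x) → b ∈ (B +B x) → a ∈ (B' +B y) → b ∈ (B' +B y)
          → (B +B x) ≈B (B' +B y))
    -- resolution: the classes P + x partition the block set, i.e. a block lying in
    -- two of these classes forces the two classes to coincide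
    × (∀ B B' x y → B ∈ P → B' ∈ P → (B +B x) ≈B (B' +B y) → (P +P x) ≈C (P +P y))

IsPrimePower : ℕ → Set
IsPrimePower q = Σ ℕ λ p → Σ ℕ λ k → Data.Nat.Primality.Prime p × (1 Data.Nat.≤ k) × (p Data.Nat.^ k ≡ q)
  where import Data.Nat.Primality

-- Put j = (1 , 0). Since λ = 2, a base parallel class must be invariant under translation by j, so it consists of {0 , j}
-- and of two translates L and L + j of a "half system" L: the second coordinates of the points of L run through the nonzero
-- elements of F, and the differences of L cover each (c , d) with d ≠ 0 exactly once.
-- Let C be the group of fourth powers of F and S a transversal of {1 , -1} in C. If a₀, a₁, a₂, a₃ lie in different cosets
-- of C, and if both a₀ - a₁, a₀ - a₂, a₁ - a₂, a₂ - a₃ and a₀ - a₃, a₁ - a₃, a₂ - a₃, a₀ - a₁ lie in different cosets of C,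
-- then the blocks
--   {(0 , a₀ s) , (0 , a₁ s) , (0 , a₂ s) , (1 , a₃ s)}, {(0 , - a₂ s) , (0 , - a₃ s)}, {(0 , - a₀ s) , (1 , - a₁ s)}
-- with s ∈ S form a half system.
-- For large q such elements are chosen greedily: for b ≠ b′ the number of x with (x - b) / (x - b′) ∈ C is known exactly, so
-- by a second moment argument x - b, with b running through a large set, is almost equidistributed over the cosets of C for
-- all but few x. For small q there is a table of suitable elements. The only exception is q = 17, where a half system of a
-- different shape is used.
module Submission where

open import Defs
open import Level using (0ℓ)
open import Algebra.Bundles using (CommutativeMonoid; CommutativeRing; RawRing)
open import Algebra.Solver.Ring.AlmostCommutativeRing using (AlmostCommutativeRing; fromCommutativeRing; _-Raw-AlmostCommutative⟶_)
import Algebra.Properties.CommutativeMonoid.Sum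
import Algebra.Properties.CommutativeSemiring.Exp
import Algebra.Properties.Ring
import Algebra.Properties.Semiring.Exp
import Algebra.Properties.Semiring.Mult
import Algebra.Properties.Semiring.Sum
import Algebra.Solver.Ring
open import Data.Bool as Bool using (Bool; true; false; _∧_; _∨_; not; if_then_else_)
open import Data.Empty using (⊥; ⊥-elim)
open import Data.Fin using (Fin; zero; suc; toℕ; fromℕ<; inject≤; punchOut)
open import Data.Fin.Patterns
open import Data.Fin.Permutation using (Permutation; permutation)
open import Data.Fin.Properties using (_≟_; any?; inject≤-injective; pigeonhole; punchOut-injective; suc-injective; toℕ-fromℕ<; toℕ-injective; ¬∀⟶∃¬)
import Data.Fin.Properties as Finₚ
open import Data.List using (List; []; _∷_; concat; concatMap; filter; foldr; length; map; replicate; tabulate; _++_)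
open import Data.List.Membership.Propositional using (_∈_)
open import Data.List.Membership.Propositional.Properties using (∈-++⁺ʳ; ∈-++⁺ˡ; ∈-++⁻; ∈-filter⁻; ∈-map⁺; ∈-map⁻)
open import Data.List.Properties using (concat-++; concat-map; length-map; map-++; map-cong; map-id; map-∘)
open import Data.List.Relation.Binary.Permutation.Propositional using (_↭_; prep; ↭-refl; ↭-sym; module PermutationReasoning)
open import Data.List.Relation.Binary.Permutation.Propositional.Properties using (++-assoc; ++-comm; ++⁺; ++⁺ʳ; ++⁺ˡ; ∈-resp-↭) renaming (shift to ↭-shift)
open import Data.List.Relation.Unary.Any using (here; there)
open import Data.Maybe as Maybe using (Maybe)
open import Data.Nat as ℕ using (ℕ; zero; suc; s≤s; z≤n)
open import Data.Nat.Divisibility using (m%n≡0⇒n∣m)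
import Data.Nat.DivMod as ℕ÷
open import Data.Nat.Primality using (Prime; prime⇒irreducible; prime⇒nonTrivial)
import Data.Nat.Properties as ℕₚ
open import Data.Nat.Tactic.RingSolver using (solve-∀)
open import Data.Product using (_×_; _,_; Σ; ∃-syntax; proj₁; proj₂)
open import Data.Sum using (_⊎_; inj₁; inj₂; [_,_]′)
open import Data.Vec as Vec using (Vec; []; _∷_)
open import Function using (_∘_; case_of_)
open import Relation.Binary.Definitions using (tri<; tri≈; tri>)
open import Relation.Binary.PropositionalEquality hiding (J)
open import Relation.Nullary using (Dec; does; no; yes; ¬_; ¬?; _×-dec_)
open import Relation.Nullary.Decidable using (dec⇒maybe; ⌊_⌋)
open import Relation.Unary using (Decidable; Pred)

-- Fields of order q

-- Why j must fix P: the 2q translates of P cover every pair of points twice, as λ = 2, while each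
-- pair may lie in one block only. So just q of the translates are different, and the stabilizer of
-- P has order 2; since q is odd, j is the only involution. The obstacle is to meet ten coset
-- conditions at once, four on elements and six on differences. A Weil bound would do so for large
-- q, but here only pair correlations are used, which a substitution evaluates exactly. The price is
-- a step-by-step choice: each step excludes a number of bad elements bounded independently of q and
-- keeps a fixed proportion of the candidates. Comparing these bounds with the coset size 2n gives
-- the threshold n = 10700, so all q up to 85600 need a computation. The operations of F are unknown
-- there, so the tabulated elements live in a computable ring that maps to F. As the conditions are
-- equations between fourth roots of unity, any homomorphism transports them. Only q = 17 needs a
-- genuine isomorphism with residues, because exact counts are transported.

module _ {c ℓ} (M : CommutativeMonoid c ℓ) where
  open CommutativeMonoid M using (Carrier; _≈_; ε; ∙-congˡ; identityʳ; identityˡ) renaming (trans to ≈-trans)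
  open Algebra.Properties.CommutativeMonoid.Sum M

  sum-point : ∀ {n} (a : Fin n) v → sum (λ y → if does (y ≟ a) then v else ε) ≈ v
  sum-point {suc n} zero v = ≈-trans (∙-congˡ (sum-replicate-zero n)) (identityʳ v)
  sum-point {suc n} (suc a) v = ≈-trans (identityˡ _) (sum-point a v)

module FieldTheory {q : ℕ} (F : FieldOn q) where
  open FieldOn F

  F-ring : CommutativeRing 0ℓ 0ℓ
  F-ring = record { isCommutativeRing = isCommutativeRing }

  open CommutativeRing F-ring public using (_+_; _*_; -_; _-_; 0#; 1#; +-identityˡ; +-identityʳ; *-identityˡ; *-identityʳ; *-comm; *-assoc; +-comm; +-assoc; zeroˡ; zeroʳ; distribˡ; distribʳ; -‿inverseʳ; -‿inverseˡ)
  open CommutativeRing F-ring using (+-congˡ; semiring; commutativeSemiring; ring; *-commutativeMonoid; +-commutativeMonoid)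
  open Algebra.Properties.Semiring.Mult semiring public using (×-homo-+; ×1-homo-*) renaming (_×_ to _·_)
  open Algebra.Properties.Semiring.Exp semiring public using (_^_; ^-homo-*; ^-assocʳ)
  open Algebra.Properties.CommutativeSemiring.Exp commutativeSemiring public using (^-distrib-*)
  open Algebra.Properties.Ring ring public using (-‿distribˡ-*; -‿distribʳ-*; -0#≈0#; -‿involutive)
  open Algebra.Properties.Ring ring using (-‿+-comm)

  private
    acr : AlmostCommutativeRing 0ℓ 0ℓ
    acr = fromCommutativeRing F-ring

  -- The pair (a , b) denotes the integer a - b.
  ℤ-coefficients : RawRing 0ℓ 0ℓ
  ℤ-coefficients = record
    { Carrier = ℕ × ℕ ; _≈_ = _≡_
    ; _+_ = λ (a , b) (c , d) → a ℕ.+ c , b ℕ.+ d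
    ; _*_ = λ (a , b) (c , d) → a ℕ.* c ℕ.+ b ℕ.* d , a ℕ.* d ℕ.+ b ℕ.* c
    ; -_ = λ (a , b) → b , a
    ; 0# = 0 , 0 ; 1# = 1 , 0 }

  private
    +-interchange : ∀ a b c d → (a + b) + (c + d) ≡ (a + c) + (b + d)
    +-interchange a b c d = begin
      (a + b) + (c + d) ≡⟨ +-assoc a b _ ⟩
      a + (b + (c + d)) ≡⟨ cong (a +_) (trans (sym (+-assoc b c d)) (trans (cong (_+ d) (+-comm b c)) (+-assoc c b d))) ⟩
      a + (c + (b + d)) ≡⟨ +-assoc a c _ ⟨
      (a + c) + (b + d) ∎
      where open ≡-Reasoning

    difference-* : ∀ a b c d → (a * c + b * d) - (a * d + b * c) ≡ (a - b) * (c - d)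
    difference-* a b c d = begin
      (a * c + b * d) - (a * d + b * c) ≡⟨ +-congˡ (-‿+-comm _ _) ⟨
      (a * c + b * d) + (- (a * d) + - (b * c)) ≡⟨ +-interchange _ _ _ _ ⟩
      (a * c - a * d) + (b * d - b * c) ≡⟨ cong₂ _+_ (sym (step a)) (trans (+-comm _ _) (sym step′)) ⟩
      a * (c - d) + (- b) * (c - d) ≡⟨ distribʳ (c - d) a (- b) ⟨
      (a - b) * (c - d) ∎
      where
      open ≡-Reasoning
      step : ∀ x → x * (c - d) ≡ x * c - x * d
      step x = trans (distribˡ x c (- d)) (cong (x * c +_) (sym (-‿distribʳ-* x d)))
      step′ : (- b) * (c - d) ≡ - (b * c) + b * d
      step′ = trans (step (- b)) (cong₂ _+_ (sym (-‿distribˡ-* b c))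
        (trans (cong -_ (sym (-‿distribˡ-* b d))) (-‿involutive (b * d))))

    evaluate : ℕ × ℕ → Fin q
    evaluate (a , b) = a · 1# - b · 1#

    coefficient-morphism : ℤ-coefficients -Raw-AlmostCommutative⟶ acr
    coefficient-morphism = record
      { ⟦_⟧ = evaluate
      ; +-homo = λ (a , b) (c , d) → trans
          (cong₂ _-_ (×-homo-+ 1# a c) (×-homo-+ 1# b d))
          (trans (+-congˡ (sym (-‿+-comm _ _))) (+-interchange _ _ _ _))
      ; *-homo = λ (a , b) (c , d) → trans
          (cong₂ _-_
            (trans (×-homo-+ 1# (a ℕ.* c) (b ℕ.* d)) (cong₂ _+_ (×1-homo-* a c) (×1-homo-* b d)))
            (trans (×-homo-+ 1# (a ℕ.* d) (b ℕ.* c)) (cong₂ _+_ (×1-homo-* a d) (×1-homo-* b c))))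
          (difference-* (a · 1#) (b · 1#) (c · 1#) (d · 1#))
      ; -‿homo = λ (a , b) → trans (+-comm _ _) (trans (cong (- (a · 1#) +_) (sym (-‿involutive _))) (-‿+-comm (a · 1#) (- (b · 1#))))
      ; 0-homo = -‿inverseʳ 0#
      ; 1-homo = trans (cong (1# + 0# +_) -0#≈0#) (trans (+-identityʳ _) (+-identityʳ 1#)) }

    -- Pairs are never normalised, so the solver has to recognise two pairs that denote one integer.
    -- The cross sum is an equation in ℕ, hence decidable and preserved by the map into F.
    evaluate-≡ : ∀ {a b c d} → a ℕ.+ d ≡ c ℕ.+ b → evaluate (a , b) ≡ evaluate (c , d)
    evaluate-≡ {a} {b} {c} {d} e = begin
      a · 1# - b · 1# ≡⟨ +-identityʳ _ ⟨
      (a · 1# - b · 1#) + 0# ≡⟨ +-congˡ (-‿inverseʳ (d · 1#)) ⟨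
      (a · 1# - b · 1#) + (d · 1# - d · 1#) ≡⟨ +-interchange _ _ _ _ ⟩
      (a · 1# + d · 1#) + (- (b · 1#) - d · 1#) ≡⟨ cong (_+ (- (b · 1#) - d · 1#)) swap ⟩
      (c · 1# + b · 1#) + (- (b · 1#) - d · 1#) ≡⟨ cong ((c · 1# + b · 1#) +_) (+-comm _ _) ⟩
      (c · 1# + b · 1#) + (- (d · 1#) - b · 1#) ≡⟨ +-interchange _ _ _ _ ⟩
      (c · 1# - d · 1#) + (b · 1# - b · 1#) ≡⟨ +-congˡ (-‿inverseʳ (b · 1#)) ⟩
      (c · 1# - d · 1#) + 0# ≡⟨ +-identityʳ _ ⟩
      c · 1# - d · 1# ∎
      where
      open ≡-Reasoning
      swap : a · 1# + d · 1# ≡ c · 1# + b · 1#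
      swap = trans (sym (×-homo-+ 1# a d)) (trans (cong (_· 1#) e) (×-homo-+ 1# c b))

    coefficient-≟ : ∀ x y → Maybe (evaluate x ≡ evaluate y)
    coefficient-≟ (a , b) (c , d) = Maybe.map (evaluate-≡ {a} {b} {c} {d}) (dec⇒maybe (a ℕ.+ d ℕₚ.≟ c ℕ.+ b))

  open Algebra.Solver.Ring ℤ-coefficients acr coefficient-morphism coefficient-≟ public
    using (solve; _:+_; _:*_; :-_; _:-_; _:=_; con)

  0≢1# : 0# ≢ 1#
  0≢1# = 0≢1

  integral : ∀ {x y} → x * y ≡ 0# → x ≢ 0# → y ≡ 0#
  integral {x} {y} xy≡0 x≢0 with inverse x x≢0
  ... | z , xz≡1 = begin
    y ≡⟨ *-identityˡ y ⟨
    1# * y ≡⟨ cong (_* y) xz≡1 ⟨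
    (x * z) * y ≡⟨ solve 3 (λ x y z → (x :* z) :* y := z :* (x :* y)) refl x y z ⟩
    z * (x * y) ≡⟨ cong (z *_) xy≡0 ⟩
    z * 0# ≡⟨ zeroʳ z ⟩
    0# ∎
    where open ≡-Reasoning

  product≢0 : ∀ {x y} → x ≢ 0# → y ≢ 0# → x * y ≢ 0#
  product≢0 x≢0 y≢0 xy≡0 = y≢0 (integral xy≡0 x≢0)

  factorˡ≢0 : ∀ {x y} → x * y ≢ 0# → x ≢ 0#
  factorˡ≢0 {y = y} xy≢0 x≡0 = xy≢0 (trans (cong (_* y) x≡0) (zeroˡ y))

  difference≡0⇒≡ : ∀ {x y} → x - y ≡ 0# → x ≡ y
  difference≡0⇒≡ {x} {y} e = begin
    x ≡⟨ solve 2 (λ x y → x := (x :- y) :+ y) refl x y ⟩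
    (x - y) + y ≡⟨ cong (_+ y) e ⟩
    0# + y ≡⟨ +-identityˡ y ⟩
    y ∎
    where open ≡-Reasoning

  ≡⇒difference≡0 : ∀ {x y} → x ≡ y → x - y ≡ 0#
  ≡⇒difference≡0 {x} refl = -‿inverseʳ x

  *-cancelˡ : ∀ {x y z} → x ≢ 0# → x * y ≡ x * z → y ≡ z
  *-cancelˡ {x} {y} {z} x≢0 e = difference≡0⇒≡ (integral (begin
    x * (y - z) ≡⟨ solve 3 (λ x y z → x :* (y :- z) := x :* y :- x :* z) refl x y z ⟩
    x * y - x * z ≡⟨ ≡⇒difference≡0 e ⟩
    0# ∎) x≢0)
    where open ≡-Reasoning

  ^-≢0 : ∀ {x} n → x ≢ 0# → x ^ n ≢ 0#
  ^-≢0 zero x≢0 e = 0≢1# (sym e)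
  ^-≢0 (suc n) x≢0 = product≢0 x≢0 (^-≢0 n x≢0)

  ^-≡0 : ∀ {x} n → x ^ n ≡ 0# → x ≡ 0#
  ^-≡0 {x} n e with x ≟ 0#
  ... | yes x≡0 = x≡0
  ... | no x≢0 = ⊥-elim (^-≢0 n x≢0 e)

  abstract
    -- With the convention that 0 is its own inverse, w ↦ d * w ⁻¹ is an involution of the whole
    -- field, as the substitution in `sum-correlation` requires.
    _⁻¹ : Fin q → Fin q
    x ⁻¹ with x ≟ 0#
    ... | yes _ = 0#
    ... | no x≢0 = proj₁ (inverse x x≢0)

    *-inverseʳ : ∀ {x} → x ≢ 0# → x * x ⁻¹ ≡ 1#
    *-inverseʳ {x} x≢0 with x ≟ 0#
    ... | yes x≡0 = ⊥-elim (x≢0 x≡0)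
    ... | no x≢0 = proj₂ (inverse x x≢0)

    0⁻¹≡0 : 0# ⁻¹ ≡ 0#
    0⁻¹≡0 with 0# ≟ 0#
    ... | yes _ = refl
    ... | no ne = ⊥-elim (ne refl)

  *-inverse-cancelˡ : ∀ {x} → x ≢ 0# → ∀ y → x * (x ⁻¹ * y) ≡ y
  *-inverse-cancelˡ {x} x≢0 y = trans (sym (*-assoc x (x ⁻¹) y)) (trans (cong (_* y) (*-inverseʳ x≢0)) (*-identityˡ y))

  *-inverse-cancelʳ : ∀ {x} → x ≢ 0# → ∀ y → x ⁻¹ * (x * y) ≡ y
  *-inverse-cancelʳ {x} x≢0 y = trans (solve 3 (λ x i y → i :* (x :* y) := x :* (i :* y)) refl x (x ⁻¹) y) (*-inverse-cancelˡ x≢0 y)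

  ⁻¹-≢0 : ∀ {x} → x ≢ 0# → x ⁻¹ ≢ 0#
  ⁻¹-≢0 {x} x≢0 e = 0≢1# (trans (sym (zeroʳ x)) (trans (cong (x *_) (sym e)) (*-inverseʳ x≢0)))

  scaling : ∀ {x} → x ≢ 0# → Permutation q q
  scaling {x} x≢0 = permutation (x *_) (x ⁻¹ *_) (*-inverse-cancelˡ x≢0) (*-inverse-cancelʳ x≢0)

  -- The product of all nonzero y equals the product of all x y, which gives x ^ (q - 1) = 1
  -- up to the factor coming from y = 0.
  x^q≡x : ∀ x → x ^ q ≡ x
  x^q≡x x with x ≟ 0#
  ... | yes refl = 0^q≡0 x
    where
    0^q≡0 : ∀ {m} → Fin m → 0# ^ m ≡ 0#
    0^q≡0 {suc m} _ = zeroˡ _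
  ... | no x≢0 = begin
    x ^ q ≡⟨ sum-replicate q {x} ⟨
    ∏ {q} (λ _ → x) ≡⟨ sum-cong-≗ {q} split ⟩
    ∏ (λ y → at-0 y * off-0 y) ≡⟨ ∑-distrib-+ at-0 off-0 ⟩
    ∏ at-0 * ∏ off-0 ≡⟨ cong₂ _*_ (sum-point *-commutativeMonoid 0# x) off-0≡1 ⟩
    x * 1# ≡⟨ *-identityʳ x ⟩
    x ∎
    where
    open ≡-Reasoning
    open Algebra.Properties.CommutativeMonoid.Sum *-commutativeMonoid renaming (sum to ∏)
    at-0 off-0 units : Fin q → Fin q
    at-0 y = if does (y ≟ 0#) then x else 1#
    off-0 y = if does (y ≟ 0#) then 1# else x
    units y = if does (y ≟ 0#) then 1# else y
    split : ∀ y → x ≡ at-0 y * off-0 y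
    split y with y ≟ 0#
    ... | yes _ = sym (*-identityʳ x)
    ... | no _ = sym (*-identityˡ x)
    units-scaled : ∀ y → units (x * y) ≡ off-0 y * units y
    units-scaled y with y ≟ 0# | (x * y) ≟ 0#
    ... | yes _ | yes _ = sym (*-identityˡ 1#)
    ... | yes y≡0 | no xy≢0 = ⊥-elim (xy≢0 (trans (cong (x *_) y≡0) (zeroʳ x)))
    ... | no y≢0 | yes xy≡0 = ⊥-elim (product≢0 x≢0 y≢0 xy≡0)
    ... | no _ | no _ = refl
    units≢0 : ∀ y → units y ≢ 0#
    units≢0 y with y ≟ 0#
    ... | yes _ = 0≢1# ∘ sym
    ... | no y≢0 = y≢0
    ∏≢0 : ∀ {m} (f : Fin m → Fin q) → (∀ i → f i ≢ 0#) → ∏ f ≢ 0#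
    ∏≢0 {zero} f f≢0 = 0≢1# ∘ sym
    ∏≢0 {suc m} f f≢0 = product≢0 (f≢0 zero) (∏≢0 (f ∘ suc) (f≢0 ∘ suc))
    off-0≡1 : ∏ off-0 ≡ 1#
    off-0≡1 = *-cancelˡ (∏≢0 units units≢0) (begin
      ∏ units * ∏ off-0 ≡⟨ *-comm _ _ ⟩
      ∏ off-0 * ∏ units ≡⟨ ∑-distrib-+ off-0 units ⟨
      ∏ (λ y → off-0 y * units y) ≡⟨ sum-cong-≗ units-scaled ⟨
      ∏ (λ y → units (x * y)) ≡⟨ ∑-permute units (scaling x≢0) ⟨
      ∏ units ≡⟨ *-identityʳ _ ⟨
      ∏ units * 1# ∎)

  -- The value at y of the monic polynomial with the given lower coefficients, constant term first.
  monic : ∀ {d} → Vec (Fin q) d → Fin q → Fin q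
  monic [] y = 1#
  monic (c ∷ v) y = c + y * monic v y

  private
    -- The second polynomial has smaller degree, so the leading coefficient is untouched and the
    -- result is again monic.
    add-scaled : ∀ {d} → Fin q → Vec (Fin q) (suc d) → Vec (Fin q) d → Vec (Fin q) (suc d)
    add-scaled r (a ∷ []) [] = (a + r) ∷ []
    add-scaled r (a ∷ v) (b ∷ w) = (a + r * b) ∷ add-scaled r v w

    monic-add-scaled : ∀ {d} r (v : Vec (Fin q) (suc d)) w y → monic (add-scaled r v w) y ≡ monic v y + r * monic w y
    monic-add-scaled r (a ∷ []) [] y = trans
      (cong (λ z → a + z + y * 1#) (sym (*-identityʳ r)))
      (solve 4 (λ a r y e → (a :+ r :* e) :+ y :* e := (a :+ y :* e) :+ r :* e) refl a r y 1#)
    monic-add-scaled r (a ∷ a′ ∷ v) (b ∷ w) y = trans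
      (cong (λ m → a + r * b + y * m) (monic-add-scaled r (a′ ∷ v) w y))
      (solve 6 (λ a r b y m m′ → a :+ r :* b :+ y :* (m :+ r :* m′) := (a :+ y :* m) :+ r :* (b :+ y :* m′)) refl
        a r b y (monic (a′ ∷ v) y) (monic w y))

  -- Synthetic division by y - r. Writing v = a + y m, the difference of values is (y - r) m(y) + r
  -- (m(y) - m(r)), and the second summand is divisible by induction.
  monic-divide : ∀ {d} (v : Vec (Fin q) (suc d)) r →
    Σ (Vec (Fin q) d) λ w → ∀ y → monic v y - monic v r ≡ (y - r) * monic w y
  monic-divide (a ∷ []) r = [] , λ y → solve 4 (λ a r y e → (a :+ y :* e) :- (a :+ r :* e) := (y :- r) :* e) refl a r y 1#
  monic-divide (a ∷ a′ ∷ v) r with monic-divide (a′ ∷ v) r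
  ... | w , w-quotient = add-scaled r (a′ ∷ v) w , λ y → let m = monic (a′ ∷ v) in begin
    (a + y * m y) - (a + r * m r) ≡⟨ solve 5 (λ a r y m n → (a :+ y :* m) :- (a :+ r :* n) := (y :- r) :* m :+ r :* (m :- n)) refl a r y (m y) (m r) ⟩
    (y - r) * m y + r * (m y - m r) ≡⟨ cong (λ z → (y - r) * m y + r * z) (w-quotient y) ⟩
    (y - r) * m y + r * ((y - r) * monic w y) ≡⟨ solve 4 (λ d r m n → d :* m :+ r :* (d :* n) := d :* (m :+ r :* n)) refl (y - r) r (m y) (monic w y) ⟩
    (y - r) * (m y + r * monic w y) ≡⟨ cong ((y - r) *_) (monic-add-scaled r (a′ ∷ v) w y) ⟨
    (y - r) * monic (add-scaled r (a′ ∷ v) w) y ∎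
    where open ≡-Reasoning

  monic-roots : ∀ {d} (v : Vec (Fin q) d) (f : Fin (suc d) → Fin q) → (∀ {i j} → f i ≡ f j → i ≡ j) →
    ¬ (∀ i → monic v (f i) ≡ 0#)
  monic-roots [] f f-injective root = 0≢1# (sym (root zero))
  monic-roots {suc d} v f f-injective root with monic-divide v (f zero)
  ... | w , w-quotient = monic-roots w (f ∘ suc) (λ e → suc-injective (f-injective e)) λ i →
    integral
      (trans (sym (w-quotient (f (suc i)))) (≡⇒difference≡0 (trans (root (suc i)) (sym (root zero)))))
      (λ e → case f-injective (difference≡0⇒≡ e) of λ ())

  -- The source of elements with prescribed properties in a field of which only the order is known:
  -- it yields the non-square `g` and the roots in `root-exists` and `binomial-root-exists`.
  monic-nonroot : ∀ {d} → d ℕ.< q → (v : Vec (Fin q) d) → ∃[ y ] monic v y ≢ 0#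
  monic-nonroot d<q v = ¬∀⟶∃¬ q _ (λ y → monic v y ≟ 0#) λ root →
    monic-roots v (λ i → inject≤ i d<q) (inject≤-injective d<q d<q _ _) (λ i → root _)

open Algebra.Properties.Semiring.Sum ℕₚ.+-*-semiring using (sum; sum-cong-≗; ∑-comm; ∑-distrib-+; ∑-permute; *-distribˡ-sum; *-distribʳ-sum)

-- Sums and indicators

ind : ∀ {p} {P : Set p} → Dec P → ℕ
ind d = if does d then 1 else 0

ind-true : ∀ {p} {P : Set p} (d : Dec P) → P → ind d ≡ 1
ind-true (yes _) _ = refl
ind-true (no ¬p) p = ⊥-elim (¬p p)

ind-false : ∀ {p} {P : Set p} (d : Dec P) → ¬ P → ind d ≡ 0
ind-false (yes p) ¬p = ⊥-elim (¬p p)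
ind-false (no _) _ = refl

ind-⇔ : ∀ {p r} {P : Set p} {R : Set r} (d : Dec P) (e : Dec R) → (P → R) → (R → P) → ind d ≡ ind e
ind-⇔ (yes p) e f g = sym (ind-true e (f p))
ind-⇔ (no ¬p) e f g = sym (ind-false e (¬p ∘ g))

sum-zero : ∀ {m} (f : Fin m → ℕ) → (∀ i → f i ≡ 0) → sum f ≡ 0
sum-zero {zero} f f≡0 = refl
sum-zero {suc m} f f≡0 = cong₂ ℕ._+_ (f≡0 zero) (sum-zero (f ∘ suc) (f≡0 ∘ suc))

sum-const : ∀ m c → sum {m} (λ _ → c) ≡ m ℕ.* c
sum-const zero c = refl
sum-const (suc m) c = cong (c ℕ.+_) (sum-const m c)

sum-ind : ∀ {m} (a : Fin m) (f : Fin m → ℕ) → sum (λ y → ind (y ≟ a) ℕ.* f y) ≡ f a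
sum-ind a f = trans (sum-cong-≗ {_} {λ y → ind (y ≟ a) ℕ.* f y} eq) (sum-point ℕₚ.+-0-commutativeMonoid a (f a))
  where
  eq : ∀ y → ind (y ≟ a) ℕ.* f y ≡ (if does (y ≟ a) then f a else 0)
  eq y with y ≟ a
  ... | yes refl = ℕₚ.*-identityˡ (f a)
  ... | no _ = refl

sum-ind₁ : ∀ {m} (a : Fin m) → sum (λ y → ind (y ≟ a)) ≡ 1
sum-ind₁ a = trans (sum-cong-≗ {_} {λ y → ind (y ≟ a)} (λ y → sym (ℕₚ.*-identityʳ _))) (sum-ind a (λ _ → 1))

sum-+ : ∀ {m} (f g : Fin m → ℕ) → sum (λ i → f i ℕ.+ g i) ≡ sum f ℕ.+ sum g
sum-+ = ∑-distrib-+

sum-cong : ∀ {m} {f g : Fin m → ℕ} → (∀ i → f i ≡ g i) → sum f ≡ sum g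
sum-cong {m} {f} {g} = sum-cong-≗ {m} {f} {g}

total : ∀ {a} {A : Set a} → (A → ℕ) → List A → ℕ
total f [] = 0
total f (x ∷ xs) = f x ℕ.+ total f xs

total-filter : ∀ {a p} {A : Set a} {P : Pred A p} (P? : Decidable P) (f : A → ℕ) {m} (h : Fin m → A) →
  total f (filter P? (tabulate h)) ≡ sum (λ i → ind (P? (h i)) ℕ.* f (h i))
total-filter P? f {zero} h = refl
total-filter P? f {suc m} h with P? (h zero)
... | yes _ = cong₂ ℕ._+_ (sym (ℕₚ.*-identityˡ _)) (total-filter P? f (h ∘ suc))
... | no _ = total-filter P? f (h ∘ suc)

total-+ : ∀ {a} {A : Set a} (f g : A → ℕ) xs → total (λ x → f x ℕ.+ g x) xs ≡ total f xs ℕ.+ total g xs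
total-+ f g [] = refl
total-+ f g (x ∷ xs) = trans (cong (f x ℕ.+ g x ℕ.+_) (total-+ f g xs)) (interchange (f x) (g x) _ _)
  where
  interchange : ∀ a b c d → a ℕ.+ b ℕ.+ (c ℕ.+ d) ≡ (a ℕ.+ c) ℕ.+ (b ℕ.+ d)
  interchange = solve-∀

total-cong : ∀ {a} {A : Set a} {f g : A → ℕ} → (∀ x → f x ≡ g x) → ∀ xs → total f xs ≡ total g xs
total-cong e [] = refl
total-cong e (x ∷ xs) = cong₂ ℕ._+_ (e x) (total-cong e xs)

total-zero : ∀ {a} {A : Set a} (xs : List A) → total (λ _ → 0) xs ≡ 0
total-zero [] = refl
total-zero (x ∷ xs) = total-zero xs

length-total : ∀ {a} {A : Set a} (xs : List A) → length xs ≡ total (λ _ → 1) xs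
length-total [] = refl
length-total (x ∷ xs) = cong suc (length-total xs)

-- Cosets of the fourth powers

module QuarticClasses (n : ℕ) (0<n : 0 ℕ.< n) (F : FieldOn (8 ℕ.* n ℕ.+ 1)) where
  open FieldTheory F public

  q : ℕ
  q = 8 ℕ.* n ℕ.+ 1

  x^8n≡1 : ∀ {x} → x ≢ 0# → x ^ (8 ℕ.* n) ≡ 1#
  x^8n≡1 {x} x≢0 = *-cancelˡ x≢0 (begin
    x * x ^ (8 ℕ.* n) ≡⟨ cong (x ^_) (ℕₚ.+-comm 1 (8 ℕ.* n)) ⟩
    x ^ q ≡⟨ x^q≡x x ⟩
    x ≡⟨ *-identityʳ x ⟨
    x * 1# ∎)
    where open ≡-Reasoning

  square-root-of-1 : ∀ {z} → z * z ≡ 1# → z ≢ 1# → z ≡ - 1#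
  square-root-of-1 {z} zz≡1 z≢1 = difference≡0⇒≡ (integral (begin
    (z - 1#) * (z - - 1#) ≡⟨ solve 2 (λ z e → (z :- e) :* (z :- :- e) := z :* z :- e :* e) refl z 1# ⟩
    z * z - 1# * 1# ≡⟨ ≡⇒difference≡0 (trans zz≡1 (sym (*-identityˡ 1#))) ⟩
    0# ∎) (z≢1 ∘ difference≡0⇒≡))
    where open ≡-Reasoning

  private abstract
    4n-1 : ∃[ d ] suc d ≡ 4 ℕ.* n
    4n-1 = go 0<n where
      go : ∀ {n} → 0 ℕ.< n → ∃[ d ] suc d ≡ 4 ℕ.* n
      go {suc n} _ = _ , refl

    -- The polynomial y (y^(4n) - 1) has degree 4n + 1 < q and cannot vanish everywhere. Its factor
    -- y makes the nonroot nonzero.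
    non-square-exists : ∃[ y ] (y ≢ 0# × y ^ (4 ℕ.* n) ≢ 1#)
    non-square-exists = from-nonroot (proj₁ 4n-1) (proj₂ 4n-1)
      (monic-nonroot (d+2<q (proj₂ 4n-1)) (0# ∷ (- 1#) ∷ Vec.replicate (proj₁ 4n-1) 0#))
      where
      eq : ∀ n → 1 ℕ.+ (4 ℕ.* n ℕ.+ 4 ℕ.* n) ≡ 8 ℕ.* n ℕ.+ 1
      eq = solve-∀
      d+2<q : ∀ {d} → suc d ≡ 4 ℕ.* n → suc (suc d) ℕ.< q
      d+2<q 1+d≡4n = ℕₚ.≤-trans (ℕₚ.≤-reflexive (cong (2 ℕ.+_) 1+d≡4n)) (ℕₚ.≤-trans
        (ℕₚ.+-monoʳ-≤ 1 (ℕₚ.m<m+n (4 ℕ.* n) (ℕₚ.*-mono-≤ {1} {4} (ℕ.s≤s ℕ.z≤n) 0<n)))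
        (ℕₚ.≤-reflexive (eq n)))
      monic-replicate : ∀ d y → monic (Vec.replicate d 0#) y ≡ y ^ d
      monic-replicate zero y = refl
      monic-replicate (suc d) y = trans (+-identityˡ _) (cong (y *_) (monic-replicate d y))
      from-nonroot : ∀ d → suc d ≡ 4 ℕ.* n → ∃[ y ] monic (0# ∷ (- 1#) ∷ Vec.replicate d 0#) y ≢ 0# →
        ∃[ y ] (y ≢ 0# × y ^ (4 ℕ.* n) ≢ 1#)
      from-nonroot d 1+d≡4n (y , nonroot) = y , factorˡ≢0 (nonroot ∘ trans (+-identityˡ _)) , λ e → nonroot (begin
        0# + y * (- 1# + y * monic (Vec.replicate d 0#) y) ≡⟨ cong (λ z → 0# + y * (- 1# + y * z)) (monic-replicate d y) ⟩
        0# + y * (- 1# + y ^ suc d) ≡⟨ cong (λ k → 0# + y * (- 1# + y ^ k)) 1+d≡4n ⟩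
        0# + y * (- 1# + y ^ (4 ℕ.* n)) ≡⟨ cong (λ z → 0# + y * (- 1# + z)) e ⟩
        0# + y * (- 1# + 1#) ≡⟨ +-identityˡ _ ⟩
        y * (- 1# + 1#) ≡⟨ cong (y *_) (-‿inverseˡ 1#) ⟩
        y * 0# ≡⟨ zeroʳ y ⟩
        0# ∎)
        where open ≡-Reasoning

  g : Fin q
  g = proj₁ non-square-exists

  g≢0 : g ≢ 0#
  g≢0 = proj₁ (proj₂ non-square-exists)

  g^4n≡-1 : g ^ (4 ℕ.* n) ≡ - 1#
  g^4n≡-1 = square-root-of-1 (begin
    g ^ (4 ℕ.* n) * g ^ (4 ℕ.* n) ≡⟨ ^-homo-* g (4 ℕ.* n) (4 ℕ.* n) ⟨
    g ^ (4 ℕ.* n ℕ.+ 4 ℕ.* n) ≡⟨ cong (g ^_) (eq n) ⟩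
    g ^ (8 ℕ.* n) ≡⟨ x^8n≡1 g≢0 ⟩
    1# ∎) (proj₂ (proj₂ non-square-exists))
    where
    open ≡-Reasoning
    eq : ∀ n → 4 ℕ.* n ℕ.+ 4 ℕ.* n ≡ 8 ℕ.* n
    eq = solve-∀

  1≢-1 : 1# ≢ - 1#
  1≢-1 e = proj₂ (proj₂ non-square-exists) (trans g^4n≡-1 (sym e))

  x≢-x : ∀ {x} → x ≢ 0# → x ≢ - x
  x≢-x {x} x≢0 e = 1≢-1 (*-cancelˡ x≢0 (begin
    x * 1# ≡⟨ *-identityʳ x ⟩
    x ≡⟨ e ⟩
    - x ≡⟨ cong -_ (*-identityʳ x) ⟨
    - (x * 1#) ≡⟨ -‿distribʳ-* x 1# ⟩
    x * - 1# ∎))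
    where open ≡-Reasoning

  -x≢0 : ∀ {x} → x ≢ 0# → - x ≢ 0#
  -x≢0 {x} x≢0 e = x≢0 (trans (sym (-‿involutive x)) (trans (cong -_ e) -0#≈0#))

  abstract
    -- The quartic residue character x^((q-1)/4) with values in F itself. On nonzero elements its
    -- fibres are the cosets of the group C of fourth powers.
    φ : Fin q → Fin q
    φ x = x ^ (2 ℕ.* n)

    φ-def : ∀ x → φ x ≡ x ^ (2 ℕ.* n)
    φ-def x = refl

    φ-* : ∀ x y → φ (x * y) ≡ φ x * φ y
    φ-* x y = ^-distrib-* x y (2 ℕ.* n)

    φ-1 : φ 1# ≡ 1#
    φ-1 = go (2 ℕ.* n) where
      go : ∀ m → 1# ^ m ≡ 1#
      go zero = refl
      go (suc m) = trans (*-identityˡ _) (go m)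

    φ-0 : φ 0# ≡ 0#
    φ-0 = go 0<n where
      go : ∀ {n} → 0 ℕ.< n → 0# ^ (2 ℕ.* n) ≡ 0#
      go {suc n} _ = zeroˡ _

    φ-≢0 : ∀ {x} → x ≢ 0# → φ x ≢ 0#
    φ-≢0 = ^-≢0 (2 ℕ.* n)

    -- The exponent 2n is even because q is 1 modulo 8 and not merely modulo 4. Hence -1 lies in C,
    -- and C splits into pairs s, -s.
    φ-neg : ∀ x → φ (- x) ≡ φ x
    φ-neg x = begin
      φ (- x) ≡⟨ ^-assocʳ (- x) 2 n ⟨
      ((- x) ^ 2) ^ n ≡⟨ cong (_^ n) (solve 2 (λ x e → :- x :* (:- x :* e) := x :* (x :* e)) refl x 1#) ⟩
      (x ^ 2) ^ n ≡⟨ ^-assocʳ x 2 n ⟩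
      φ x ∎
      where open ≡-Reasoning

    φ⁴≡1 : ∀ {x} → x ≢ 0# → (φ x * φ x) * (φ x * φ x) ≡ 1#
    φ⁴≡1 {x} x≢0 = begin
      (φ x * φ x) * (φ x * φ x) ≡⟨ cong₂ _*_ (^-homo-* x (2 ℕ.* n) (2 ℕ.* n)) (^-homo-* x (2 ℕ.* n) (2 ℕ.* n)) ⟨
      x ^ m * x ^ m ≡⟨ ^-homo-* x m m ⟨
      x ^ (m ℕ.+ m) ≡⟨ cong (x ^_) (eq n) ⟩
      x ^ (8 ℕ.* n) ≡⟨ x^8n≡1 x≢0 ⟩
      1# ∎
      where
      open ≡-Reasoning
      m : ℕ
      m = 2 ℕ.* n ℕ.+ 2 ℕ.* n
      eq : ∀ n → 2 ℕ.* n ℕ.+ 2 ℕ.* n ℕ.+ (2 ℕ.* n ℕ.+ 2 ℕ.* n) ≡ 8 ℕ.* n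
      eq = solve-∀

  -- The root of -1 is a parameter because the counting arguments use `φ g`, whereas a tabulated
  -- witness brings a root of its own, found by computation. The two may differ by a sign.
  module FourthRoots (J : Fin q) (JJ≡-1 : J * J ≡ - 1#) where

    ρ : Fin 4 → Fin q
    ρ 0F = 1#
    ρ 1F = J
    ρ 2F = - 1#
    ρ 3F = - J

    J≢0 : J ≢ 0#
    J≢0 J≡0 = -x≢0 (0≢1# ∘ sym) (trans (sym JJ≡-1) (trans (cong (_* J) J≡0) (zeroˡ J)))

    ρ≢0 : ∀ j → ρ j ≢ 0#
    ρ≢0 0F = 0≢1# ∘ sym
    ρ≢0 1F = J≢0
    ρ≢0 2F = -x≢0 (0≢1# ∘ sym)
    ρ≢0 3F = -x≢0 J≢0

    private
      J≢1 : J ≢ 1#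
      J≢1 J≡1 = 1≢-1 (trans (sym (*-identityʳ 1#)) (trans (cong (λ x → x * x) (sym J≡1)) JJ≡-1))
      J≢-1 : J ≢ - 1#
      J≢-1 e = 1≢-1 (trans (sym (*-identityʳ 1#)) (trans (solve 1 (λ x → x :* x := :- x :* :- x) refl 1#)
        (trans (cong (λ x → x * x) (sym e)) JJ≡-1)))
      neg : ∀ {x y} → - x ≡ y → x ≡ - y
      neg {x} e = trans (sym (-‿involutive x)) (cong -_ e)

    ρ-injective : ∀ {i j} → ρ i ≡ ρ j → i ≡ j
    ρ-injective {0F} {0F} e = refl
    ρ-injective {0F} {1F} e = ⊥-elim (J≢1 (sym e))
    ρ-injective {0F} {2F} e = ⊥-elim (1≢-1 e)
    ρ-injective {0F} {3F} e = ⊥-elim (J≢-1 (neg (sym e)))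
    ρ-injective {1F} {0F} e = ⊥-elim (J≢1 e)
    ρ-injective {1F} {1F} e = refl
    ρ-injective {1F} {2F} e = ⊥-elim (J≢-1 e)
    ρ-injective {1F} {3F} e = ⊥-elim (x≢-x J≢0 e)
    ρ-injective {2F} {0F} e = ⊥-elim (1≢-1 (sym e))
    ρ-injective {2F} {1F} e = ⊥-elim (J≢-1 (sym e))
    ρ-injective {2F} {2F} e = refl
    ρ-injective {2F} {3F} e = ⊥-elim (J≢1 (trans (neg (sym e)) (-‿involutive 1#)))
    ρ-injective {3F} {0F} e = ⊥-elim (J≢-1 (neg e))
    ρ-injective {3F} {1F} e = ⊥-elim (x≢-x J≢0 (sym e))
    ρ-injective {3F} {2F} e = ⊥-elim (J≢1 (trans (neg e) (-‿involutive 1#)))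
    ρ-injective {3F} {3F} e = refl

    -- The square of φ x is 1 or -1 = J * J, and in a field a square has at most two roots, which
    -- differ by sign.
    φ-range : ∀ {x} → x ≢ 0# → ∃[ j ] φ x ≡ ρ j
    φ-range {x} x≢0 with φ x * φ x ≟ 1#
    ... | yes e with φ x ≟ 1#
    ...   | yes φ≡1 = 0F , φ≡1
    ...   | no φ≢1 = 2F , square-root-of-1 e φ≢1
    φ-range {x} x≢0 | no ne with φ x ≟ J
    ...   | yes φ≡J = 1F , φ≡J
    ...   | no φ≢J = 3F , difference≡0⇒≡ (integral (begin
      (φ x - J) * (φ x - - J) ≡⟨ solve 2 (λ z e → (z :- e) :* (z :- :- e) := z :* z :- e :* e) refl (φ x) J ⟩
      φ x * φ x - J * J ≡⟨ ≡⇒difference≡0 (trans (square-root-of-1 (φ⁴≡1 x≢0) ne) (sym JJ≡-1)) ⟩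
      0# ∎) (φ≢J ∘ difference≡0⇒≡))
      where open ≡-Reasoning

  -- The condition of lying in four different cosets, put as a counting identity that can be summed
  -- over `S`. It mentions no root of -1, so it does not depend on how the cosets are labelled.
  Spread : Fin q → Fin q → Fin q → Fin q → Set
  Spread a b c d = ∀ {x} → x ≢ 0# →
    ind (φ x ≟ φ a) ℕ.+ (ind (φ x ≟ φ b) ℕ.+ (ind (φ x ≟ φ c) ℕ.+ ind (φ x ≟ φ d))) ≡ 1

  -- "Pure" differences join points with equal first coordinates, "mixed" ones join points with
  -- different first coordinates. The differences a₀ - a₁ and a₂ - a₃ serve in both lists.
  record Witness : Set where
    field
      a₀ a₁ a₂ a₃ : Fin q
      a₀≢0 : a₀ ≢ 0#
      a₁≢0 : a₁ ≢ 0#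
      a₂≢0 : a₂ ≢ 0#
      a₃≢0 : a₃ ≢ 0#
      a₀≢a₁ : a₀ - a₁ ≢ 0#
      a₀≢a₂ : a₀ - a₂ ≢ 0#
      a₁≢a₂ : a₁ - a₂ ≢ 0#
      a₀≢a₃ : a₀ - a₃ ≢ 0#
      a₁≢a₃ : a₁ - a₃ ≢ 0#
      a₂≢a₃ : a₂ - a₃ ≢ 0#
      spread-elements : Spread a₀ a₁ a₂ a₃
      spread-pure : Spread (a₀ - a₁) (a₀ - a₂) (a₁ - a₂) (a₂ - a₃)
      spread-mixed : Spread (a₀ - a₃) (a₁ - a₃) (a₂ - a₃) (a₀ - a₁)

  module _ {J : Fin q} (JJ≡-1 : J * J ≡ - 1#) where
    open FourthRoots J JJ≡-1

    spread : ∀ {a b c d} i j k l → φ a ≡ ρ i → φ b ≡ ρ j → φ c ≡ ρ k → φ d ≡ ρ l →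
      (∀ m → ind (m ≟ i) ℕ.+ (ind (m ≟ j) ℕ.+ (ind (m ≟ k) ℕ.+ ind (m ≟ l))) ≡ 1) → Spread a b c d
    spread i j k l φa φb φc φd cover {x} x≢0 with φ-range x≢0
    ... | m , φx rewrite φx | φa | φb | φc | φd = trans
      (cong₂ ℕ._+_ (eq i) (cong₂ ℕ._+_ (eq j) (cong₂ ℕ._+_ (eq k) (eq l)))) (cover m)
      where
      eq : ∀ i → ind (ρ m ≟ ρ i) ≡ ind (m ≟ i)
      eq i = ind-⇔ (ρ m ≟ ρ i) (m ≟ i) ρ-injective (cong ρ)

    -- Since φ 0 = 0 is no root of unity, all inequalities in a `Witness` follow from equations. A
    -- computation therefore has to establish equations only.
    φ≡ρ⇒≢0 : ∀ {x} j → φ x ≡ ρ j → x ≢ 0#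
    φ≡ρ⇒≢0 j e refl = ρ≢0 j (trans (sym e) φ-0)

    witness : ∀ a₀ a₁ a₂ a₃ i₀ i₁ i₂ i₃ j₀₁ j₀₂ j₁₂ j₀₃ j₁₃ j₂₃ →
      φ a₀ ≡ ρ i₀ → φ a₁ ≡ ρ i₁ → φ a₂ ≡ ρ i₂ → φ a₃ ≡ ρ i₃ →
      φ (a₀ - a₁) ≡ ρ j₀₁ → φ (a₀ - a₂) ≡ ρ j₀₂ → φ (a₁ - a₂) ≡ ρ j₁₂ →
      φ (a₀ - a₃) ≡ ρ j₀₃ → φ (a₁ - a₃) ≡ ρ j₁₃ → φ (a₂ - a₃) ≡ ρ j₂₃ →
      (∀ m → ind (m ≟ i₀) ℕ.+ (ind (m ≟ i₁) ℕ.+ (ind (m ≟ i₂) ℕ.+ ind (m ≟ i₃))) ≡ 1) →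
      (∀ m → ind (m ≟ j₀₁) ℕ.+ (ind (m ≟ j₀₂) ℕ.+ (ind (m ≟ j₁₂) ℕ.+ ind (m ≟ j₂₃))) ≡ 1) →
      (∀ m → ind (m ≟ j₀₃) ℕ.+ (ind (m ≟ j₁₃) ℕ.+ (ind (m ≟ j₂₃) ℕ.+ ind (m ≟ j₀₁))) ≡ 1) →
      Witness
    witness a₀ a₁ a₂ a₃ i₀ i₁ i₂ i₃ j₀₁ j₀₂ j₁₂ j₀₃ j₁₃ j₂₃ e₀ e₁ e₂ e₃ e₀₁ e₀₂ e₁₂ e₀₃ e₁₃ e₂₃ c c′ c″ = record
      { a₀ = a₀ ; a₁ = a₁ ; a₂ = a₂ ; a₃ = a₃
      ; a₀≢0 = φ≡ρ⇒≢0 i₀ e₀ ; a₁≢0 = φ≡ρ⇒≢0 i₁ e₁ ; a₂≢0 = φ≡ρ⇒≢0 i₂ e₂ ; a₃≢0 = φ≡ρ⇒≢0 i₃ e₃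
      ; a₀≢a₁ = φ≡ρ⇒≢0 j₀₁ e₀₁ ; a₀≢a₂ = φ≡ρ⇒≢0 j₀₂ e₀₂ ; a₁≢a₂ = φ≡ρ⇒≢0 j₁₂ e₁₂
      ; a₀≢a₃ = φ≡ρ⇒≢0 j₀₃ e₀₃ ; a₁≢a₃ = φ≡ρ⇒≢0 j₁₃ e₁₃ ; a₂≢a₃ = φ≡ρ⇒≢0 j₂₃ e₂₃
      ; spread-elements = spread i₀ i₁ i₂ i₃ e₀ e₁ e₂ e₃ c
      ; spread-pure = spread j₀₁ j₀₂ j₁₂ j₂₃ e₀₁ e₀₂ e₁₂ e₂₃ c′
      ; spread-mixed = spread j₀₃ j₁₃ j₂₃ j₀₁ e₀₃ e₁₃ e₂₃ e₀₁ c″ }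

  abstract
    I : Fin q
    I = φ g

    φg≡I : φ g ≡ I
    φg≡I = refl

    I²≡-1 : I * I ≡ - 1#
    I²≡-1 = trans (cong (λ z → z * z) (φ-def g)) (trans (sym (^-homo-* g (2 ℕ.* n) (2 ℕ.* n))) (trans (cong (g ^_) (eq n)) g^4n≡-1))
      where
      eq : ∀ n → 2 ℕ.* n ℕ.+ 2 ℕ.* n ≡ 4 ℕ.* n
      eq = solve-∀

  open FourthRoots I I²≡-1 public

  -- indicator of the coset of g ^ j modulo fourth powers
  In : Fin 4 → Fin q → ℕ
  In j x = ind (φ x ≟ ρ j)

  In-zero : ∀ j → In j 0# ≡ 0
  In-zero j = ind-false (φ 0# ≟ ρ j) λ e → ρ≢0 j (trans (sym e) φ-0)

  In-total : ∀ x → In 0F x ℕ.+ (In 1F x ℕ.+ (In 2F x ℕ.+ In 3F x)) ≡ ind (¬? (x ≟ 0#))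
  In-total x = go (x ≟ 0#)
    where
    eq : ∀ {m} → φ x ≡ ρ m → ∀ i → In i x ≡ ind (m ≟ i)
    eq {m} e i = ind-⇔ (φ x ≟ ρ i) (m ≟ i) (ρ-injective ∘ trans (sym e)) (trans e ∘ cong ρ)
    each : ∀ m → ind (m ≟ 0F) ℕ.+ (ind (m ≟ 1F) ℕ.+ (ind (m ≟ 2F) ℕ.+ ind (m ≟ 3F))) ≡ 1
    each 0F = refl
    each 1F = refl
    each 2F = refl
    each 3F = refl
    zero′ : ∀ j → x ≡ 0# → In j x ≡ 0
    zero′ j x≡0 = trans (cong (In j) x≡0) (In-zero j)
    from-range : ∃[ m ] φ x ≡ ρ m → In 0F x ℕ.+ (In 1F x ℕ.+ (In 2F x ℕ.+ In 3F x)) ≡ 1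
    from-range (m , e) = trans (cong₂ ℕ._+_ (eq {m} e 0F) (cong₂ ℕ._+_ (eq {m} e 1F) (cong₂ ℕ._+_ (eq {m} e 2F) (eq {m} e 3F)))) (each m)
    go : (d : Dec (x ≡ 0#)) → In 0F x ℕ.+ (In 1F x ℕ.+ (In 2F x ℕ.+ In 3F x)) ≡ ind (¬? d)
    go (yes x≡0) = cong₂ ℕ._+_ (zero′ 0F x≡0) (cong₂ ℕ._+_ (zero′ 1F x≡0) (cong₂ ℕ._+_ (zero′ 2F x≡0) (zero′ 3F x≡0)))
    go (no x≢0) = from-range (φ-range x≢0)

  sum-≢ : ∀ {m} (a : Fin (m ℕ.+ 1)) → sum (λ x → ind (¬? (x ≟ a))) ≡ m
  sum-≢ {m} a = ℕₚ.+-cancelʳ-≡ 1 _ _ (begin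
    sum (λ x → ind (¬? (x ≟ a))) ℕ.+ 1 ≡⟨ cong (sum (λ x → ind (¬? (x ≟ a))) ℕ.+_) (sum-ind₁ a) ⟨
    sum (λ x → ind (¬? (x ≟ a))) ℕ.+ sum (λ x → ind (x ≟ a)) ≡⟨ sum-+ (λ x → ind (¬? (x ≟ a))) (λ x → ind (x ≟ a)) ⟨
    sum (λ x → ind (¬? (x ≟ a)) ℕ.+ ind (x ≟ a)) ≡⟨ sum-cong one ⟩
    sum {m ℕ.+ 1} (λ _ → 1) ≡⟨ sum-const (m ℕ.+ 1) 1 ⟩
    (m ℕ.+ 1) ℕ.* 1 ≡⟨ ℕₚ.*-identityʳ _ ⟩
    m ℕ.+ 1 ∎)
    where
    open ≡-Reasoning
    one : ∀ x → ind (¬? (x ≟ a)) ℕ.+ ind (x ≟ a) ≡ 1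
    one x with x ≟ a
    ... | yes _ = refl
    ... | no _ = refl

  private
    -- Multiplication by g multiplies φ by I and so permutes the four cosets cyclically. Hence they
    -- share the 8n nonzero elements equally.
    shift : ∀ i j → ρ j ≡ I * ρ i → sum (In j) ≡ sum (In i)
    shift i j e = trans (∑-permute (In j) (scaling g≢0)) (sum-cong λ x →
      ind-⇔ (φ (g * x) ≟ ρ j) (φ x ≟ ρ i)
        (λ e′ → *-cancelˡ J≢0 (trans (cong (_* φ x) (sym φg≡I)) (trans (sym (φ-* g x)) (trans e′ e))))
        (λ e′ → trans (φ-* g x) (trans (cong₂ _*_ φg≡I e′) (sym e))))

  class-size : ∀ j → sum (In j) ≡ 2 ℕ.* n
  class-size j = trans (same j) (ℕₚ.*-cancelˡ-≡ (sum (In 0F)) (2 ℕ.* n) 4 (begin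
    4 ℕ.* sum (In 0F) ≡⟨ four (sum (In 0F)) ⟩
    sum (In 0F) ℕ.+ (sum (In 0F) ℕ.+ (sum (In 0F) ℕ.+ sum (In 0F))) ≡⟨ cong (sum (In 0F) ℕ.+_) (cong₂ ℕ._+_ (sym same₁) (cong₂ ℕ._+_ (sym same₂) (sym same₃))) ⟩
    sum (In 0F) ℕ.+ (sum (In 1F) ℕ.+ (sum (In 2F) ℕ.+ sum (In 3F))) ≡⟨ cong (sum (In 0F) ℕ.+_) (cong (sum (In 1F) ℕ.+_) (sum-+ (In 2F) (In 3F))) ⟨
    sum (In 0F) ℕ.+ (sum (In 1F) ℕ.+ sum (λ x → In 2F x ℕ.+ In 3F x)) ≡⟨ cong (sum (In 0F) ℕ.+_) (sum-+ (In 1F) _) ⟨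
    sum (In 0F) ℕ.+ sum (λ x → In 1F x ℕ.+ (In 2F x ℕ.+ In 3F x)) ≡⟨ sum-+ (In 0F) _ ⟨
    sum (λ x → In 0F x ℕ.+ (In 1F x ℕ.+ (In 2F x ℕ.+ In 3F x))) ≡⟨ sum-cong In-total ⟩
    sum (λ x → ind (¬? (x ≟ 0#))) ≡⟨ sum-≢ {8 ℕ.* n} 0# ⟩
    8 ℕ.* n ≡⟨ eight n ⟩
    4 ℕ.* (2 ℕ.* n) ∎))
    where
    open ≡-Reasoning
    four : ∀ m → 4 ℕ.* m ≡ m ℕ.+ (m ℕ.+ (m ℕ.+ m))
    four = solve-∀
    eight : ∀ n → 8 ℕ.* n ≡ 4 ℕ.* (2 ℕ.* n)
    eight = solve-∀
    same₁ : sum (In 1F) ≡ sum (In 0F)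
    same₁ = shift 0F 1F (sym (*-identityʳ I))
    same₂ : sum (In 2F) ≡ sum (In 0F)
    same₂ = trans (shift 1F 2F (sym I²≡-1)) same₁
    same₃ : sum (In 3F) ≡ sum (In 0F)
    same₃ = trans (shift 2F 3F (trans (cong -_ (sym (*-identityʳ I))) (-‿distribʳ-* I 1#))) same₂
    same : ∀ j → sum (In j) ≡ sum (In 0F)
    same 0F = refl
    same 1F = same₁
    same 2F = same₂
    same 3F = same₃

  -- The order of the representatives in `Fin q` is unrelated to the field structure; it merely
  -- selects one of s and -s.
  InS : Fin q → Set
  InS s = φ s ≡ 1# × toℕ s ℕ.< toℕ (- s)

  InS? : ∀ s → Dec (InS s)
  InS? s = (φ s ≟ 1#) ×-dec (toℕ s ℕ.<? toℕ (- s))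

  S : List (Fin q)
  S = filter InS? (tabulate λ s → s)

  private
    σ : Fin q → ℕ
    σ s = ind (InS? s)

    σ-pair : ∀ y → σ y ℕ.+ σ (- y) ≡ In 0F y
    σ-pair y = go (φ y ≟ 1#)
      where
      go : (d : Dec (φ y ≡ 1#)) → σ y ℕ.+ σ (- y) ≡ ind d
      go (no φy≢1) = cong₂ ℕ._+_ (ind-false (InS? y) (φy≢1 ∘ proj₁)) (ind-false (InS? (- y)) (φy≢1 ∘ trans (sym (φ-neg y)) ∘ proj₁))
      go (yes φy≡1) with ℕₚ.<-cmp (toℕ y) (toℕ (- y))
      ... | tri< lt _ _ = cong₂ ℕ._+_ (ind-true (InS? y) (φy≡1 , lt))
        (ind-false (InS? (- y)) λ (_ , gt) → ℕₚ.<-asym lt (subst (λ z → toℕ (- y) ℕ.< toℕ z) (-‿involutive y) gt))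
      ... | tri≈ _ eq _ = ⊥-elim (x≢-x (φ≡ρ⇒≢0 I²≡-1 0F φy≡1) (toℕ-injective eq))
      ... | tri> ¬lt _ gt = cong₂ ℕ._+_ (ind-false (InS? y) (¬lt ∘ proj₂))
        (ind-true (InS? (- y)) (trans (φ-neg y) φy≡1 , subst (λ z → toℕ (- y) ℕ.< toℕ z) (sym (-‿involutive y)) gt))

    negation : Permutation q q
    negation = permutation -_ -_ -‿involutive -‿involutive

  length-S : length S ≡ n
  length-S = ℕₚ.*-cancelˡ-≡ (length S) n 2 (begin
    2 ℕ.* length S ≡⟨ cong (2 ℕ.*_) (trans (length-total S) (trans (total-filter InS? (λ _ → 1) (λ s → s)) (sum-cong (λ s → ℕₚ.*-identityʳ (σ s))))) ⟩
    2 ℕ.* sum σ ≡⟨ cong (sum σ ℕ.+_) (ℕₚ.+-identityʳ (sum σ)) ⟩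
    sum σ ℕ.+ sum σ ≡⟨ cong (sum σ ℕ.+_) (∑-permute σ negation) ⟩
    sum σ ℕ.+ sum (λ s → σ (- s)) ≡⟨ sum-+ σ (λ s → σ (- s)) ⟨
    sum (λ s → σ s ℕ.+ σ (- s)) ≡⟨ sum-cong σ-pair ⟩
    sum (In 0F) ≡⟨ class-size 0F ⟩
    2 ℕ.* n ∎)
    where open ≡-Reasoning

  ± : Fin q → Fin q → Fin q → ℕ
  ± e x s = ind (x ≟ e * s) ℕ.+ ind (x ≟ - (e * s))

  -- Solving x = e s or x = - (e s) leaves the candidates y = x / e and - y for s. Exactly one of
  -- them is in `S` if y is a fourth power, and none otherwise.
  total-± : ∀ {e x} → e ≢ 0# → x ≢ 0# → total (± e x) S ≡ ind (φ x ≟ φ e)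
  total-± {e} {x} e≢0 x≢0 = begin
    total (± e x) S ≡⟨ total-filter InS? (± e x) (λ s → s) ⟩
    sum (λ s → σ s ℕ.* ± e x s) ≡⟨ sum-cong pointwise ⟩
    sum (λ s → ind (s ≟ y) ℕ.* σ s ℕ.+ ind (s ≟ - y) ℕ.* σ s) ≡⟨ sum-+ (λ s → ind (s ≟ y) ℕ.* σ s) (λ s → ind (s ≟ - y) ℕ.* σ s) ⟩
    sum (λ s → ind (s ≟ y) ℕ.* σ s) ℕ.+ sum (λ s → ind (s ≟ - y) ℕ.* σ s) ≡⟨ cong₂ ℕ._+_ (sum-ind y σ) (sum-ind (- y) σ) ⟩
    σ y ℕ.+ σ (- y) ≡⟨ σ-pair y ⟩
    In 0F y ≡⟨ ind-⇔ (φ y ≟ 1#) (φ x ≟ φ e) to from ⟩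
    ind (φ x ≟ φ e) ∎
    where
    open ≡-Reasoning
    y = e ⁻¹ * x
    ey≡x : e * y ≡ x
    ey≡x = *-inverse-cancelˡ e≢0 x
    φx : φ x ≡ φ e * φ y
    φx = trans (cong φ (sym ey≡x)) (φ-* e y)
    to : φ y ≡ 1# → φ x ≡ φ e
    to e′ = trans φx (trans (cong (φ e *_) e′) (*-identityʳ (φ e)))
    from : φ x ≡ φ e → φ y ≡ 1#
    from e′ = *-cancelˡ (φ-≢0 e≢0) (trans (sym φx) (trans e′ (sym (*-identityʳ (φ e)))))
    e-y : e * - y ≡ - x
    e-y = trans (sym (-‿distribʳ-* e y)) (cong -_ ey≡x)
    pointwise : ∀ s → σ s ℕ.* ± e x s ≡ ind (s ≟ y) ℕ.* σ s ℕ.+ ind (s ≟ - y) ℕ.* σ s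
    pointwise s = begin
      σ s ℕ.* ± e x s ≡⟨ cong (σ s ℕ.*_) (cong₂ ℕ._+_
        (ind-⇔ (x ≟ e * s) (s ≟ y) (λ e′ → *-cancelˡ e≢0 (trans (sym e′) (sym ey≡x))) (λ e′ → trans (sym ey≡x) (cong (e *_) (sym e′))))
        (ind-⇔ (x ≟ - (e * s)) (s ≟ - y)
          (λ e′ → *-cancelˡ e≢0 (trans (sym (-‿involutive _)) (trans (cong -_ (sym e′)) (sym e-y))))
          (λ e′ → trans (sym (-‿involutive x)) (cong -_ (trans (sym e-y) (cong (e *_) (sym e′))))))) ⟩
      σ s ℕ.* (ind (s ≟ y) ℕ.+ ind (s ≟ - y)) ≡⟨ dist (σ s) (ind (s ≟ y)) (ind (s ≟ - y)) ⟩
      ind (s ≟ y) ℕ.* σ s ℕ.+ ind (s ≟ - y) ℕ.* σ s ∎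
      where
      dist : ∀ a b c → a ℕ.* (b ℕ.+ c) ≡ b ℕ.* a ℕ.+ c ℕ.* a
      dist = solve-∀

  total-±-zero : ∀ {e} → e ≢ 0# → total (± e 0#) S ≡ 0
  total-±-zero {e} e≢0 = trans (total-filter InS? (± e 0#) (λ s → s)) (sum-zero _ λ s → vanish s (InS? s))
    where
    vanish : ∀ s (d : Dec (InS s)) → ind d ℕ.* ± e 0# s ≡ 0
    vanish s (no _) = refl
    vanish s (yes (φs≡1 , _)) = trans (ℕₚ.*-identityˡ _) (cong₂ ℕ._+_
      (ind-false (0# ≟ e * s) (es≢0 ∘ sym)) (ind-false (0# ≟ - (e * s)) (-x≢0 es≢0 ∘ sym)))
      where
      es≢0 : e * s ≢ 0#
      es≢0 = product≢0 e≢0 (φ≡ρ⇒≢0 I²≡-1 0F φs≡1)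

  ±₄ : Fin q → Fin q → Fin q → Fin q → Fin q → Fin q → ℕ
  ±₄ a b c d x s = ± a x s ℕ.+ (± b x s ℕ.+ (± c x s ℕ.+ ± d x s))

  private
    total-±₄ : ∀ a b c d x → total (±₄ a b c d x) S ≡
      total (± a x) S ℕ.+ (total (± b x) S ℕ.+ (total (± c x) S ℕ.+ total (± d x) S))
    total-±₄ a b c d x = trans (total-+ (± a x) _ S) (cong (total (± a x) S ℕ.+_)
      (trans (total-+ (± b x) _ S) (cong (total (± b x) S ℕ.+_) (total-+ (± c x) (± d x) S))))

  -- The elements of `S` and their negatives make up C, so the multiples of a by them form the coset
  -- a C, and likewise for b, c, d. These four cosets partition the nonzero elements. It is applied
  -- to the points and to both kinds of differences.
  spread-tiles : ∀ {a b c d} → a ≢ 0# → b ≢ 0# → c ≢ 0# → d ≢ 0# → Spread a b c d → ∀ x →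
    total (±₄ a b c d x) S ≡ ind (¬? (x ≟ 0#))
  spread-tiles {a} {b} {c} {d} a≢0 b≢0 c≢0 d≢0 spr x = trans (total-±₄ a b c d x) (go (x ≟ 0#))
    where
    go : (dec : Dec (x ≡ 0#)) → total (± a x) S ℕ.+ (total (± b x) S ℕ.+ (total (± c x) S ℕ.+ total (± d x) S)) ≡ ind (¬? dec)
    go (yes refl) = cong₂ ℕ._+_ (total-±-zero a≢0) (cong₂ ℕ._+_ (total-±-zero b≢0) (cong₂ ℕ._+_ (total-±-zero c≢0) (total-±-zero d≢0)))
    go (no x≢0) = trans (cong₂ ℕ._+_ (total-± a≢0 x≢0) (cong₂ ℕ._+_ (total-± b≢0 x≢0) (cong₂ ℕ._+_ (total-± c≢0 x≢0) (total-± d≢0 x≢0)))) (spr x≢0)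

-- Half systems

total-map : ∀ {a b} {A : Set a} {B : Set b} (f : B → ℕ) (h : A → B) xs → total f (map h xs) ≡ total (f ∘ h) xs
total-map f h [] = refl
total-map f h (x ∷ xs) = cong (f (h x) ℕ.+_) (total-map f h xs)

total-++ : ∀ {a} {A : Set a} (f : A → ℕ) xs ys → total f (xs ++ ys) ≡ total f xs ℕ.+ total f ys
total-++ f [] ys = refl
total-++ f (x ∷ xs) ys = trans (cong (f x ℕ.+_) (total-++ f xs ys)) (sym (ℕₚ.+-assoc (f x) _ _))

total-concatMap : ∀ {a b} {A : Set a} {B : Set b} (f : B → ℕ) (h : A → List B) xs →
  total f (concatMap h xs) ≡ total (λ x → total f (h x)) xs
total-concatMap f h [] = refl
total-concatMap f h (x ∷ xs) = trans (total-++ f (h x) _) (cong (total f (h x) ℕ.+_) (total-concatMap f h xs))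

total-concat : ∀ {a} {A : Set a} (f : A → ℕ) xss → total f (concat xss) ≡ total (total f) xss
total-concat f [] = refl
total-concat f (xs ∷ xss) = trans (total-++ f xs _) (cong (total f xs ℕ.+_) (total-concat f xss))

total-filter′ : ∀ {a p} {A : Set a} {P : Pred A p} (P? : Decidable P) (f : A → ℕ) xs →
  total f (filter P? xs) ≡ total (λ x → ind (P? x) ℕ.* f x) xs
total-filter′ P? f [] = refl
total-filter′ P? f (x ∷ xs) with P? x
... | yes _ = cong₂ ℕ._+_ (sym (ℕₚ.*-identityˡ _)) (total-filter′ P? f xs)
... | no _ = total-filter′ P? f xs

∈⇒≤-total : ∀ {a} {A : Set a} (f : A → ℕ) {x xs} → x ∈ xs → f x ℕ.≤ total f xs
∈⇒≤-total f (here refl) = ℕₚ.m≤m+n _ _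
∈⇒≤-total f (there {x = y} x∈xs) = ℕₚ.≤-trans (∈⇒≤-total f x∈xs) (ℕₚ.m≤n+m _ (f y))

total-positive : ∀ {a} {A : Set a} (f : A → ℕ) xs → 0 ℕ.< total f xs → ∃[ x ] (x ∈ xs × 0 ℕ.< f x)
total-positive f (x ∷ xs) 0<t with f x in eq
... | suc k = x , here refl , subst (0 ℕ.<_) (sym eq) (s≤s z≤n)
... | zero with total-positive f xs 0<t
...   | y , y∈xs , 0<fy = y , there y∈xs , 0<fy

total≤1⇒unique : ∀ {a} {A : Set a} (f : A → ℕ) {xs} → total f xs ℕ.≤ 1 → ∀ {x y} → x ∈ xs → y ∈ xs →
  0 ℕ.< f x → 0 ℕ.< f y → x ≡ y
total≤1⇒unique f t (here refl) (here refl) _ _ = refl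
total≤1⇒unique f t (here refl) (there y∈) 0<fx 0<fy =
  ⊥-elim (ℕₚ.<-irrefl refl (ℕₚ.≤-trans (ℕₚ.+-mono-≤ 0<fx (ℕₚ.≤-trans 0<fy (∈⇒≤-total f y∈))) t))
total≤1⇒unique f t (there x∈) (here refl) 0<fx 0<fy =
  ⊥-elim (ℕₚ.<-irrefl refl (ℕₚ.≤-trans (ℕₚ.+-mono-≤ 0<fy (ℕₚ.≤-trans 0<fx (∈⇒≤-total f x∈))) t))
total≤1⇒unique f {z ∷ _} t (there x∈) (there y∈) 0<fx 0<fy =
  total≤1⇒unique f (ℕₚ.≤-trans (ℕₚ.m≤n+m _ (f z)) t) x∈ y∈ 0<fx 0<fy

count-total : ∀ {q} (x : Γ q) ys → count x ys ≡ total (λ y → ind (x ≟Γ y)) ys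
count-total x [] = refl
count-total x (y ∷ ys) with x ≟Γ y
... | yes _ = cong suc (count-total x ys)
... | no _ = count-total x ys

replicate-+ : ∀ {a} {A : Set a} (x : A) k l → replicate (k ℕ.+ l) x ≡ replicate k x ++ replicate l x
replicate-+ x zero l = refl
replicate-+ x (suc k) l = cong (x ∷_) (replicate-+ x k l)

∈-replicate⁻ : ∀ {a} {A : Set a} {x y : A} k → y ∈ replicate k x → y ≡ x
∈-replicate⁻ (suc k) (here e) = e
∈-replicate⁻ (suc k) (there y∈) = ∈-replicate⁻ k y∈

-- Differences and translates in ℤ₂ × F

module Differences {q : ℕ} (F : FieldOn q) where
  open FieldTheory F

  infixl 6 _⊕_ _⊖_
  _⊕_ _⊖_ : Γ q → Γ q → Γ q
  _⊕_ = addΓ F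
  _⊖_ = subΓ F

  infixl 6 _⊞_
  _⊞_ : Block q → Γ q → Block q
  _⊞_ = _+B_ F

  j : Γ q
  j = 1F , 0#

  private
    +₂-assoc : ∀ a b c → (a +₂ b) +₂ c ≡ a +₂ (b +₂ c)
    +₂-assoc 0F b c = refl
    +₂-assoc 1F 0F c = refl
    +₂-assoc 1F 1F 0F = refl
    +₂-assoc 1F 1F 1F = refl
    +₂-comm : ∀ a b → a +₂ b ≡ b +₂ a
    +₂-comm 0F 0F = refl
    +₂-comm 0F 1F = refl
    +₂-comm 1F 0F = refl
    +₂-comm 1F 1F = refl
    +₂-cancel : ∀ a b → (a +₂ b) +₂ b ≡ a
    +₂-cancel 0F 0F = refl
    +₂-cancel 0F 1F = refl
    +₂-cancel 1F 0F = refl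
    +₂-cancel 1F 1F = refl
    +₂-translate : ∀ a b c → (a +₂ c) +₂ (b +₂ c) ≡ a +₂ b
    +₂-translate a b c = trans (cong ((a +₂ c) +₂_) (+₂-comm b c)) (trans (sym (+₂-assoc (a +₂ c) c b)) (cong (_+₂ b) (+₂-cancel a c)))
    +₂-zero : ∀ a b → a +₂ b ≡ 0F → a ≡ b
    +₂-zero 0F 0F _ = refl
    +₂-zero 1F 1F _ = refl

  ⊕-assoc : ∀ a b c → (a ⊕ b) ⊕ c ≡ a ⊕ (b ⊕ c)
  ⊕-assoc (a , x) (b , y) (c , z) = cong₂ _,_ (+₂-assoc a b c) (+-assoc x y z)

  ⊕-comm : ∀ a b → a ⊕ b ≡ b ⊕ a
  ⊕-comm (a , x) (b , y) = cong₂ _,_ (+₂-comm a b) (+-comm x y)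

  ⊕-identityʳ : ∀ a → a ⊕ 0Γ F ≡ a
  ⊕-identityʳ (0F , x) = cong (0F ,_) (+-identityʳ x)
  ⊕-identityʳ (1F , x) = cong (1F ,_) (+-identityʳ x)

  ⊖-⊕ : ∀ a b → (a ⊖ b) ⊕ b ≡ a
  ⊖-⊕ (a , x) (b , y) = cong₂ _,_ (+₂-cancel a b) (solve 2 (λ x y → (x :- y) :+ y := x) refl x y)

  ⊕-⊖ : ∀ a b → (a ⊕ b) ⊖ b ≡ a
  ⊕-⊖ (a , x) (b , y) = cong₂ _,_ (+₂-cancel a b) (solve 2 (λ x y → (x :+ y) :- y := x) refl x y)

  ⊖-translate : ∀ a b c → (a ⊕ c) ⊖ (b ⊕ c) ≡ a ⊖ b
  ⊖-translate (a , x) (b , y) (c , z) = cong₂ _,_ (+₂-translate a b c) (solve 3 (λ x y z → (x :+ z) :- (y :+ z) := x :- y) refl x y z)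

  ⊖-zero : ∀ {a b} → a ⊖ b ≡ 0Γ F → a ≡ b
  ⊖-zero {a , x} {b , y} e = cong₂ _,_ (+₂-zero a b (cong proj₁ e)) (difference≡0⇒≡ (cong proj₂ e))

  ⊕-cancelʳ : ∀ {a b} c → a ⊕ c ≡ b ⊕ c → a ≡ b
  ⊕-cancelʳ {a} {b} c e = trans (sym (⊕-⊖ a c)) (trans (cong (_⊖ c) e) (⊕-⊖ b c))

  ⊕-cancelˡ : ∀ {b c} a → a ⊕ b ≡ a ⊕ c → b ≡ c
  ⊕-cancelˡ {b} {c} a e = ⊕-cancelʳ a (trans (⊕-comm b a) (trans e (⊕-comm a c)))

  j⊕j : j ⊕ j ≡ 0Γ F
  j⊕j = cong (0F ,_) (+-identityʳ 0#)

  ⊕j⊕j : ∀ a → (a ⊕ j) ⊕ j ≡ a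
  ⊕j⊕j a = trans (⊕-assoc a j j) (trans (cong (a ⊕_) j⊕j) (⊕-identityʳ a))

  ⊞-⊞ : ∀ B x y → (B ⊞ x) ⊞ y ≡ B ⊞ (x ⊕ y)
  ⊞-⊞ B x y = trans (sym (map-∘ B)) (map-cong (λ b → ⊕-assoc b x y) B)

  ⊞-zero : ∀ B → B ⊞ 0Γ F ≡ B
  ⊞-zero B = trans (map-cong ⊕-identityʳ B) (map-id B)

  pairs : Γ q → Block q → ℕ
  pairs g B = total (λ u → total (λ v → ind (¬? (v ≟Γ u)) ℕ.* ind (g ≟Γ (u ⊖ v))) B) B

  count-Δ : ∀ g B → count g (Δ F B) ≡ pairs g B
  count-Δ g B = trans (count-total g (Δ F B)) (trans
    (total-concatMap _ _ B)
    (total-cong (λ u → trans (total-map _ _ (filter (λ v → ¬? (v ≟Γ u)) B)) (total-filter′ (λ v → ¬? (v ≟Γ u)) _ B)) B))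

  count-Δs : ∀ g (C : Class q) → count g (concatMap (Δ F) C) ≡ total (pairs g) C
  count-Δs g C = trans (count-total g (concatMap (Δ F) C)) (trans (total-concatMap _ (Δ F) C)
    (total-cong (λ B → trans (sym (count-total g (Δ F B))) (count-Δ g B)) C))

  pairs-⊞ : ∀ g B x → pairs g (B ⊞ x) ≡ pairs g B
  pairs-⊞ g B x = trans (total-map _ (_⊕ x) B) (total-cong (λ u → trans (total-map _ (_⊕ x) B) (total-cong (λ v →
    cong₂ ℕ._*_
      (ind-⇔ (¬? ((v ⊕ x) ≟Γ (u ⊕ x))) (¬? (v ≟Γ u)) (λ ne e → ne (cong (_⊕ x) e)) (λ ne e → ne (⊕-cancelʳ x e)))
      (cong (λ d → ind (g ≟Γ d)) (⊖-translate u v x))) B)) B)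

  pairs-positive : ∀ {g B u v} → u ∈ B → v ∈ B → u ≢ v → g ≡ u ⊖ v →
    0 ℕ.< total (λ v → ind (¬? (v ≟Γ u)) ℕ.* ind (g ≟Γ (u ⊖ v))) B
  pairs-positive {g} {B} {u} {v} u∈ v∈ u≢v e = ℕₚ.≤-trans
    (ℕₚ.≤-reflexive (sym (cong₂ ℕ._*_ (ind-true (¬? (v ≟Γ u)) (u≢v ∘ sym)) (ind-true (g ≟Γ (u ⊖ v)) e))))
    (∈⇒≤-total (λ v → ind (¬? (v ≟Γ u)) ℕ.* ind (g ≟Γ (u ⊖ v))) v∈)

  count-⊞ : ∀ a B x → count a (B ⊞ x) ≡ count (a ⊖ x) B
  count-⊞ a B x = trans (count-total a (B ⊞ x)) (trans (total-map _ (_⊕ x) B) (trans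
    (total-cong (λ y → ind-⇔ (a ≟Γ (y ⊕ x)) ((a ⊖ x) ≟Γ y)
      (λ e → trans (cong (_⊖ x) e) (⊕-⊖ y x)) (λ e → trans (sym (⊖-⊕ a x)) (cong (_⊕ x) e))) B)
    (sym (count-total (a ⊖ x) B))))

  count-translate : ∀ a (C : Class q) x → count a (concat (_+P_ F C x)) ≡ count (a ⊖ x) (concat C)
  count-translate a C x = trans (cong (count a) (concat-map {f = _⊕ x} C)) (count-⊞ a (concat C) x)

  count-++ : ∀ (a : Γ q) xs ys → count a (xs ++ ys) ≡ count a xs ℕ.+ count a ys
  count-++ a xs ys = trans (count-total a (xs ++ ys)) (trans (total-++ _ xs ys) (sym (cong₂ ℕ._+_ (count-total a xs) (count-total a ys))))

-- Half of the blocks of the base parallel class: the other half is its translate by the involution,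
-- and the remaining block is {0 , involution}.
record IsHalfSystem {q : ℕ} (F : FieldOn q) (n : ℕ) (L : Class q) : Set where
  field
    sizes : map length L ↭ replicate (2 ℕ.* n) 2 ++ replicate n 4
    cover : ∀ x → count (0F , x) (concat L) ℕ.+ count (1F , x) (concat L) ≡ ind (¬? (x ≟ FieldOn.0F F))
    differences : ∀ c d → count (c , d) (concatMap (Δ F) L) ≡ ind (¬? (d ≟ FieldOn.0F F))

-- From a half system to the base parallel class

module HalfSystem {q : ℕ} (F : FieldOn q) (n : ℕ) (L : Class q) (half : IsHalfSystem F n L) where
  open FieldTheory F
  open Differences F
  open IsHalfSystem half

  B₀ : Block q
  B₀ = 0Γ F ∷ j ∷ []

  P : Class q
  P = B₀ ∷ L ++ _+P_ F L j

  private
    concat-P : ∀ a → count a (concat P) ≡ count a B₀ ℕ.+ (count a (concat L) ℕ.+ count (a ⊖ j) (concat L))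
    concat-P a = trans (count-++ a B₀ _) (cong (count a B₀ ℕ.+_) (trans
      (cong (count a) (sym (concat-++ L (_+P_ F L j))))
      (trans (count-++ a (concat L) _) (cong (count a (concat L) ℕ.+_) (count-translate a L j)))))

    count-B₀ : ∀ c x → count (c , x) B₀ ≡ ind (x ≟ 0#)
    count-B₀ c x = trans (count-total (c , x) B₀) (trans (cong (λ k → ind ((c , x) ≟Γ 0Γ F) ℕ.+ k) (ℕₚ.+-identityʳ _)) (go c (x ≟ 0#)))
      where
      go : ∀ c (d : Dec (x ≡ 0#)) → ind ((c , x) ≟Γ 0Γ F) ℕ.+ ind ((c , x) ≟Γ j) ≡ ind d
      go c (no ne) = cong₂ ℕ._+_ (ind-false ((c , x) ≟Γ 0Γ F) (ne ∘ cong proj₂)) (ind-false ((c , x) ≟Γ j) (ne ∘ cong proj₂))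
      go 0F (yes e) = cong₂ ℕ._+_ (ind-true ((0F , x) ≟Γ 0Γ F) (cong (0F ,_) e)) (ind-false ((0F , x) ≟Γ j) (λ ()))
      go 1F (yes e) = cong₂ ℕ._+_ (ind-false ((1F , x) ≟Γ 0Γ F) (λ ())) (ind-true ((1F , x) ≟Γ j) (cong (1F ,_) e))

    x-0 : ∀ x → x - 0# ≡ x
    x-0 x = trans (cong (x +_) -0#≈0#) (+-identityʳ x)

    ind-¬ : ∀ {p} {X : Set p} (d : Dec X) → ind d ℕ.+ ind (¬? d) ≡ 1
    ind-¬ (yes _) = refl
    ind-¬ (no _) = refl

  P-partition : ∀ a → count a (concat P) ≡ 1
  P-partition (c , x) = trans (concat-P (c , x)) (trans (cong₂ ℕ._+_ (count-B₀ c x) (both c)) (ind-¬ (x ≟ 0#)))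
    where
    both : ∀ c → count (c , x) (concat L) ℕ.+ count ((c , x) ⊖ j) (concat L) ≡ ind (¬? (x ≟ 0#))
    both 0F = trans (cong (λ y → count (0F , x) (concat L) ℕ.+ count (1F , y) (concat L)) (x-0 x)) (cover x)
    both 1F = trans (cong (λ y → count (1F , x) (concat L) ℕ.+ count (0F , y) (concat L)) (x-0 x)) (trans (ℕₚ.+-comm (count (1F , x) (concat L)) _) (cover x))

  translate-partition : ∀ x → IsParallelClass F (_+P_ F P x)
  translate-partition x a = trans (count-translate a P x) (P-partition (a ⊖ x))

  private
    -- Both ordered pairs of {0 , j} have the difference j, since j is its own negative. Thus `B₀`
    -- alone provides j twice, while all (c , d) with d ≠ 0 come once from `L` and once from its
    -- translate.
    pairs-B₀ : ∀ g → pairs g B₀ ≡ 2 ℕ.* ind (g ≟Γ j)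
    pairs-B₀ g = arithmetic
      (ind-false (¬? (0Γ F ≟Γ 0Γ F)) (λ ne → ne refl)) (ind-true (¬? (j ≟Γ 0Γ F)) λ ())
      (ind-true (¬? (0Γ F ≟Γ j)) λ ()) (ind-false (¬? (j ≟Γ j)) (λ ne → ne refl))
      (cong (λ y → ind (g ≟Γ (1F , y))) (x-0 0#)) (cong (λ y → ind (g ≟Γ (1F , y))) (x-0 0#))
      where
      arithmetic : ∀ {a b c d x y w z t} → a ≡ 0 → b ≡ 1 → c ≡ 1 → d ≡ 0 → x ≡ t → y ≡ t →
        (a ℕ.* z ℕ.+ (b ℕ.* x ℕ.+ 0)) ℕ.+ ((c ℕ.* y ℕ.+ (d ℕ.* w ℕ.+ 0)) ℕ.+ 0) ≡ 2 ℕ.* t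
      arithmetic {t = t} refl refl refl refl refl refl = twice t
        where
        twice : ∀ t → (0 ℕ.+ (1 ℕ.* t ℕ.+ 0)) ℕ.+ ((1 ℕ.* t ℕ.+ (0 ℕ.+ 0)) ℕ.+ 0) ≡ 2 ℕ.* t
        twice = solve-∀

    pairs-L : ∀ c d → total (pairs (c , d)) L ≡ ind (¬? (d ≟ 0#))
    pairs-L c d = trans (sym (count-Δs (c , d) L)) (differences c d)

    pairs-P : ∀ c d → total (pairs (c , d)) P ≡ 2 ℕ.* (ind ((c , d) ≟Γ j) ℕ.+ ind (¬? (d ≟ 0#)))
    pairs-P c d = begin
      pairs g B₀ ℕ.+ total (pairs g) (L ++ _+P_ F L j) ≡⟨ cong₂ ℕ._+_ (pairs-B₀ g) (total-++ (pairs g) L (_+P_ F L j)) ⟩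
      2 ℕ.* ind (g ≟Γ j) ℕ.+ (total (pairs g) L ℕ.+ total (pairs g) (_+P_ F L j))
        ≡⟨ cong (λ t → 2 ℕ.* ind (g ≟Γ j) ℕ.+ (total (pairs g) L ℕ.+ t)) (trans (total-map (pairs g) (_⊞ j) L) (total-cong (λ B → pairs-⊞ g B j) L)) ⟩
      2 ℕ.* ind (g ≟Γ j) ℕ.+ (total (pairs g) L ℕ.+ total (pairs g) L) ≡⟨ cong (λ t → 2 ℕ.* ind (g ≟Γ j) ℕ.+ (t ℕ.+ t)) (pairs-L c d) ⟩
      2 ℕ.* ind (g ≟Γ j) ℕ.+ (ind (¬? (d ≟ 0#)) ℕ.+ ind (¬? (d ≟ 0#))) ≡⟨ twice (ind (g ≟Γ j)) (ind (¬? (d ≟ 0#))) ⟩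
      2 ℕ.* (ind (g ≟Γ j) ℕ.+ ind (¬? (d ≟ 0#))) ∎
      where
      open ≡-Reasoning
      g = (c , d)
      twice : ∀ a b → 2 ℕ.* a ℕ.+ (b ℕ.+ b) ≡ 2 ℕ.* (a ℕ.+ b)
      twice = solve-∀

    if-yes : ∀ {X : Set} (d : Dec X) → X → (if ⌊ d ⌋ then 0 else 2) ≡ 0
    if-yes (yes _) x = refl
    if-yes (no ¬x) x = ⊥-elim (¬x x)

    if-no : ∀ {X : Set} (d : Dec X) → ¬ X → (if ⌊ d ⌋ then 0 else 2) ≡ 2
    if-no (yes x) ¬x = ⊥-elim (¬x x)
    if-no (no _) _ = refl

  P-differences : ∀ g → count g (concatMap (Δ F) P) ≡ (if ⌊ g ≟Γ 0Γ F ⌋ then 0 else 2)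
  P-differences (c , d) = trans (count-Δs (c , d) P) (trans (pairs-P c d) (go c (d ≟ 0#)))
    where
    go : ∀ c (dec : Dec (d ≡ 0#)) → 2 ℕ.* (ind ((c , d) ≟Γ j) ℕ.+ ind (¬? dec)) ≡ (if ⌊ (c , d) ≟Γ 0Γ F ⌋ then 0 else 2)
    go c (no d≢0) = trans (cong (λ k → 2 ℕ.* (k ℕ.+ 1)) (ind-false ((c , d) ≟Γ j) (d≢0 ∘ cong proj₂)))
      (sym (if-no ((c , d) ≟Γ 0Γ F) (d≢0 ∘ cong proj₂)))
    go 0F (yes d≡0) = trans (cong (λ k → 2 ℕ.* (k ℕ.+ 0)) (ind-false ((0F , d) ≟Γ j) (λ ())))
      (sym (if-yes ((0F , d) ≟Γ 0Γ F) (cong (0F ,_) d≡0)))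
    go 1F (yes d≡0) = trans (cong (λ k → 2 ℕ.* (k ℕ.+ 0)) (ind-true ((1F , d) ≟Γ j) (cong (1F ,_) d≡0)))
      (sym (if-no ((1F , d) ≟Γ 0Γ F) (λ ())))

  K : List ℕ
  K = replicate (4 ℕ.* n ℕ.+ 1) 2 ++ replicate (2 ℕ.* n) 4

  P-sizes : map length P ↭ K
  P-sizes = begin
    2 ∷ map length (L ++ _+P_ F L j) ≡⟨ cong (2 ∷_) (trans (map-++ length L _) (cong (map length L ++_) lengths)) ⟩
    2 ∷ (map length L ++ map length L) ↭⟨ prep 2 (++⁺ sizes sizes) ⟩
    2 ∷ ((twos ++ fours) ++ (twos ++ fours)) ↭⟨ prep 2 middle ⟩
    2 ∷ ((twos ++ twos) ++ (fours ++ fours)) ≡⟨ cong₂ _++_ (cong (2 ∷_) (sym (replicate-+ 2 (2 ℕ.* n) (2 ℕ.* n)))) (sym (replicate-+ 4 n n)) ⟩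
    replicate (1 ℕ.+ (2 ℕ.* n ℕ.+ 2 ℕ.* n)) 2 ++ replicate (n ℕ.+ n) 4
      ≡⟨ cong₂ (λ k l → replicate k 2 ++ replicate l 4) (four n) (two n) ⟩
    K ∎
    where
    open PermutationReasoning
    twos = replicate (2 ℕ.* n) 2
    fours = replicate n 4
    lengths : map length (_+P_ F L j) ≡ map length L
    lengths = trans (sym (map-∘ L)) (map-cong (length-map (_⊕ j)) L)
    middle : (twos ++ fours) ++ (twos ++ fours) ↭ (twos ++ twos) ++ (fours ++ fours)
    middle = begin
      (twos ++ fours) ++ (twos ++ fours) ↭⟨ ++-assoc twos fours _ ⟩
      twos ++ (fours ++ (twos ++ fours)) ↭⟨ ++⁺ˡ twos (↭-sym (++-assoc fours twos fours)) ⟩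
      twos ++ ((fours ++ twos) ++ fours) ↭⟨ ++⁺ˡ twos (++⁺ʳ fours (++-comm fours twos)) ⟩
      twos ++ ((twos ++ fours) ++ fours) ↭⟨ ++⁺ˡ twos (++-assoc twos fours fours) ⟩
      twos ++ (twos ++ (fours ++ fours)) ↭⟨ ++-assoc twos twos _ ⟨
      (twos ++ twos) ++ (fours ++ fours) ∎
    four : ∀ n → 1 ℕ.+ (2 ℕ.* n ℕ.+ 2 ℕ.* n) ≡ 4 ℕ.* n ℕ.+ 1
    four = solve-∀
    two : ∀ n → n ℕ.+ n ≡ 2 ℕ.* n
    two = solve-∀

  isPDF : IsPDF F P K 2
  isPDF = P-partition , P-sizes , P-differences

  private
    -- Regarding `L` itself as the translate by 0 lets a single case of `same` deal with both halves
    -- of `P`.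
    data Origin : Block q → Set where
      base : Origin B₀
      translate : ∀ {B} ε → B ∈ L → ε ≡ 0Γ F ⊎ ε ≡ j → Origin (B ⊞ ε)

    origin : ∀ {B} → B ∈ P → Origin B
    origin (here refl) = base
    origin {B} (there B∈) with ∈-++⁻ L B∈
    ... | inj₁ B∈L = subst Origin (⊞-zero B) (translate (0Γ F) B∈L (inj₁ refl))
    ... | inj₂ B∈L+j with ∈-map⁻ (_⊞ j) B∈L+j
    ...   | B′ , B′∈L , refl = translate j B′∈L (inj₂ refl)

    0∈B₀ : 0Γ F ∈ B₀
    0∈B₀ = here refl

    j∈B₀ : j ∈ B₀
    j∈B₀ = there (here refl)

    B₀-stable : ∀ {a} → a ∈ B₀ → a ⊕ j ∈ B₀
    B₀-stable (here refl) = there (here (trans (⊕-comm (0Γ F) j) (⊕-identityʳ j)))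
    B₀-stable (there (here refl)) = here j⊕j

    _≈_ : Block q → Block q → Set
    _≈_ = _≈B_ F

    ≈-refl : ∀ {B} → B ≈ B
    ≈-refl a = (λ a∈ → a∈) , (λ a∈ → a∈)

    ≈-reflexive : ∀ {B B′} → B ≡ B′ → B ≈ B′
    ≈-reflexive refl = ≈-refl

    ⊞∈ : ∀ {b B} x → b ∈ B → b ⊕ x ∈ B ⊞ x
    ⊞∈ x b∈ = ∈-map⁺ (_⊕ x) b∈

    swap-j : ∀ b x → b ⊕ (x ⊕ j) ≡ (b ⊕ j) ⊕ x
    swap-j b x = trans (cong (b ⊕_) (⊕-comm x j)) (sym (⊕-assoc b j x))

    swap-j′ : ∀ b x → b ⊕ x ≡ (b ⊕ j) ⊕ (x ⊕ j)
    swap-j′ b x = trans (cong (_⊕ x) (sym (⊕j⊕j b))) (sym (swap-j (b ⊕ j) x))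

    B₀-⊞ : ∀ x → (B₀ ⊞ (x ⊕ j)) ≈ (B₀ ⊞ x)
    B₀-⊞ x a = to , from
      where
      to : a ∈ B₀ ⊞ (x ⊕ j) → a ∈ B₀ ⊞ x
      to a∈ with ∈-map⁻ (_⊕ (x ⊕ j)) a∈
      ... | b , b∈ , refl = subst (_∈ B₀ ⊞ x) (sym (swap-j b x)) (⊞∈ x (B₀-stable b∈))
      from : a ∈ B₀ ⊞ x → a ∈ B₀ ⊞ (x ⊕ j)
      from a∈ with ∈-map⁻ (_⊕ x) a∈
      ... | b , b∈ , refl = subst (_∈ B₀ ⊞ (x ⊕ j)) (sym (swap-j′ b x)) (⊞∈ (x ⊕ j) (B₀-stable b∈))

    -- The second component is what the resolution property asks for. It falls out of the same case
    -- analysis as the uniqueness of the block, so both are proved together.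
    Same : Block q → Block q → Γ q → Γ q → Set
    Same B B′ x y = ((B ⊞ x) ≈ (B′ ⊞ y)) × (x ≡ y ⊎ x ≡ y ⊕ j)

    in-pair : ∀ {B u v} → B ∈ L → u ∈ B → v ∈ B → u ≢ v → 0 ℕ.< pairs (u ⊖ v) B
    in-pair {B} {u} B∈ u∈ v∈ u≢v = ℕₚ.≤-trans (pairs-positive u∈ v∈ u≢v refl) (∈⇒≤-total _ u∈)

    -- No difference (c , 0) occurs in `L`; this is what separates the translates of `B₀` from all
    -- other blocks.
    L-≢ : ∀ {B u v} → B ∈ L → u ∈ B → v ∈ B → u ≢ v → proj₂ (u ⊖ v) ≢ 0#
    L-≢ {B} {u} {v} B∈ u∈ v∈ u≢v d≡0 = ℕₚ.<-irrefl refl (ℕₚ.≤-trans (in-pair B∈ u∈ v∈ u≢v)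
      (ℕₚ.≤-trans (∈⇒≤-total (pairs (u ⊖ v)) B∈) (ℕₚ.≤-reflexive
        (trans (pairs-L (proj₁ (u ⊖ v)) (proj₂ (u ⊖ v))) (ind-false (¬? (proj₂ (u ⊖ v) ≟ 0#)) (λ ne → ne d≡0))))))

    L-≢-⊞ : ∀ {B ε u v} → B ∈ L → u ∈ B ⊞ ε → v ∈ B ⊞ ε → u ≢ v → proj₂ (u ⊖ v) ≢ 0#
    L-≢-⊞ {ε = ε} B∈ u∈ v∈ u≢v with ∈-map⁻ (_⊕ ε) u∈ | ∈-map⁻ (_⊕ ε) v∈
    ... | u₁ , u₁∈ , refl | v₁ , v₁∈ , refl = λ e → L-≢ B∈ u₁∈ v₁∈ (u≢v ∘ cong (_⊕ ε)) (trans (cong proj₂ (sym (⊖-translate u₁ v₁ ε))) e)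

    total≤1 : ∀ g → total (pairs g) L ℕ.≤ 1
    total≤1 (c , d) = ℕₚ.≤-trans (ℕₚ.≤-reflexive (pairs-L c d)) (ind≤1 (¬? (d ≟ 0#)))
      where
      ind≤1 : ∀ {X : Set} (dec : Dec X) → ind dec ℕ.≤ 1
      ind≤1 (yes _) = s≤s z≤n
      ind≤1 (no _) = z≤n

    -- A difference occurs at most once in `L`. Therefore the sum over the blocks has one positive
    -- term, which fixes B, and the sum over the rows within B has one, which fixes u.
    L-unique : ∀ {B B′ u v u′ v′} → B ∈ L → B′ ∈ L → u ∈ B → v ∈ B → u′ ∈ B′ → v′ ∈ B′ → u ≢ v → u′ ≢ v′ →
      u ⊖ v ≡ u′ ⊖ v′ → B ≡ B′ × u ≡ u′
    L-unique {B} {B′} {u} {v} {u′} {v′} B∈ B′∈ u∈ v∈ u′∈ v′∈ u≢v u′≢v′ e = B≡B′ , u≡u′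
      where
      g = u ⊖ v
      B≡B′ : B ≡ B′
      B≡B′ = total≤1⇒unique (pairs g) (total≤1 g) B∈ B′∈ (in-pair B∈ u∈ v∈ u≢v)
        (subst (λ h → 0 ℕ.< pairs h B′) (sym e) (in-pair B′∈ u′∈ v′∈ u′≢v′))
      u≡u′ : u ≡ u′
      u≡u′ = total≤1⇒unique (λ u → total (λ v → ind (¬? (v ≟Γ u)) ℕ.* ind (g ≟Γ (u ⊖ v))) B)
        (ℕₚ.≤-trans (∈⇒≤-total (pairs g) B∈) (total≤1 g)) u∈ (subst (u′ ∈_) (sym B≡B′) u′∈)
        (pairs-positive {g} u∈ v∈ u≢v refl)
        (pairs-positive {g} (subst (u′ ∈_) (sym B≡B′) u′∈) (subst (v′ ∈_) (sym B≡B′) v′∈) u′≢v′ e)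

    B₀-difference : ∀ {u v} → u ∈ B₀ → v ∈ B₀ → proj₂ (u ⊖ v) ≡ 0#
    B₀-difference (here refl) (here refl) = -‿inverseʳ 0#
    B₀-difference (here refl) (there (here refl)) = -‿inverseʳ 0#
    B₀-difference (there (here refl)) (here refl) = -‿inverseʳ 0#
    B₀-difference (there (here refl)) (there (here refl)) = -‿inverseʳ 0#

    up-to-j : ∀ {u u′ x y} → u ∈ B₀ → u′ ∈ B₀ → u ⊕ x ≡ u′ ⊕ y → x ≡ y ⊎ x ≡ y ⊕ j
    up-to-j (here refl) (here refl) e = inj₁ (⊕-cancelˡ (0Γ F) e)
    up-to-j {x = x} {y} (here refl) (there (here refl)) e = inj₂ (⊕-cancelˡ (0Γ F) (trans e (trans (⊕-comm j y) (trans (sym (⊕-identityʳ (y ⊕ j))) (⊕-comm (y ⊕ j) (0Γ F))))))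
    up-to-j {x = x} {y} (there (here refl)) (here refl) e = inj₂ (⊕-cancelˡ j (trans e (trans (⊕-comm (0Γ F) y) (trans (⊕-identityʳ y) (trans (sym (⊕j⊕j y)) (⊕-comm (y ⊕ j) j))))))
    up-to-j (there (here refl)) (there (here refl)) e = inj₁ (⊕-cancelˡ j e)

    -- Both blocks realise the difference a - b. If its second coordinate is 0, both are translates
    -- of `B₀`; otherwise both come from one block of `L` and one point u₁ of it, so the total
    -- translations ε + x and ε′ + y agree, and x, y differ by 0 or j.
    same : ∀ {B B′ a b x y} → Origin B → Origin B′ → a ≢ b → a ∈ B ⊞ x → b ∈ B ⊞ x → a ∈ B′ ⊞ y → b ∈ B′ ⊞ y → Same B B′ x y
    same {x = x} {y} o o′ a≢b a∈ b∈ a∈′ b∈′ with ∈-map⁻ (_⊕ x) a∈ | ∈-map⁻ (_⊕ x) b∈ | ∈-map⁻ (_⊕ y) a∈′ | ∈-map⁻ (_⊕ y) b∈′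
    ... | u , u∈ , refl | v , v∈ , refl | u′ , u′∈ , eu | v′ , v′∈ , ev = go o o′ u∈ v∈ u′∈ v′∈
      where
      u≢v : u ≢ v
      u≢v e = a≢b (cong (_⊕ x) e)
      u′≢v′ : u′ ≢ v′
      u′≢v′ e = a≢b (trans eu (trans (cong (_⊕ y) e) (sym ev)))
      u⊖v : u ⊖ v ≡ u′ ⊖ v′
      u⊖v = trans (sym (⊖-translate u v x)) (trans (cong₂ _⊖_ eu ev) (⊖-translate u′ v′ y))
      go : ∀ {B B′} → Origin B → Origin B′ → u ∈ B → v ∈ B → u′ ∈ B′ → v′ ∈ B′ → Same B B′ x y
      go base base u∈ v∈ u′∈ v′∈ with up-to-j u∈ u′∈ eu
      ... | inj₁ refl = ≈-refl , inj₁ refl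
      ... | inj₂ refl = B₀-⊞ y , inj₂ refl
      go base (translate ε B′∈ _) u∈ v∈ u′∈ v′∈ = ⊥-elim (L-≢-⊞ B′∈ u′∈ v′∈ u′≢v′ (trans (cong proj₂ (sym u⊖v)) (B₀-difference u∈ v∈)))
      go (translate ε B∈ _) base u∈ v∈ u′∈ v′∈ = ⊥-elim (L-≢-⊞ B∈ u∈ v∈ u≢v (trans (cong proj₂ u⊖v) (B₀-difference u′∈ v′∈)))
      go (translate {B} ε B∈ εj) (translate {B′} ε′ B′∈ εj′) u∈ v∈ u′∈ v′∈
        with ∈-map⁻ (_⊕ ε) u∈ | ∈-map⁻ (_⊕ ε) v∈ | ∈-map⁻ (_⊕ ε′) u′∈ | ∈-map⁻ (_⊕ ε′) v′∈
      ... | u₁ , u₁∈ , eu₁ | v₁ , v₁∈ , ev₁ | u₂ , u₂∈ , eu₂ | v₂ , v₂∈ , ev₂ =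
        ≈-reflexive (trans (⊞-⊞ B ε x) (trans (cong₂ _⊞_ (proj₁ unique) εx≡ε′y) (sym (⊞-⊞ B′ ε′ y))))
        , up-to-j (ε∈ εj) (ε∈ εj′) εx≡ε′y
        where
        u₁≢v₁ : u₁ ≢ v₁
        u₁≢v₁ e = u≢v (trans eu₁ (trans (cong (_⊕ ε) e) (sym ev₁)))
        u₂≢v₂ : u₂ ≢ v₂
        u₂≢v₂ e = u′≢v′ (trans eu₂ (trans (cong (_⊕ ε′) e) (sym ev₂)))
        unique : B ≡ B′ × u₁ ≡ u₂
        unique = L-unique B∈ B′∈ u₁∈ v₁∈ u₂∈ v₂∈ u₁≢v₁ u₂≢v₂ (trans (sym (⊖-translate u₁ v₁ ε))
          (trans (cong₂ _⊖_ (sym eu₁) (sym ev₁)) (trans u⊖v (trans (cong₂ _⊖_ eu₂ ev₂) (⊖-translate u₂ v₂ ε′)))))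
        εx≡ε′y : ε ⊕ x ≡ ε′ ⊕ y
        εx≡ε′y = ⊕-cancelˡ u₁ (trans (sym (⊕-assoc u₁ ε x)) (trans (cong (_⊕ x) (sym eu₁)) (trans eu
          (trans (cong (_⊕ y) eu₂) (trans (⊕-assoc u₂ ε′ y) (cong (_⊕ (ε′ ⊕ y)) (sym (proj₂ unique))))))))
        ε∈ : ∀ {ε} → ε ≡ 0Γ F ⊎ ε ≡ j → ε ∈ B₀
        ε∈ (inj₁ refl) = 0∈B₀
        ε∈ (inj₂ refl) = j∈B₀

    -- Translation by j permutes the blocks of `P`: it fixes `B₀` as a set and exchanges `L` with
    -- its translate.
    partner : ∀ {B} → B ∈ P → Σ (Block q) λ B′ → B′ ∈ P × (∀ y → (B ⊞ (y ⊕ j)) ≈ (B′ ⊞ y))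
    partner {B} B∈ with origin B∈
    ... | base = B₀ , here refl , B₀-⊞
    ... | translate {B₁} ε B₁∈ (inj₁ refl) = B₁ ⊞ j , there (∈-++⁺ʳ L (∈-map⁺ (_⊞ j) B₁∈)) , λ y →
      ≈-reflexive (trans (cong (_⊞ (y ⊕ j)) (⊞-zero B₁)) (trans (cong (B₁ ⊞_) (⊕-comm y j)) (sym (⊞-⊞ B₁ j y))))
    ... | translate {B₁} ε B₁∈ (inj₂ refl) = B₁ , there (∈-++⁺ˡ B₁∈) , λ y →
      ≈-reflexive (trans (⊞-⊞ B₁ j (y ⊕ j)) (cong (B₁ ⊞_) (trans (⊕-comm j (y ⊕ j)) (⊕j⊕j y))))

    classes : ∀ {x y} → x ≡ y ⊎ x ≡ y ⊕ j → _≈C_ F (_+P_ F P x) (_+P_ F P y)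
    classes (inj₁ refl) = (λ B B∈ → B , B∈ , ≈-refl) , (λ B B∈ → B , B∈ , ≈-refl)
    classes {y = y} (inj₂ refl) = to , from
      where
      to : ∀ B → B ∈ _+P_ F P (y ⊕ j) → Σ (Block q) λ B′ → B′ ∈ _+P_ F P y × B ≈ B′
      to B B∈ with ∈-map⁻ (_⊞ (y ⊕ j)) B∈
      ... | B₁ , B₁∈ , refl with partner B₁∈
      ...   | B₂ , B₂∈ , e = B₂ ⊞ y , ∈-map⁺ (_⊞ y) B₂∈ , e y
      from : ∀ B′ → B′ ∈ _+P_ F P y → Σ (Block q) λ B → B ∈ _+P_ F P (y ⊕ j) × B ≈ B′
      from B′ B′∈ with ∈-map⁻ (_⊞ y) B′∈
      ... | B₁ , B₁∈ , refl with partner B₁∈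
      ...   | B₂ , B₂∈ , e = B₂ ⊞ (y ⊕ j) , ∈-map⁺ (_⊞ (y ⊕ j)) B₂∈ , λ a →
        let (f , h) = subst (λ z → (B₁ ⊞ z) ≈ (B₂ ⊞ (y ⊕ j))) (⊕j⊕j y) (e (y ⊕ j)) a in h , f

    length∈K : ∀ {B} → B ∈ P → length B ∈ K
    length∈K B∈ = ∈-resp-↭ P-sizes (∈-map⁺ length B∈)

    -- Blocks are lists, so length at least 2 does not by itself give two different points;
    -- repetitions are ruled out because `P` contains every point once.
    two-points : ∀ {B} → B ∈ P → Σ (Γ q) λ u → Σ (Γ q) λ v → u ∈ B × v ∈ B × u ≢ v
    two-points {B} B∈ = go B (long (∈-++⁻ (replicate (4 ℕ.* n ℕ.+ 1) 2) (length∈K B∈))) once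
      where
      long : length B ∈ replicate (4 ℕ.* n ℕ.+ 1) 2 ⊎ length B ∈ replicate (2 ℕ.* n) 4 → 2 ℕ.≤ length B
      long (inj₁ l∈) = ℕₚ.≤-reflexive (sym (∈-replicate⁻ (4 ℕ.* n ℕ.+ 1) l∈))
      long (inj₂ l∈) = ℕₚ.≤-trans (s≤s (s≤s z≤n)) (ℕₚ.≤-reflexive (sym (∈-replicate⁻ (2 ℕ.* n) l∈)))
      once : ∀ u → total (λ y → ind (u ≟Γ y)) B ℕ.≤ 1
      once u = ℕₚ.≤-trans (∈⇒≤-total (total (λ y → ind (u ≟Γ y))) B∈) (ℕₚ.≤-reflexive
        (trans (sym (total-concat _ P)) (trans (sym (count-total u (concat P))) (P-partition u))))
      go : ∀ B → 2 ℕ.≤ length B → (∀ u → total (λ y → ind (u ≟Γ y)) B ℕ.≤ 1) → Σ (Γ q) λ u → Σ (Γ q) λ v → u ∈ B × v ∈ B × u ≢ v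
      go (u ∷ []) (s≤s ()) _
      go (u ∷ v ∷ B) _ once = u , v , here refl , there (here refl) , λ e → ℕₚ.<-irrefl refl (ℕₚ.≤-trans
        (ℕₚ.+-mono-≤ (ℕₚ.≤-reflexive (sym (ind-true (u ≟Γ u) refl)))
          (ℕₚ.≤-trans (ℕₚ.≤-reflexive (sym (ind-true (u ≟Γ v) e))) (ℕₚ.m≤m+n _ _)))
        (once u))

    connect : ∀ a b → a ≢ b → Σ (Block q) λ B → Σ (Γ q) λ x → B ∈ P × a ∈ B ⊞ x × b ∈ B ⊞ x
    connect a b a≢b with total-positive (pairs (a ⊖ b)) P positive
      where
      positive : 0 ℕ.< total (pairs (a ⊖ b)) P
      positive = ℕₚ.≤-trans (s≤s z≤n) (ℕₚ.≤-reflexive (sym (trans (sym (count-Δs (a ⊖ b) P))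
        (trans (P-differences (a ⊖ b)) (if-no ((a ⊖ b) ≟Γ 0Γ F) (a≢b ∘ ⊖-zero))))))
    ... | B , B∈ , 0<pairs with total-positive _ B 0<pairs
    ...   | u , u∈ , 0<row with total-positive _ B 0<row
    ...     | v , v∈ , 0<ind = B , a ⊖ u , B∈ ,
      subst (_∈ B ⊞ (a ⊖ u)) u⊕ (⊞∈ (a ⊖ u) u∈) , subst (_∈ B ⊞ (a ⊖ u)) v⊕ (⊞∈ (a ⊖ u) v∈)
      where
      dec : ∀ {X : Set} (d : Dec X) k → 0 ℕ.< k ℕ.* ind d → X
      dec (yes x) k _ = x
      dec (no _) k 0<0 = ⊥-elim (ℕₚ.<-irrefl refl (subst (0 ℕ.<_) (ℕₚ.*-zeroʳ k) 0<0))
      a⊖b : a ⊖ b ≡ u ⊖ v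
      a⊖b = dec ((a ⊖ b) ≟Γ (u ⊖ v)) (ind (¬? (v ≟Γ u))) 0<ind
      u⊕ : u ⊕ (a ⊖ u) ≡ a
      u⊕ = trans (⊕-comm u _) (⊖-⊕ a u)
      v⊕ : v ⊕ (a ⊖ u) ≡ b
      v⊕ = ⊕-cancelʳ (u ⊖ v) (trans (rotate v (a ⊖ u) (u ⊖ v)) (trans (cong (_⊕ (a ⊖ u)) (trans (⊕-comm v _) (⊖-⊕ u v)))
        (trans u⊕ (trans (sym (⊖-⊕ a b)) (trans (⊕-comm _ b) (cong (b ⊕_) a⊖b))))))
        where
        rotate : ∀ a b c → (a ⊕ b) ⊕ c ≡ (a ⊕ c) ⊕ b
        rotate a b c = trans (⊕-assoc a b c) (trans (cong (a ⊕_) (⊕-comm b c)) (sym (⊕-assoc a c b)))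

  isHSBase : IsHSBase F P K
  isHSBase = ((λ B → length∈K) , λ k k∈ → preimage (∈-map⁻ length (∈-resp-↭ (↭-sym P-sizes) k∈)))
    , translate-partition
    , connect
    , (λ a b a≢b B B′ x y B∈ B′∈ a∈ b∈ a∈′ b∈′ → proj₁ (same (origin B∈) (origin B′∈) a≢b a∈ b∈ a∈′ b∈′))
    , λ B B′ x y B∈ B′∈ B≈B′ → resolve x y B∈ B′∈ B≈B′ (two-points B∈)
    where
    preimage : ∀ {k} → (∃[ B ] (B ∈ P × k ≡ length B)) → Σ (Block q) λ B → B ∈ P × length B ≡ k
    preimage (B , B∈ , e) = B , B∈ , sym e
    resolve : ∀ {B B′} x y → B ∈ P → B′ ∈ P → (B ⊞ x) ≈ (B′ ⊞ y) → (Σ (Γ q) λ u → Σ (Γ q) λ v → u ∈ B × v ∈ B × u ≢ v) →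
      _≈C_ F (_+P_ F P x) (_+P_ F P y)
    resolve x y B∈ B′∈ B≈B′ (u , v , u∈ , v∈ , u≢v) = classes (proj₂ (same (origin B∈) (origin B′∈) (u≢v ∘ ⊕-cancelʳ x)
      (⊞∈ x u∈) (⊞∈ x v∈) (proj₁ (B≈B′ _) (⊞∈ x u∈)) (proj₁ (B≈B′ _) (⊞∈ x v∈))))

total-cong-∈ : ∀ {a} {A : Set a} {f g : A → ℕ} xs → (∀ x → x ∈ xs → f x ≡ g x) → total f xs ≡ total g xs
total-cong-∈ [] e = refl
total-cong-∈ (x ∷ xs) e = cong₂ ℕ._+_ (e x (here refl)) (total-cong-∈ xs (λ y y∈ → e y (there y∈)))

-- The half system of a witness

module Construction (n : ℕ) (0<n : 0 ℕ.< n) (F : FieldOn (8 ℕ.* n ℕ.+ 1)) (W : QuarticClasses.Witness n 0<n F) where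
  open QuarticClasses n 0<n F
  open Differences F
  open QuarticClasses.Witness W

  -- A quadruple of type 3 + 1 yields three pure and three mixed differences up to sign, one short
  -- of four cosets each. The negatives of the a_i are therefore paired up so that B adds one pure
  -- difference, a₂ - a₃, and C one mixed difference, a₀ - a₁.
  block-A block-B block-C : Fin q → Block q
  block-A s = (0F , a₀ * s) ∷ (0F , a₁ * s) ∷ (0F , a₂ * s) ∷ (1F , a₃ * s) ∷ []
  block-B s = (0F , - (a₂ * s)) ∷ (0F , - (a₃ * s)) ∷ []
  block-C s = (0F , - (a₀ * s)) ∷ (1F , - (a₁ * s)) ∷ []

  blocks : Fin q → Class q
  blocks s = block-A s ∷ block-B s ∷ block-C s ∷ []

  L : Class q
  L = concatMap blocks S

  private
    sizes : ∀ xs → map length (concatMap blocks xs) ↭ replicate (2 ℕ.* length xs) 2 ++ replicate (length xs) 4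
    sizes [] = ↭-refl
    sizes (x ∷ xs) = begin
      4 ∷ 2 ∷ 2 ∷ map length (concatMap blocks xs) ↭⟨ prep 4 (prep 2 (prep 2 (sizes xs))) ⟩
      4 ∷ 2 ∷ 2 ∷ (replicate (2 ℕ.* l) 2 ++ replicate l 4) ↭⟨ ↭-shift 4 (2 ∷ 2 ∷ replicate (2 ℕ.* l) 2) (replicate l 4) ⟨
      replicate (2 ℕ.+ 2 ℕ.* l) 2 ++ replicate (suc l) 4 ≡⟨ cong (λ k → replicate k 2 ++ replicate (suc l) 4) (double l) ⟩
      replicate (2 ℕ.* suc l) 2 ++ replicate (suc l) 4 ∎
      where
      open PermutationReasoning
      l = length xs
      double : ∀ l → 2 ℕ.+ 2 ℕ.* l ≡ 2 ℕ.* suc l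
      double = solve-∀

    point-count : Fin 2 → Fin q → Fin q → ℕ
    point-count c x s = total (total (λ y → ind ((c , x) ≟Γ y))) (blocks s)

    count-points : ∀ c x → count (c , x) (concat L) ≡ total (point-count c x) S
    count-points c x = trans (count-total (c , x) (concat L)) (trans (total-concat _ L) (total-concatMap _ blocks S))

    points : ∀ x s → point-count 0F x s ℕ.+ point-count 1F x s ≡ ±₄ a₀ a₁ a₂ a₃ x s
    points x s = rearrange (ind (x ≟ a₀ * s)) (ind (x ≟ a₁ * s)) (ind (x ≟ a₂ * s)) (ind (x ≟ a₃ * s))
      (ind (x ≟ - (a₀ * s))) (ind (x ≟ - (a₁ * s))) (ind (x ≟ - (a₂ * s))) (ind (x ≟ - (a₃ * s)))
      where
      rearrange : ∀ a b c d a′ b′ c′ d′ →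
        ((a ℕ.+ (b ℕ.+ (c ℕ.+ 0))) ℕ.+ ((c′ ℕ.+ (d′ ℕ.+ 0)) ℕ.+ ((a′ ℕ.+ 0) ℕ.+ 0))) ℕ.+ ((d ℕ.+ 0) ℕ.+ ((b′ ℕ.+ 0) ℕ.+ 0))
          ≡ (a ℕ.+ a′) ℕ.+ ((b ℕ.+ b′) ℕ.+ ((c ℕ.+ c′) ℕ.+ (d ℕ.+ d′)))
      rearrange = solve-∀

    cover : ∀ x → count (0F , x) (concat L) ℕ.+ count (1F , x) (concat L) ≡ ind (¬? (x ≟ 0#))
    cover x = trans (cong₂ ℕ._+_ (count-points 0F x) (count-points 1F x))
      (trans (sym (total-+ (point-count 0F x) (point-count 1F x) S))
      (trans (total-cong (points x) S) (spread-tiles a₀≢0 a₁≢0 a₂≢0 a₃≢0 spread-elements x)))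

    weight : Γ q → Γ q → Γ q → ℕ
    weight g u v = ind (¬? (v ≟Γ u)) ℕ.* ind (g ≟Γ (u ⊖ v))

    weight-≡ : ∀ g u → weight g u u ≡ 0
    weight-≡ g u = cong (ℕ._* ind (g ≟Γ (u ⊖ u))) (ind-false (¬? (u ≟Γ u)) (λ ne → ne refl))

    weight-≢ : ∀ g {u v} → u ≢ v → weight g u v ≡ ind (g ≟Γ (u ⊖ v))
    weight-≢ g {u} {v} u≢v = trans (cong (ℕ._* ind (g ≟Γ (u ⊖ v))) (ind-true (¬? (v ≟Γ u)) (u≢v ∘ sym))) (ℕₚ.*-identityˡ _)

    δ : Γ q → Γ q → Γ q → ℕ
    δ g u v = ind (g ≟Γ (u ⊖ v))

    pairs₂ : ∀ g u v → u ≢ v → pairs g (u ∷ v ∷ []) ≡ δ g u v ℕ.+ δ g v u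
    pairs₂ g u v u≢v = cong₂ ℕ._+_
      (cong₂ ℕ._+_ (weight-≡ g u) (trans (ℕₚ.+-identityʳ _) (weight-≢ g u≢v)))
      (trans (ℕₚ.+-identityʳ _) (trans (cong₂ ℕ._+_ (weight-≢ g (u≢v ∘ sym)) (trans (ℕₚ.+-identityʳ _) (weight-≡ g v))) (ℕₚ.+-identityʳ _)))

    pairs₄ : ∀ g u v w z → u ≢ v → u ≢ w → u ≢ z → v ≢ w → v ≢ z → w ≢ z → pairs g (u ∷ v ∷ w ∷ z ∷ []) ≡
      (δ g u v ℕ.+ (δ g u w ℕ.+ δ g u z)) ℕ.+ ((δ g v u ℕ.+ (δ g v w ℕ.+ δ g v z)) ℕ.+
      ((δ g w u ℕ.+ (δ g w v ℕ.+ δ g w z)) ℕ.+ (δ g z u ℕ.+ (δ g z v ℕ.+ δ g z w))))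
    pairs₄ g u v w z uv uw uz vw vz wz = cong₂ ℕ._+_
      (cong₂ ℕ._+_ (weight-≡ g u) (cong₂ ℕ._+_ (weight-≢ g uv) (cong₂ ℕ._+_ (weight-≢ g uw) (trans (ℕₚ.+-identityʳ _) (weight-≢ g uz)))))
      (cong₂ ℕ._+_
        (cong₂ ℕ._+_ (weight-≢ g (uv ∘ sym)) (cong₂ ℕ._+_ (weight-≡ g v) (cong₂ ℕ._+_ (weight-≢ g vw) (trans (ℕₚ.+-identityʳ _) (weight-≢ g vz)))))
        (cong₂ ℕ._+_
          (cong₂ ℕ._+_ (weight-≢ g (uw ∘ sym)) (cong₂ ℕ._+_ (weight-≢ g (vw ∘ sym)) (cong₂ ℕ._+_ (weight-≡ g w) (trans (ℕₚ.+-identityʳ _) (weight-≢ g wz)))))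
          (trans (ℕₚ.+-identityʳ _) (cong₂ ℕ._+_ (weight-≢ g (uz ∘ sym)) (cong₂ ℕ._+_ (weight-≢ g (vz ∘ sym))
            (trans (cong₂ ℕ._+_ (weight-≢ g (wz ∘ sym)) (trans (ℕₚ.+-identityʳ _) (weight-≡ g z))) (ℕₚ.+-identityʳ _)))))))

    module _ {s : Fin q} (s≢0 : s ≢ 0#) where
      as≢bs : ∀ {a b} → a - b ≢ 0# → a * s ≢ b * s
      as≢bs {a} {b} a≢b e = a≢b (≡⇒difference≡0 (*-cancelˡ s≢0 (trans (*-comm s a) (trans e (*-comm b s)))))

      same-colour : ∀ {c : Fin 2} {x y : Fin q} → x ≢ y → (c , x) ≢ (c , y)
      same-colour x≢y e = x≢y (cong proj₂ e)

      -as≢-bs : ∀ {a b} → a - b ≢ 0# → - (a * s) ≢ - (b * s)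
      -as≢-bs a≢b e = as≢bs a≢b (trans (sym (-‿involutive _)) (trans (cong -_ e) (-‿involutive _)))

      module _ (d : Fin q) where
        e₊ : ∀ x y → ind (d ≟ x * s - y * s) ≡ ind (d ≟ (x - y) * s)
        e₊ x y = cong (λ z → ind (d ≟ z)) (solve 3 (λ x y s → x :* s :- y :* s := (x :- y) :* s) refl x y s)
        e₋ : ∀ x y → ind (d ≟ y * s - x * s) ≡ ind (d ≟ - ((x - y) * s))
        e₋ x y = cong (λ z → ind (d ≟ z)) (solve 3 (λ x y s → y :* s :- x :* s := :- ((x :- y) :* s)) refl x y s)
        n₊ : ∀ x y → ind (d ≟ (- (y * s)) - (- (x * s))) ≡ ind (d ≟ (x - y) * s)
        n₊ x y = cong (λ z → ind (d ≟ z)) (solve 3 (λ x y s → :- (y :* s) :- :- (x :* s) := (x :- y) :* s) refl x y s)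
        n₋ : ∀ x y → ind (d ≟ (- (x * s)) - (- (y * s))) ≡ ind (d ≟ - ((x - y) * s))
        n₋ x y = cong (λ z → ind (d ≟ z)) (solve 3 (λ x y s → :- (x :* s) :- :- (y :* s) := :- ((x :- y) :* s)) refl x y s)

        pairs-blocks : ∀ c → let u₀ = 0F , a₀ * s ; u₁ = 0F , a₁ * s ; u₂ = 0F , a₂ * s ; u₃ = 1F , a₃ * s
                                 v₀ = 0F , - (a₀ * s) ; v₁ = 1F , - (a₁ * s) ; v₂ = 0F , - (a₂ * s) ; v₃ = 0F , - (a₃ * s)
                                 δ = δ (c , d) in
          total (pairs (c , d)) (blocks s) ≡
          ((δ u₀ u₁ ℕ.+ (δ u₀ u₂ ℕ.+ δ u₀ u₃)) ℕ.+ ((δ u₁ u₀ ℕ.+ (δ u₁ u₂ ℕ.+ δ u₁ u₃)) ℕ.+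
          ((δ u₂ u₀ ℕ.+ (δ u₂ u₁ ℕ.+ δ u₂ u₃)) ℕ.+ (δ u₃ u₀ ℕ.+ (δ u₃ u₁ ℕ.+ δ u₃ u₂))))) ℕ.+
          ((δ v₂ v₃ ℕ.+ δ v₃ v₂) ℕ.+ ((δ v₀ v₁ ℕ.+ δ v₁ v₀) ℕ.+ 0))
        pairs-blocks c = cong₂ ℕ._+_
          (pairs₄ (c , d) (0F , a₀ * s) (0F , a₁ * s) (0F , a₂ * s) (1F , a₃ * s) (same-colour (as≢bs a₀≢a₁)) (same-colour (as≢bs a₀≢a₂)) (λ ()) (same-colour (as≢bs a₁≢a₂)) (λ ()) (λ ()))
          (cong₂ ℕ._+_ (pairs₂ (c , d) (0F , - (a₂ * s)) (0F , - (a₃ * s)) (same-colour (-as≢-bs a₂≢a₃))) (cong (ℕ._+ 0) (pairs₂ (c , d) (0F , - (a₀ * s)) (1F , - (a₁ * s)) (λ ()))))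

        pure : total (pairs (0F , d)) (blocks s) ≡ ±₄ (a₀ - a₁) (a₀ - a₂) (a₁ - a₂) (a₂ - a₃) d s
        pure = trans (pairs-blocks 0F) (rearrange (e₊ a₀ a₁) (e₋ a₀ a₁) (e₊ a₀ a₂) (e₋ a₀ a₂) (e₊ a₁ a₂) (e₋ a₁ a₂) (n₊ a₂ a₃) (n₋ a₂ a₃))
          where
          -- A pair with the wrong first coordinate is rejected by comparing closed elements of
          -- `Fin 2`, so its indicator computes to 0; hence the zeros on the left.
          rearrange : ∀ {x x′ y y′ z z′ w w′ X X′ Y Y′ Z Z′ W W′} → x ≡ X → x′ ≡ X′ → y ≡ Y → y′ ≡ Y′ → z ≡ Z → z′ ≡ Z′ → w ≡ W → w′ ≡ W′ →
            ((x ℕ.+ (y ℕ.+ 0)) ℕ.+ ((x′ ℕ.+ (z ℕ.+ 0)) ℕ.+ ((y′ ℕ.+ (z′ ℕ.+ 0)) ℕ.+ 0))) ℕ.+ ((w′ ℕ.+ w) ℕ.+ 0)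
            ≡ (X ℕ.+ X′) ℕ.+ ((Y ℕ.+ Y′) ℕ.+ ((Z ℕ.+ Z′) ℕ.+ (W ℕ.+ W′)))
          rearrange {x} {x′} {y} {y′} {z} {z′} {w} {w′} refl refl refl refl refl refl refl refl = go x x′ y y′ z z′ w w′
            where
            go : ∀ x x′ y y′ z z′ w w′ →
              ((x ℕ.+ (y ℕ.+ 0)) ℕ.+ ((x′ ℕ.+ (z ℕ.+ 0)) ℕ.+ ((y′ ℕ.+ (z′ ℕ.+ 0)) ℕ.+ 0))) ℕ.+ ((w′ ℕ.+ w) ℕ.+ 0)
              ≡ (x ℕ.+ x′) ℕ.+ ((y ℕ.+ y′) ℕ.+ ((z ℕ.+ z′) ℕ.+ (w ℕ.+ w′)))
            go = solve-∀

        mixed : total (pairs (1F , d)) (blocks s) ≡ ±₄ (a₀ - a₃) (a₁ - a₃) (a₂ - a₃) (a₀ - a₁) d s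
        mixed = trans (pairs-blocks 1F) (rearrange (e₊ a₀ a₃) (e₋ a₀ a₃) (e₊ a₁ a₃) (e₋ a₁ a₃) (e₊ a₂ a₃) (e₋ a₂ a₃) (n₊ a₀ a₁) (n₋ a₀ a₁))
          where
          rearrange : ∀ {x x′ y y′ z z′ w w′ X X′ Y Y′ Z Z′ W W′} → x ≡ X → x′ ≡ X′ → y ≡ Y → y′ ≡ Y′ → z ≡ Z → z′ ≡ Z′ → w ≡ W → w′ ≡ W′ →
            (x ℕ.+ (y ℕ.+ (z ℕ.+ (x′ ℕ.+ (y′ ℕ.+ z′))))) ℕ.+ ((w′ ℕ.+ w) ℕ.+ 0)
            ≡ (X ℕ.+ X′) ℕ.+ ((Y ℕ.+ Y′) ℕ.+ ((Z ℕ.+ Z′) ℕ.+ (W ℕ.+ W′)))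
          rearrange {x} {x′} {y} {y′} {z} {z′} {w} {w′} refl refl refl refl refl refl refl refl = go x x′ y y′ z z′ w w′
            where
            go : ∀ x x′ y y′ z z′ w w′ →
              (x ℕ.+ (y ℕ.+ (z ℕ.+ (x′ ℕ.+ (y′ ℕ.+ z′))))) ℕ.+ ((w′ ℕ.+ w) ℕ.+ 0)
              ≡ (x ℕ.+ x′) ℕ.+ ((y ℕ.+ y′) ℕ.+ ((z ℕ.+ z′) ℕ.+ (w ℕ.+ w′)))
            go = solve-∀

    S≢0 : ∀ {s} → s ∈ S → s ≢ 0#
    S≢0 s∈ = φ≡ρ⇒≢0 I²≡-1 0F (proj₁ (proj₂ (∈-filter⁻ InS? {xs = tabulate λ s → s} s∈)))

    count-differences : ∀ g → count g (concatMap (Δ F) L) ≡ total (λ s → total (pairs g) (blocks s)) S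
    count-differences g = trans (count-Δs g L) (total-concatMap (pairs g) blocks S)

    differences : ∀ c d → count (c , d) (concatMap (Δ F) L) ≡ ind (¬? (d ≟ 0#))
    differences 0F d = trans (count-differences (0F , d)) (trans (total-cong-∈ S (λ s s∈ → pure (S≢0 s∈) d))
      (spread-tiles a₀≢a₁ a₀≢a₂ a₁≢a₂ a₂≢a₃ spread-pure d))
    differences 1F d = trans (count-differences (1F , d)) (trans (total-cong-∈ S (λ s s∈ → mixed (S≢0 s∈) d))
      (spread-tiles a₀≢a₃ a₁≢a₃ a₂≢a₃ a₀≢a₁ spread-mixed d))

  isHalfSystem : IsHalfSystem F n L
  isHalfSystem = record
    { sizes = subst (λ k → map length L ↭ replicate (2 ℕ.* k) 2 ++ replicate k 4) length-S (sizes S)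
    ; cover = cover
    ; differences = differences }

-- Existence of witnesses for large q

sum-mono : ∀ {m} {f g : Fin m → ℕ} → (∀ i → f i ℕ.≤ g i) → sum f ℕ.≤ sum g
sum-mono {zero} f≤g = z≤n
sum-mono {suc m} f≤g = ℕₚ.+-mono-≤ (f≤g zero) (sum-mono (f≤g ∘ suc))

sum-<⇒∃ : ∀ {m} (f g : Fin m → ℕ) → sum f ℕ.< sum g → ∃[ i ] f i ℕ.< g i
sum-<⇒∃ {suc m} f g lt with f zero ℕ.<? g zero
... | yes f<g = zero , f<g
... | no f≮g with sum-<⇒∃ (f ∘ suc) (g ∘ suc) (ℕₚ.+-cancelˡ-< (f zero) _ _ (ℕₚ.<-≤-trans lt (ℕₚ.+-monoˡ-≤ _ (ℕₚ.≮⇒≥ f≮g))))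
...   | i , f<g = suc i , f<g

sum-scale : ∀ {m} c (f : Fin m → ℕ) → sum (λ i → c ℕ.* f i) ≡ c ℕ.* sum f
sum-scale c f = sym (*-distribˡ-sum c f)

-- Expanding the square and exchanging sums turns a second moment over x into the pair correlations
-- of f b and f b′, which are known exactly in the application.
sum-square : ∀ {m k} (β : Fin m → ℕ) (f : Fin m → Fin k → ℕ) →
  sum (λ x → sum (λ b → β b ℕ.* f b x) ℕ.* sum (λ b → β b ℕ.* f b x)) ≡
  sum (λ b → sum (λ b′ → β b ℕ.* β b′ ℕ.* sum (λ x → f b x ℕ.* f b′ x)))
sum-square β f = begin
  sum (λ x → g x ℕ.* g x)
    ≡⟨ sum-cong (λ x → trans (*-distribʳ-sum (g x) (λ b → β b ℕ.* f b x)) (sum-cong λ b → *-distribˡ-sum (β b ℕ.* f b x) (λ b′ → β b′ ℕ.* f b′ x))) ⟩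
  sum (λ x → sum (λ b → sum (λ b′ → β b ℕ.* f b x ℕ.* (β b′ ℕ.* f b′ x))))
    ≡⟨ ∑-comm (λ x b → sum (λ b′ → β b ℕ.* f b x ℕ.* (β b′ ℕ.* f b′ x))) ⟩
  sum (λ b → sum (λ x → sum (λ b′ → β b ℕ.* f b x ℕ.* (β b′ ℕ.* f b′ x))))
    ≡⟨ sum-cong (λ b → ∑-comm (λ x b′ → β b ℕ.* f b x ℕ.* (β b′ ℕ.* f b′ x))) ⟩
  sum (λ b → sum (λ b′ → sum (λ x → β b ℕ.* f b x ℕ.* (β b′ ℕ.* f b′ x))))
    ≡⟨ sum-cong (λ b → sum-cong λ b′ → trans (sum-cong λ x → interchange (β b) (f b x) (β b′) (f b′ x)) (sum-scale (β b ℕ.* β b′) (λ x → f b x ℕ.* f b′ x))) ⟩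
  sum (λ b → sum (λ b′ → β b ℕ.* β b′ ℕ.* sum (λ x → f b x ℕ.* f b′ x))) ∎
  where
  open ≡-Reasoning
  g = λ x → sum (λ b → β b ℕ.* f b x)
  interchange : ∀ a b c d → a ℕ.* b ℕ.* (c ℕ.* d) ≡ a ℕ.* c ℕ.* (b ℕ.* d)
  interchange = solve-∀

module Inequalities where
  open import Data.Nat using (_+_; _*_; _≤_)

  2xy≤x²+y² : ∀ x y → 2 * (x * y) ≤ x * x + y * y
  2xy≤x²+y² zero y = z≤n
  2xy≤x²+y² (suc x) zero = ℕₚ.≤-trans (ℕₚ.≤-reflexive (eq x)) z≤n
    where
    eq : ∀ x → 2 * (suc x * 0) ≡ 0
    eq = solve-∀
  2xy≤x²+y² (suc x) (suc y) = ℕₚ.≤-trans (ℕₚ.≤-reflexive (lhs x y))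
    (ℕₚ.≤-trans (ℕₚ.+-monoˡ-≤ (2 * x + 2 * y + 2) (2xy≤x²+y² x y)) (ℕₚ.≤-reflexive (rhs x y)))
    where
    lhs : ∀ x y → 2 * (suc x * suc y) ≡ 2 * (x * y) + (2 * x + 2 * y + 2)
    lhs = solve-∀
    rhs : ∀ x y → x * x + y * y + (2 * x + 2 * y + 2) ≡ suc x * suc x + suc y * suc y
    rhs = solve-∀

  square-sum₃ : ∀ a b c → (a + b + c) * (a + b + c) ≤ 3 * (a * a + b * b + c * c)
  square-sum₃ a b c = ℕₚ.≤-trans (ℕₚ.≤-reflexive (lhs a b c))
    (ℕₚ.≤-trans (ℕₚ.+-monoʳ-≤ (a * a + b * b + c * c) (ℕₚ.+-mono-≤ (ℕₚ.+-mono-≤ (2xy≤x²+y² a b) (2xy≤x²+y² a c)) (2xy≤x²+y² b c)))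
    (ℕₚ.≤-reflexive (rhs a b c)))
    where
    lhs : ∀ a b c → (a + b + c) * (a + b + c) ≡ a * a + b * b + c * c + (2 * (a * b) + 2 * (a * c) + 2 * (b * c))
    lhs = solve-∀
    rhs : ∀ a b c → a * a + b * b + c * c + (a * a + b * b + (a * a + c * c) + (b * b + c * c)) ≡ 3 * (a * a + b * b + c * c)
    rhs = solve-∀

  -- The Cauchy-Schwarz inequality in the scaling of `deviation`, of which it is the case D = 0. It
  -- serves for those x that are not bad.
  square-sum₄ : ∀ a b c d → 12 * ((a + b + c + d) * (a + b + c + d)) ≤ 48 * (a * a + b * b + c * c + d * d)
  square-sum₄ a b c d = ℕₚ.≤-trans (ℕₚ.≤-reflexive (lhs a b c d)) (ℕₚ.≤-trans
    (ℕₚ.+-mono-≤ (ℕₚ.*-monoʳ-≤ 12 (square-sum₃ a b c)) (ℕₚ.+-monoˡ-≤ (12 * (d * d)) (ℕₚ.*-monoʳ-≤ 12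
      (ℕₚ.+-mono-≤ (ℕₚ.+-mono-≤ (2xy≤x²+y² a d) (2xy≤x²+y² b d)) (2xy≤x²+y² c d))))) (ℕₚ.≤-reflexive (rhs a b c d)))
    where
    lhs : ∀ a b c d → 12 * ((a + b + c + d) * (a + b + c + d)) ≡ 12 * ((a + b + c) * (a + b + c)) + (12 * (2 * (a * d) + 2 * (b * d) + 2 * (c * d)) + 12 * (d * d))
    lhs = solve-∀
    rhs : ∀ a b c d → 12 * (3 * (a * a + b * b + c * c)) + (12 * (a * a + d * d + (b * b + d * d) + (c * c + d * d)) + 12 * (d * d)) ≡ 48 * (a * a + b * b + c * c + d * d)
    rhs = solve-∀

  -- With T = b + c + d = 3 a + X one has 12 (4 a + X)² + 4 X² = 48 a² + 16 T² and T² ≤ 3 (b² + c² + d²).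
  deviation₀ : ∀ k D a b c d → D + k * (4 * a) ≤ k * (a + b + c + d) →
    4 * (D * D) + k * k * (12 * ((a + b + c + d) * (a + b + c + d))) ≤ k * k * (48 * (a * a + b * b + c * c + d * d))
  deviation₀ zero D a b c d bad rewrite ℕₚ.n≤0⇒n≡0 (ℕₚ.≤-trans (ℕₚ.m≤m+n D 0) bad) = z≤n
  deviation₀ (suc k) D a b c d bad = go X T≡ D≤
    where
    K = suc k
    T = b + c + d
    3a≤T : 3 * a ≤ T
    3a≤T = ℕₚ.+-cancelˡ-≤ a _ _ (ℕₚ.*-cancelˡ-≤ K (ℕₚ.≤-trans (ℕₚ.m≤n+m (K * (4 * a)) D) (ℕₚ.≤-trans bad (ℕₚ.≤-reflexive (cong (K *_) (eq a b c d))))))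
      where
      eq : ∀ a b c d → a + b + c + d ≡ a + (b + c + d)
      eq = solve-∀
    -- A bad class is at most average, so this truncated subtraction is exact.
    X = T ℕ.∸ 3 * a
    T≡ : T ≡ X + 3 * a
    T≡ = sym (ℕₚ.m∸n+n≡m 3a≤T)
    D≤ : D ≤ K * X
    D≤ = ℕₚ.+-cancelʳ-≤ (K * (4 * a)) _ _ (ℕₚ.≤-trans bad (ℕₚ.≤-reflexive (trans (eq K a b c d) (trans (cong (λ t → K * (a + t)) T≡) (eq′ K a X)))))
      where
      eq : ∀ K a b c d → K * (a + b + c + d) ≡ K * (a + (b + c + d))
      eq = solve-∀
      eq′ : ∀ K a X → K * (a + (X + 3 * a)) ≡ K * X + K * (4 * a)
      eq′ = solve-∀
    go : ∀ X → T ≡ X + 3 * a → D ≤ K * X →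
      4 * (D * D) + K * K * (12 * ((a + b + c + d) * (a + b + c + d))) ≤ K * K * (48 * (a * a + b * b + c * c + d * d))
    go X T≡ D≤ = begin
      4 * (D * D) + K * K * (12 * ((a + b + c + d) * (a + b + c + d))) ≤⟨ ℕₚ.+-mono-≤ (ℕₚ.*-monoʳ-≤ 4 (ℕₚ.*-mono-≤ D≤ D≤)) (ℕₚ.≤-reflexive (trans (eq₀ K a b c d) (cong (λ t → K * K * (12 * ((a + t) * (a + t)))) T≡))) ⟩
      4 * (K * X * (K * X)) + K * K * (12 * ((a + (X + 3 * a)) * (a + (X + 3 * a)))) ≡⟨ eq₁ K X a ⟩
      K * K * (48 * (a * a) + 16 * ((X + 3 * a) * (X + 3 * a))) ≡⟨ cong (λ t → K * K * (48 * (a * a) + 16 * (t * t))) T≡ ⟨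
      K * K * (48 * (a * a) + 16 * ((b + c + d) * (b + c + d))) ≤⟨ ℕₚ.*-monoʳ-≤ (K * K) (ℕₚ.+-monoʳ-≤ (48 * (a * a)) (ℕₚ.*-monoʳ-≤ 16 (square-sum₃ b c d))) ⟩
      K * K * (48 * (a * a) + 16 * (3 * (b * b + c * c + d * d))) ≡⟨ eq₂ K a b c d ⟩
      K * K * (48 * (a * a + b * b + c * c + d * d)) ∎
      where
      open ℕₚ.≤-Reasoning
      eq₀ : ∀ K a b c d → K * K * (12 * ((a + b + c + d) * (a + b + c + d))) ≡ K * K * (12 * ((a + (b + c + d)) * (a + (b + c + d))))
      eq₀ = solve-∀
      eq₁ : ∀ K X a → 4 * (K * X * (K * X)) + K * K * (12 * ((a + (X + 3 * a)) * (a + (X + 3 * a)))) ≡ K * K * (48 * (a * a) + 16 * ((X + 3 * a) * (X + 3 * a)))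
      eq₁ = solve-∀
      eq₂ : ∀ K a b c d → K * K * (48 * (a * a) + 16 * (3 * (b * b + c * c + d * d))) ≡ K * K * (48 * (a * a + b * b + c * c + d * d))
      eq₂ = solve-∀

  total₄ squares₄ : (Fin 4 → ℕ) → ℕ
  total₄ f = f 0F + f 1F + f 2F + f 3F
  squares₄ f = f 0F * f 0F + f 1F * f 1F + f 2F * f 2F + f 3F * f 3F

  deviation : ∀ k D (f : Fin 4 → ℕ) j → D + k * (4 * f j) ≤ k * total₄ f →
    4 * (D * D) + k * k * (12 * (total₄ f * total₄ f)) ≤ k * k * (48 * squares₄ f)
  deviation k D f 0F bad = deviation₀ k D (f 0F) (f 1F) (f 2F) (f 3F) bad
  deviation k D f 1F bad = subst₂ (λ t s → 4 * (D * D) + k * k * (12 * (t * t)) ≤ k * k * (48 * s))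
    (t (f 0F) (f 1F) (f 2F) (f 3F)) (s (f 0F) (f 1F) (f 2F) (f 3F))
    (deviation₀ k D (f 1F) (f 0F) (f 2F) (f 3F) (subst (λ u → D + k * (4 * f 1F) ≤ k * u) (sym (t (f 0F) (f 1F) (f 2F) (f 3F))) bad))
    where
    t : ∀ a b c d → b + a + c + d ≡ a + b + c + d
    t = solve-∀
    s : ∀ a b c d → b * b + a * a + c * c + d * d ≡ a * a + b * b + c * c + d * d
    s = solve-∀
  deviation k D f 2F bad = subst₂ (λ t s → 4 * (D * D) + k * k * (12 * (t * t)) ≤ k * k * (48 * s))
    (t (f 0F) (f 1F) (f 2F) (f 3F)) (s (f 0F) (f 1F) (f 2F) (f 3F))
    (deviation₀ k D (f 2F) (f 1F) (f 0F) (f 3F) (subst (λ u → D + k * (4 * f 2F) ≤ k * u) (sym (t (f 0F) (f 1F) (f 2F) (f 3F))) bad))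
    where
    t : ∀ a b c d → c + b + a + d ≡ a + b + c + d
    t = solve-∀
    s : ∀ a b c d → c * c + b * b + a * a + d * d ≡ a * a + b * b + c * c + d * d
    s = solve-∀
  deviation k D f 3F bad = subst₂ (λ t s → 4 * (D * D) + k * k * (12 * (t * t)) ≤ k * k * (48 * s))
    (t (f 0F) (f 1F) (f 2F) (f 3F)) (s (f 0F) (f 1F) (f 2F) (f 3F))
    (deviation₀ k D (f 3F) (f 1F) (f 2F) (f 0F) (subst (λ u → D + k * (4 * f 3F) ≤ k * u) (sym (t (f 0F) (f 1F) (f 2F) (f 3F))) bad))
    where
    t : ∀ a b c d → d + b + c + a ≡ a + b + c + d
    t = solve-∀
    s : ∀ a b c d → d * d + b * b + c * c + a * a ≡ a * a + b * b + c * c + d * d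
    s = solve-∀

-- Distribution of x - b over the cosets

module Distribution (n : ℕ) (0<n : 0 ℕ.< n) (F : FieldOn (8 ℕ.* n ℕ.+ 1)) where
  open QuarticClasses n 0<n F
  open Inequalities

  private
    off : Fin q → Fin q → ℕ
    off b x = ind (¬? (x ≟ b))

    In-total′ : ∀ b x → total₄ (λ j → In j (x - b)) ≡ off b x
    In-total′ b x = trans (eq (In 0F (x - b)) (In 1F (x - b)) (In 2F (x - b)) (In 3F (x - b))) (trans (In-total (x - b))
      (ind-⇔ (¬? ((x - b) ≟ 0#)) (¬? (x ≟ b)) (λ ne e → ne (≡⇒difference≡0 e)) (λ ne e → ne (difference≡0⇒≡ e))))
      where
      eq : ∀ a b c d → a ℕ.+ b ℕ.+ c ℕ.+ d ≡ a ℕ.+ (b ℕ.+ (c ℕ.+ d))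
      eq = solve-∀

    total₄-sum : ∀ {m} (f : Fin 4 → Fin m → ℕ) → total₄ (λ j → sum (f j)) ≡ sum (λ x → total₄ (λ j → f j x))
    total₄-sum f = sym (trans (sum-+ (λ x → f 0F x ℕ.+ f 1F x ℕ.+ f 2F x) (f 3F)) (cong (ℕ._+ sum (f 3F))
      (trans (sum-+ (λ x → f 0F x ℕ.+ f 1F x) (f 2F)) (cong (ℕ._+ sum (f 2F)) (sum-+ (f 0F) (f 1F))))))

    total₄-cong : ∀ {f g : Fin 4 → ℕ} → (∀ j → f j ≡ g j) → total₄ f ≡ total₄ g
    total₄-cong e = cong₂ ℕ._+_ (cong₂ ℕ._+_ (cong₂ ℕ._+_ (e 0F) (e 1F)) (e 2F)) (e 3F)

    translation : Fin q → Permutation q q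
    translation b = permutation (_+ b) (_- b) (λ x → solve 2 (λ x b → (x :- b) :+ b := x) refl x b) (λ x → solve 2 (λ x b → (x :+ b) :- b := x) refl x b)

    inversion : ∀ {d} → d ≢ 0# → Permutation q q
    inversion {d} d≢0 = permutation π π involutive involutive
      where
      π : Fin q → Fin q
      π w = d * w ⁻¹
      involutive : ∀ w → π (π w) ≡ w
      involutive w = go (w ≟ 0#)
        where
        open ≡-Reasoning
        go : Dec (w ≡ 0#) → π (π w) ≡ w
        go (yes refl) = begin
          d * (d * 0# ⁻¹) ⁻¹ ≡⟨ cong (λ z → d * (d * z) ⁻¹) 0⁻¹≡0 ⟩
          d * (d * 0#) ⁻¹ ≡⟨ cong (λ z → d * z ⁻¹) (zeroʳ d) ⟩
          d * 0# ⁻¹ ≡⟨ cong (d *_) 0⁻¹≡0 ⟩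
          d * 0# ≡⟨ zeroʳ d ⟩
          0# ∎
        go (no w≢0) = begin
          d * π w ⁻¹ ≡⟨ cong (_* π w ⁻¹) πw*w ⟨
          (π w * w) * π w ⁻¹ ≡⟨ solve 3 (λ p w i → (p :* w) :* i := p :* (i :* w)) refl (π w) w (π w ⁻¹) ⟩
          π w * (π w ⁻¹ * w) ≡⟨ *-inverse-cancelˡ (product≢0 d≢0 (⁻¹-≢0 w≢0)) w ⟩
          w ∎
          where
          πw*w : π w * w ≡ d
          πw*w = trans (*-assoc d (w ⁻¹) w) (trans (cong (d *_) (trans (*-comm (w ⁻¹) w) (*-inverseʳ w≢0))) (*-identityʳ d))

    -- This is 1 if u and v are nonzero and lie in one coset of C, and 0 otherwise.
    correlation : Fin q → Fin q → ℕ
    correlation u v = total₄ (λ j → In j u ℕ.* In j v)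

    correlation-product : ∀ {u} → u ≢ 0# → ∀ v → correlation u (u * v) ≡ In 0F v
    correlation-product {u} u≢0 v = from-range (φ-range u≢0)
      where
      pick : ∀ m (f : Fin 4 → ℕ) → total₄ (λ j → ind (m ≟ j) ℕ.* f j) ≡ f m
      pick 0F f = eq (f 0F) (f 1F) (f 2F) (f 3F)
        where
        eq : ∀ a b c d → 1 ℕ.* a ℕ.+ 0 ℕ.* b ℕ.+ 0 ℕ.* c ℕ.+ 0 ℕ.* d ≡ a
        eq = solve-∀
      pick 1F f = eq (f 0F) (f 1F) (f 2F) (f 3F)
        where
        eq : ∀ a b c d → 0 ℕ.* a ℕ.+ 1 ℕ.* b ℕ.+ 0 ℕ.* c ℕ.+ 0 ℕ.* d ≡ b
        eq = solve-∀
      pick 2F f = eq (f 0F) (f 1F) (f 2F) (f 3F)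
        where
        eq : ∀ a b c d → 0 ℕ.* a ℕ.+ 0 ℕ.* b ℕ.+ 1 ℕ.* c ℕ.+ 0 ℕ.* d ≡ c
        eq = solve-∀
      pick 3F f = eq (f 0F) (f 1F) (f 2F) (f 3F)
        where
        eq : ∀ a b c d → 0 ℕ.* a ℕ.+ 0 ℕ.* b ℕ.+ 0 ℕ.* c ℕ.+ 1 ℕ.* d ≡ d
        eq = solve-∀
      from-range : ∃[ m ] φ u ≡ ρ m → correlation u (u * v) ≡ In 0F v
      from-range (m , φu≡) = trans
        (total₄-cong (λ j → cong (ℕ._* In j (u * v)) (ind-⇔ (φ u ≟ ρ j) (m ≟ j) (ρ-injective ∘ trans (sym φu≡)) (trans φu≡ ∘ cong ρ))))
        (trans (pick m (λ j → In j (u * v))) (ind-⇔ (φ (u * v) ≟ ρ m) (φ v ≟ 1#)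
          (λ e → *-cancelˡ (φ-≢0 u≢0) (trans (sym (φ-* u v)) (trans e (trans (sym φu≡) (sym (*-identityʳ (φ u)))))))
          (λ e → trans (φ-* u v) (trans (cong (φ u *_) e) (trans (*-identityʳ (φ u)) φu≡)))))

    -- The substitution u = d / w turns u + d into u (1 + w).
    sum-correlation : ∀ {d} → d ≢ 0# → sum (λ u → correlation u (u + d)) ℕ.+ 1 ≡ 2 ℕ.* n
    sum-correlation {d} d≢0 = begin
      sum g′ ℕ.+ 1 ≡⟨ cong₂ ℕ._+_ (∑-permute g′ (inversion d≢0)) (sym (sum-ind₁ {q} 0#)) ⟩
      sum (λ w → g′ (d * w ⁻¹)) ℕ.+ sum (λ w → ind (w ≟ 0#)) ≡⟨ sum-+ (λ w → g′ (d * w ⁻¹)) (λ w → ind (w ≟ 0#)) ⟨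
      sum (λ w → g′ (d * w ⁻¹) ℕ.+ ind (w ≟ 0#)) ≡⟨ sum-cong (λ w → pointwise w (w ≟ 0#)) ⟩
      sum (λ w → In 0F (w + 1#)) ≡⟨ ∑-permute (In 0F) (translation 1#) ⟨
      sum (In 0F) ≡⟨ class-size 0F ⟩
      2 ℕ.* n ∎
      where
      open ≡-Reasoning
      g′ : Fin q → ℕ
      g′ u = correlation u (u + d)
      pointwise : ∀ w (dec : Dec (w ≡ 0#)) → g′ (d * w ⁻¹) ℕ.+ ind dec ≡ In 0F (w + 1#)
      -- At w = 0 the correlation vanishes although w + 1 = 1 is a fourth power; this accounts for
      -- the summand 1 in the statement.
      pointwise w (yes refl) = trans (cong (ℕ._+ 1) (trans (cong g′ (trans (cong (d *_) 0⁻¹≡0) (zeroʳ d)))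
        (total₄-cong {g = λ _ → 0} (λ j → cong (ℕ._* In j (0# + d)) (In-zero j)))))
        (sym (ind-true (φ (0# + 1#) ≟ 1#) (trans (cong φ (+-identityˡ 1#)) φ-1)))
      pointwise w (no w≢0) = trans (ℕₚ.+-identityʳ _) (trans (cong (correlation u) u+d) (correlation-product (product≢0 d≢0 (⁻¹-≢0 w≢0)) (w + 1#)))
        where
        u = d * w ⁻¹
        u+d : u + d ≡ u * (w + 1#)
        u+d = sym (begin
          u * (w + 1#) ≡⟨ solve 4 (λ d i w e → (d :* i) :* (w :+ e) := (d :* i) :* e :+ d :* (w :* i)) refl d (w ⁻¹) w 1# ⟩
          u * 1# + d * (w * w ⁻¹) ≡⟨ cong₂ _+_ (*-identityʳ u) (trans (cong (d *_) (*-inverseʳ w≢0)) (*-identityʳ d)) ⟩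
          u + d ∎)

    -- `SS` counts the x for which x - b and x - b′ lie in one coset, `TT` those for which both are
    -- nonzero. If the cosets were independent, `SS` would be a quarter of `TT`.
    SS TT : Fin q → Fin q → ℕ
    SS b b′ = sum (λ x → correlation (x - b) (x - b′))
    TT b b′ = sum (λ x → off b x ℕ.* off b′ x)

    SS-≢ : ∀ {b b′} → b ≢ b′ → SS b b′ ℕ.+ 1 ≡ 2 ℕ.* n
    SS-≢ {b} {b′} b≢b′ = trans (cong (ℕ._+ 1) (trans (∑-permute (λ x → correlation (x - b) (x - b′)) (translation b))
      (sum-cong λ x → cong₂ correlation (solve 2 (λ x b → (x :+ b) :- b := x) refl x b) (solve 3 (λ x b c → (x :+ b) :- c := x :+ (b :- c)) refl x b b′))))
      (sum-correlation (b≢b′ ∘ difference≡0⇒≡))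

    TT-≢ : ∀ {b b′} → b ≢ b′ → TT b b′ ℕ.+ 1 ≡ 8 ℕ.* n
    TT-≢ {b} {b′} b≢b′ = ℕₚ.+-cancelʳ-≡ 1 _ _ (begin
      TT b b′ ℕ.+ 1 ℕ.+ 1 ≡⟨ cong₂ (λ s t → TT b b′ ℕ.+ s ℕ.+ t) (sum-ind₁ b) (sum-ind₁ b′) ⟨
      TT b b′ ℕ.+ sum (λ x → ind (x ≟ b)) ℕ.+ sum (λ x → ind (x ≟ b′)) ≡⟨ cong (ℕ._+ sum (λ x → ind (x ≟ b′))) (sum-+ (λ x → off b x ℕ.* off b′ x) (λ x → ind (x ≟ b))) ⟨
      sum (λ x → off b x ℕ.* off b′ x ℕ.+ ind (x ≟ b)) ℕ.+ sum (λ x → ind (x ≟ b′)) ≡⟨ sum-+ (λ x → off b x ℕ.* off b′ x ℕ.+ ind (x ≟ b)) (λ x → ind (x ≟ b′)) ⟨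
      sum (λ x → off b x ℕ.* off b′ x ℕ.+ ind (x ≟ b) ℕ.+ ind (x ≟ b′)) ≡⟨ sum-cong (λ x → pointwise x (x ≟ b) (x ≟ b′)) ⟩
      sum {q} (λ _ → 1) ≡⟨ trans (sum-const q 1) (ℕₚ.*-identityʳ q) ⟩
      8 ℕ.* n ℕ.+ 1 ∎)
      where
      open ≡-Reasoning
      pointwise : ∀ x (d : Dec (x ≡ b)) (d′ : Dec (x ≡ b′)) → ind (¬? d) ℕ.* ind (¬? d′) ℕ.+ ind d ℕ.+ ind d′ ≡ 1
      pointwise x (yes e) (yes e′) = ⊥-elim (b≢b′ (trans (sym e) e′))
      pointwise x (yes _) (no _) = refl
      pointwise x (no _) (yes _) = refl
      pointwise x (no _) (no _) = refl

    sum-off : ∀ b → sum (off b) ≡ 8 ℕ.* n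
    sum-off b = sum-≢ {8 ℕ.* n} b

    In-idem : ∀ j u → In j u ℕ.* In j u ≡ In j u
    In-idem j u = go (φ u ≟ ρ j)
      where
      go : ∀ {X : Set} (d : Dec X) → ind d ℕ.* ind d ≡ ind d
      go (yes _) = refl
      go (no _) = refl

    -- Off the diagonal the values are 2n - 1 and 8n - 1, so 4 `SS` is even smaller than `TT`. On
    -- the diagonal both are 8n, and the excess is (48 - 12) · 8n = 288n.
    kernel : ∀ b b′ → 48 ℕ.* SS b b′ ℕ.≤ 12 ℕ.* TT b b′ ℕ.+ 288 ℕ.* n ℕ.* ind (b′ ≟ b)
    kernel b b′ = go (b′ ≟ b)
      where
      go : (d : Dec (b′ ≡ b)) → 48 ℕ.* SS b b′ ℕ.≤ 12 ℕ.* TT b b′ ℕ.+ 288 ℕ.* n ℕ.* ind d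
      go (yes refl) = ℕₚ.≤-reflexive (trans (cong (48 ℕ.*_) SS≡) (trans (eq n) (cong (λ t → 12 ℕ.* t ℕ.+ 288 ℕ.* n ℕ.* 1) (sym TT≡))))
        where
        eq : ∀ n → 48 ℕ.* (8 ℕ.* n) ≡ 12 ℕ.* (8 ℕ.* n) ℕ.+ 288 ℕ.* n ℕ.* 1
        eq = solve-∀
        SS≡ : SS b b ≡ 8 ℕ.* n
        SS≡ = trans (sum-cong (λ x → trans (total₄-cong (λ j → In-idem j (x - b))) (In-total′ b x))) (sum-off b)
        TT≡ : TT b b ≡ 8 ℕ.* n
        TT≡ = trans (sum-cong (λ x → off-idem (x ≟ b))) (sum-off b)
          where
          off-idem : ∀ {X : Set} (d : Dec X) → ind (¬? d) ℕ.* ind (¬? d) ≡ ind (¬? d)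
          off-idem (yes _) = refl
          off-idem (no _) = refl
      go (no b′≢b) = ℕₚ.≤-trans (ℕₚ.+-cancelʳ-≤ 48 _ _ (ℕₚ.≤-trans (ℕₚ.≤-reflexive (begin
        48 ℕ.* SS b b′ ℕ.+ 48 ≡⟨ e₁ (SS b b′) ⟩
        48 ℕ.* (SS b b′ ℕ.+ 1) ≡⟨ cong (48 ℕ.*_) (SS-≢ (b′≢b ∘ sym)) ⟩
        48 ℕ.* (2 ℕ.* n) ≡⟨ e₂ n ⟩
        12 ℕ.* (8 ℕ.* n) ≡⟨ cong (12 ℕ.*_) (TT-≢ (b′≢b ∘ sym)) ⟨
        12 ℕ.* (TT b b′ ℕ.+ 1) ≡⟨ e₃ (TT b b′) ⟩
        12 ℕ.* TT b b′ ℕ.+ 12 ∎)) (ℕₚ.+-monoʳ-≤ (12 ℕ.* TT b b′) (ℕₚ.m≤m+n 12 36)))) (ℕₚ.m≤m+n _ _)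
        where
        open ≡-Reasoning
        e₁ : ∀ s → 48 ℕ.* s ℕ.+ 48 ≡ 48 ℕ.* (s ℕ.+ 1)
        e₁ = solve-∀
        e₂ : ∀ n → 48 ℕ.* (2 ℕ.* n) ≡ 12 ℕ.* (8 ℕ.* n)
        e₂ = solve-∀
        e₃ : ∀ t → 12 ℕ.* (t ℕ.+ 1) ≡ 12 ℕ.* t ℕ.+ 12
        e₃ = solve-∀

  -- Here β is the indicator function of a set of candidates: `β-idem` restricts its values to 0 and
  -- 1, and collapses β b * β b on the diagonal of the second moment.
  module _ (β : Fin q → ℕ) (β-idem : ∀ b → β b ℕ.* β b ≡ β b) where

    N : Fin 4 → Fin q → ℕ
    N j x = sum (λ b → β b ℕ.* In j (x - b))

    M : Fin q → ℕ
    M x = total₄ (λ j → N j x)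

    private
      M-off : ∀ x → M x ≡ sum (λ b → β b ℕ.* off b x)
      M-off x = trans (total₄-sum (λ j b → β b ℕ.* In j (x - b))) (sum-cong λ b →
        trans (eq (β b) (In 0F (x - b)) (In 1F (x - b)) (In 2F (x - b)) (In 3F (x - b))) (cong (β b ℕ.*_) (In-total′ b x)))
        where
        eq : ∀ k a b c d → k ℕ.* a ℕ.+ k ℕ.* b ℕ.+ k ℕ.* c ℕ.+ k ℕ.* d ≡ k ℕ.* (a ℕ.+ b ℕ.+ c ℕ.+ d)
        eq = solve-∀

    M-outside : ∀ {x} → β x ≡ 0 → M x ≡ sum β
    M-outside {x} βx≡0 = trans (M-off x) (sum-cong λ b → go b (x ≟ b))
      where
      go : ∀ b (d : Dec (x ≡ b)) → β b ℕ.* ind (¬? d) ≡ β b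
      go b (yes refl) = trans (ℕₚ.*-zeroʳ (β b)) (sym βx≡0)
      go b (no _) = ℕₚ.*-identityʳ (β b)

    private
      sum-N² : sum (λ x → squares₄ (λ j → N j x)) ≡ sum (λ b → sum (λ b′ → β b ℕ.* β b′ ℕ.* SS b b′))
      sum-N² = begin
        sum (λ x → total₄ (λ j → N j x ℕ.* N j x))
          ≡⟨ total₄-sum (λ j x → N j x ℕ.* N j x) ⟨
        total₄ (λ j → sum (λ x → N j x ℕ.* N j x))
          ≡⟨ total₄-cong (λ j → sum-square β (λ b x → In j (x - b))) ⟩
        total₄ (λ j → sum (λ b → sum (λ b′ → β b ℕ.* β b′ ℕ.* sum (λ x → In j (x - b) ℕ.* In j (x - b′)))))
          ≡⟨ total₄-sum (λ j b → sum (λ b′ → β b ℕ.* β b′ ℕ.* sum (λ x → In j (x - b) ℕ.* In j (x - b′)))) ⟩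
        sum (λ b → total₄ (λ j → sum (λ b′ → β b ℕ.* β b′ ℕ.* sum (λ x → In j (x - b) ℕ.* In j (x - b′)))))
          ≡⟨ sum-cong (λ b → total₄-sum (λ j b′ → β b ℕ.* β b′ ℕ.* sum (λ x → In j (x - b) ℕ.* In j (x - b′)))) ⟩
        sum (λ b → sum (λ b′ → total₄ (λ j → β b ℕ.* β b′ ℕ.* sum (λ x → In j (x - b) ℕ.* In j (x - b′)))))
          ≡⟨ sum-cong (λ b → sum-cong λ b′ → trans (dist (β b ℕ.* β b′) _ _ _ _) (cong (β b ℕ.* β b′ ℕ.*_) (total₄-sum (λ j x → In j (x - b) ℕ.* In j (x - b′))))) ⟩
        sum (λ b → sum (λ b′ → β b ℕ.* β b′ ℕ.* SS b b′)) ∎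
        where
        open ≡-Reasoning
        dist : ∀ k a b c d → k ℕ.* a ℕ.+ k ℕ.* b ℕ.+ k ℕ.* c ℕ.+ k ℕ.* d ≡ k ℕ.* (a ℕ.+ b ℕ.+ c ℕ.+ d)
        dist = solve-∀

      sum-M² : sum (λ x → M x ℕ.* M x) ≡ sum (λ b → sum (λ b′ → β b ℕ.* β b′ ℕ.* TT b b′))
      sum-M² = trans (sum-cong (λ x → cong₂ ℕ._*_ (M-off x) (M-off x))) (sum-square β off)

      scale² : ∀ c (f : Fin q → Fin q → ℕ) → c ℕ.* sum (λ b → sum (f b)) ≡ sum (λ b → sum (λ b′ → c ℕ.* f b b′))
      scale² c f = sym (trans (sum-cong (λ b → sum-scale c (f b))) (sum-scale c (λ b → sum (f b))))

      -- Only the diagonal of `kernel` contributes, so the excess over equidistribution is linear in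
      -- the size of the set, whereas one proportional deviation costs the square of that size.
      moments : 48 ℕ.* sum (λ x → squares₄ (λ j → N j x)) ℕ.≤ 12 ℕ.* sum (λ x → M x ℕ.* M x) ℕ.+ 288 ℕ.* n ℕ.* sum β
      moments = begin
        48 ℕ.* sum (λ x → squares₄ (λ j → N j x)) ≡⟨ trans (cong (48 ℕ.*_) sum-N²) (scale² 48 (λ b b′ → β b ℕ.* β b′ ℕ.* SS b b′)) ⟩
        sum (λ b → sum (λ b′ → 48 ℕ.* (β b ℕ.* β b′ ℕ.* SS b b′))) ≤⟨ sum-mono (λ b → sum-mono λ b′ → bound b b′) ⟩
        sum (λ b → sum (λ b′ → 12 ℕ.* (β b ℕ.* β b′ ℕ.* TT b b′) ℕ.+ 288 ℕ.* n ℕ.* (ind (b′ ≟ b) ℕ.* (β b ℕ.* β b′))))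
          ≡⟨ trans (sum-cong (λ b → sum-+ (λ b′ → 12 ℕ.* (β b ℕ.* β b′ ℕ.* TT b b′)) _)) (sum-+ (λ b → sum (λ b′ → 12 ℕ.* (β b ℕ.* β b′ ℕ.* TT b b′))) _) ⟩
        sum (λ b → sum (λ b′ → 12 ℕ.* (β b ℕ.* β b′ ℕ.* TT b b′))) ℕ.+ sum (λ b → sum (λ b′ → 288 ℕ.* n ℕ.* (ind (b′ ≟ b) ℕ.* (β b ℕ.* β b′))))
          ≡⟨ cong₂ ℕ._+_ (trans (sym (scale² 12 (λ b b′ → β b ℕ.* β b′ ℕ.* TT b b′))) (cong (12 ℕ.*_) (sym sum-M²)))
               (trans (sym (scale² (288 ℕ.* n) (λ b b′ → ind (b′ ≟ b) ℕ.* (β b ℕ.* β b′)))) (cong (288 ℕ.* n ℕ.*_) (sum-cong λ b → trans (sum-ind b (λ b′ → β b ℕ.* β b′)) (β-idem b)))) ⟩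
        12 ℕ.* sum (λ x → M x ℕ.* M x) ℕ.+ 288 ℕ.* n ℕ.* sum β ∎
        where
        open ℕₚ.≤-Reasoning
        bound : ∀ b b′ → 48 ℕ.* (β b ℕ.* β b′ ℕ.* SS b b′) ℕ.≤ 12 ℕ.* (β b ℕ.* β b′ ℕ.* TT b b′) ℕ.+ 288 ℕ.* n ℕ.* (ind (b′ ≟ b) ℕ.* (β b ℕ.* β b′))
        bound b b′ = begin
          48 ℕ.* (β b ℕ.* β b′ ℕ.* SS b b′) ≡⟨ e₁ (β b ℕ.* β b′) (SS b b′) ⟩
          β b ℕ.* β b′ ℕ.* (48 ℕ.* SS b b′) ≤⟨ ℕₚ.*-monoʳ-≤ (β b ℕ.* β b′) (kernel b b′) ⟩
          β b ℕ.* β b′ ℕ.* (12 ℕ.* TT b b′ ℕ.+ 288 ℕ.* n ℕ.* ind (b′ ≟ b)) ≡⟨ e₂ (β b ℕ.* β b′) (TT b b′) n (ind (b′ ≟ b)) ⟩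
          12 ℕ.* (β b ℕ.* β b′ ℕ.* TT b b′) ℕ.+ 288 ℕ.* n ℕ.* (ind (b′ ≟ b) ℕ.* (β b ℕ.* β b′)) ∎
          where
          e₁ : ∀ a s → 48 ℕ.* (a ℕ.* s) ≡ a ℕ.* (48 ℕ.* s)
          e₁ = solve-∀
          e₂ : ∀ a t n i → a ℕ.* (12 ℕ.* t ℕ.+ 288 ℕ.* n ℕ.* i) ≡ 12 ℕ.* (a ℕ.* t) ℕ.+ 288 ℕ.* n ℕ.* (i ℕ.* a)
          e₂ = solve-∀

    -- With D = `sum β` and k > 0 this reads 4 N ≤ M - D / k: at x the class j receives less than
    -- its quarter, with tolerance 1 / k. It is multiplied by k to stay within ℕ.
    Bad? : ∀ k j x → Dec (sum β ℕ.+ k ℕ.* (4 ℕ.* N j x) ℕ.≤ k ℕ.* M x)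
    Bad? k j x = sum β ℕ.+ k ℕ.* (4 ℕ.* N j x) ℕ.≤? k ℕ.* M x

    -- Chebyshev's inequality for the distribution of the classes of x - b.
    few-bad : ∀ k j → sum (λ x → ind (Bad? k j x)) ℕ.* (sum β ℕ.* sum β) ℕ.≤ k ℕ.* k ℕ.* (72 ℕ.* n ℕ.* sum β)
    few-bad k j = ℕₚ.*-cancelˡ-≤ 4 (ℕₚ.+-cancelʳ-≤ (k ℕ.* k ℕ.* (12 ℕ.* ΣM²)) _ _ (begin
      4 ℕ.* (bad ℕ.* (D ℕ.* D)) ℕ.+ k ℕ.* k ℕ.* (12 ℕ.* ΣM²)
        ≡⟨ cong₂ ℕ._+_ (trans (e₁ bad (D ℕ.* D)) (sym (sum-scale (4 ℕ.* (D ℕ.* D)) (λ x → ind (Bad? k j x)))))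
             (trans (e₂ k ΣM²) (sym (sum-scale (k ℕ.* k ℕ.* 12) (λ x → M x ℕ.* M x)))) ⟩
      sum (λ x → 4 ℕ.* (D ℕ.* D) ℕ.* ind (Bad? k j x)) ℕ.+ sum (λ x → k ℕ.* k ℕ.* 12 ℕ.* (M x ℕ.* M x))
        ≡⟨ sum-+ (λ x → 4 ℕ.* (D ℕ.* D) ℕ.* ind (Bad? k j x)) (λ x → k ℕ.* k ℕ.* 12 ℕ.* (M x ℕ.* M x)) ⟨
      sum (λ x → 4 ℕ.* (D ℕ.* D) ℕ.* ind (Bad? k j x) ℕ.+ k ℕ.* k ℕ.* 12 ℕ.* (M x ℕ.* M x))
        ≤⟨ sum-mono (λ x → pointwise x (Bad? k j x)) ⟩
      sum (λ x → k ℕ.* k ℕ.* 48 ℕ.* squares₄ (λ j → N j x))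
        ≡⟨ trans (sum-scale (k ℕ.* k ℕ.* 48) (λ x → squares₄ (λ j → N j x))) (ℕₚ.*-assoc (k ℕ.* k) 48 _) ⟩
      k ℕ.* k ℕ.* (48 ℕ.* sum (λ x → squares₄ (λ j → N j x)))
        ≤⟨ ℕₚ.*-monoʳ-≤ (k ℕ.* k) moments ⟩
      k ℕ.* k ℕ.* (12 ℕ.* ΣM² ℕ.+ 288 ℕ.* n ℕ.* D)
        ≡⟨ e₃ k ΣM² n D ⟩
      4 ℕ.* (k ℕ.* k ℕ.* (72 ℕ.* n ℕ.* D)) ℕ.+ k ℕ.* k ℕ.* (12 ℕ.* ΣM²) ∎))
      where
      open ℕₚ.≤-Reasoning
      D = sum β
      ΣM² = sum (λ x → M x ℕ.* M x)
      bad = sum (λ x → ind (Bad? k j x))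
      e₁ : ∀ b d → 4 ℕ.* (b ℕ.* d) ≡ 4 ℕ.* d ℕ.* b
      e₁ = solve-∀
      e₂ : ∀ k m → k ℕ.* k ℕ.* (12 ℕ.* m) ≡ k ℕ.* k ℕ.* 12 ℕ.* m
      e₂ = solve-∀
      e₃ : ∀ k m n d → k ℕ.* k ℕ.* (12 ℕ.* m ℕ.+ 288 ℕ.* n ℕ.* d) ≡ 4 ℕ.* (k ℕ.* k ℕ.* (72 ℕ.* n ℕ.* d)) ℕ.+ k ℕ.* k ℕ.* (12 ℕ.* m)
      e₃ = solve-∀
      pointwise : ∀ x (d : Dec (D ℕ.+ k ℕ.* (4 ℕ.* N j x) ℕ.≤ k ℕ.* M x)) →
        4 ℕ.* (D ℕ.* D) ℕ.* ind d ℕ.+ k ℕ.* k ℕ.* 12 ℕ.* (M x ℕ.* M x) ℕ.≤ k ℕ.* k ℕ.* 48 ℕ.* squares₄ (λ j → N j x)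
      pointwise x (yes b) = subst₂ ℕ._≤_ (cong₂ ℕ._+_ (sym (ℕₚ.*-identityʳ _)) (sym (ℕₚ.*-assoc (k ℕ.* k) 12 _))) (sym (ℕₚ.*-assoc (k ℕ.* k) 48 _))
        (deviation k D (λ j → N j x) j b)
      pointwise x (no _) = ℕₚ.≤-trans (ℕₚ.≤-reflexive (trans (cong (ℕ._+ k ℕ.* k ℕ.* 12 ℕ.* (M x ℕ.* M x)) (ℕₚ.*-zeroʳ (4 ℕ.* (D ℕ.* D)))) (ℕₚ.*-assoc (k ℕ.* k) 12 _)))
        (ℕₚ.≤-trans (ℕₚ.*-monoʳ-≤ (k ℕ.* k) (square-sum₄ (N 0F x) (N 1F x) (N 2F x) (N 3F x))) (ℕₚ.≤-reflexive (sym (ℕₚ.*-assoc (k ℕ.* k) 48 _))))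

    -- For a set of at least (u / v) n elements, the bound 72 k² n / D becomes 72 k² v / u, which no
    -- longer depends on n.
    few-bad′ : ∀ k j u v → 0 ℕ.< sum β → u ℕ.* n ℕ.≤ v ℕ.* sum β →
      u ℕ.* sum (λ x → ind (Bad? k j x)) ℕ.≤ k ℕ.* k ℕ.* 72 ℕ.* v
    few-bad′ k j u v 0<D un≤vD = ℕₚ.*-cancelʳ-≤ _ _ (D ℕ.* D) {{ℕₚ.m*n≢0 D D {{ℕ.>-nonZero 0<D}} {{ℕ.>-nonZero 0<D}}}} (begin
      u ℕ.* bad ℕ.* (D ℕ.* D) ≡⟨ ℕₚ.*-assoc u bad (D ℕ.* D) ⟩
      u ℕ.* (bad ℕ.* (D ℕ.* D)) ≤⟨ ℕₚ.*-monoʳ-≤ u (few-bad k j) ⟩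
      u ℕ.* (k ℕ.* k ℕ.* (72 ℕ.* n ℕ.* D)) ≡⟨ e₁ u k n D ⟩
      k ℕ.* k ℕ.* 72 ℕ.* D ℕ.* (u ℕ.* n) ≤⟨ ℕₚ.*-monoʳ-≤ (k ℕ.* k ℕ.* 72 ℕ.* D) un≤vD ⟩
      k ℕ.* k ℕ.* 72 ℕ.* D ℕ.* (v ℕ.* D) ≡⟨ e₂ k D v ⟩
      k ℕ.* k ℕ.* 72 ℕ.* v ℕ.* (D ℕ.* D) ∎)
      where
      open ℕₚ.≤-Reasoning
      D = sum β
      bad = sum (λ x → ind (Bad? k j x))
      e₁ : ∀ u k n D → u ℕ.* (k ℕ.* k ℕ.* (72 ℕ.* n ℕ.* D)) ≡ k ℕ.* k ℕ.* 72 ℕ.* D ℕ.* (u ℕ.* n)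
      e₁ = solve-∀
      e₂ : ∀ k D v → k ℕ.* k ℕ.* 72 ℕ.* D ℕ.* (v ℕ.* D) ≡ k ℕ.* k ℕ.* 72 ℕ.* v ℕ.* (D ℕ.* D)
      e₂ = solve-∀

    -- Outside the set no b equals x, so M x is the full size D, and the negation of `Bad?` says 4 N
    -- > (1 - 1 / k) D.
    good : ∀ k j x → β x ≡ 0 → ind (Bad? k j x) ≡ 0 → k ℕ.* sum β ℕ.< sum β ℕ.+ k ℕ.* (4 ℕ.* N j x)
    good k j x βx≡0 not-bad = go (Bad? k j x) not-bad
      where
      go : (d : Dec (sum β ℕ.+ k ℕ.* (4 ℕ.* N j x) ℕ.≤ k ℕ.* M x)) → ind d ≡ 0 → k ℕ.* sum β ℕ.< sum β ℕ.+ k ℕ.* (4 ℕ.* N j x)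
      go (no ¬bad) _ = ℕₚ.≰⇒> (¬bad ∘ subst (λ m → sum β ℕ.+ k ℕ.* (4 ℕ.* N j x) ℕ.≤ k ℕ.* m) (sym (M-outside βx≡0)))

  private
    data Is01 : ℕ → Set where
      is0 : Is01 0
      is1 : Is01 1

    ind-01 : ∀ {X : Set} (d : Dec X) → Is01 (ind d)
    ind-01 (yes _) = is1
    ind-01 (no _) = is0

    *-01 : ∀ {a b} → Is01 a → Is01 b → Is01 (a ℕ.* b)
    *-01 is0 _ = is0
    *-01 is1 is0 = is0
    *-01 is1 is1 = is1

    idem : ∀ {a} → Is01 a → a ℕ.* a ≡ a
    idem is0 = refl
    idem is1 = refl

    positive : ∀ {a} → Is01 a → 0 ℕ.< a → a ≡ 1
    positive is1 _ = refl

    factors : ∀ {a b} → Is01 a → Is01 b → a ℕ.* b ≡ 1 → a ≡ 1 × b ≡ 1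
    factors is1 is1 _ = refl , refl

    -- A union bound: `bad` may be a sum of indicators, and its vanishing at x means that x avoids
    -- all exceptional sets at once.
    pick : ∀ (α bad : Fin q → ℕ) → (∀ x → Is01 (α x)) → sum bad ℕ.< sum α → ∃[ x ] (α x ≡ 1 × bad x ≡ 0)
    pick α bad α-01 lt with sum-<⇒∃ bad α lt
    ... | x , bad<α = x , α≡1 , ℕₚ.n<1⇒n≡0 (ℕₚ.≤-trans bad<α (ℕₚ.≤-reflexive α≡1))
      where
      α≡1 : α x ≡ 1
      α≡1 = positive (α-01 x) (ℕₚ.≤-<-trans z≤n bad<α)

    In-01 : ∀ j x → Is01 (In j x)
    In-01 j x = ind-01 (φ x ≟ ρ j)

    In⇒≡ : ∀ j {x} → In j x ≡ 1 → φ x ≡ ρ j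
    In⇒≡ j {x} e = go (φ x ≟ ρ j) e
      where
      go : ∀ {X : Set} (d : Dec X) → ind d ≡ 1 → X
      go (yes x) _ = x

    disjoint : ∀ i j {x} → i ≢ j → In i x ≡ 1 → In j x ≡ 0
    disjoint i j {x} i≢j e = ind-false (φ x ≟ ρ j) (λ e′ → i≢j (ρ-injective (trans (sym (In⇒≡ i e)) e′)))

    scaled-< : ∀ u {B C S} → u ℕ.* B ℕ.≤ C → C ℕ.< u ℕ.* S → B ℕ.< S
    scaled-< u {B} {C} {S} le lt = ℕₚ.*-cancelˡ-< u B S (ℕₚ.≤-<-trans le lt)

    scaled-<₂ : ∀ u v {B C S} → u ℕ.* (v ℕ.* B) ℕ.≤ C → C ℕ.< u ℕ.* (v ℕ.* S) → B ℕ.< S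
    scaled-<₂ u v {B} {C} {S} le lt = ℕₚ.*-cancelˡ-< v B S (scaled-< u le lt)

    merge : ∀ u v w t → u ℕ.* v ≡ w → u ℕ.* (v ℕ.* t) ≡ w ℕ.* t
    merge u v w t e = trans (sym (ℕₚ.*-assoc u v t)) (cong (ℕ._* t) e)

    +-bound : ∀ {a b A B C} → a ℕ.≤ A → b ℕ.≤ B → A ℕ.+ B ≡ C → a ℕ.+ b ℕ.≤ C
    +-bound a≤A b≤B refl = ℕₚ.+-mono-≤ a≤A b≤B

    exchange : ∀ u v t → u ℕ.* (v ℕ.* t) ≡ v ℕ.* (u ℕ.* t)
    exchange = solve-∀

    zeros : ∀ {a b} → a ℕ.+ b ≡ 0 → a ≡ 0 × b ≡ 0
    zeros {zero} {zero} _ = refl , refl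

  -- Greedy choice of a₀, a₁, a₂, a₃: every step keeps, up to few exceptions, a fixed proportion of the candidates
  -- for the remaining elements. With few-bad′, the tolerances 1/14 and 1/4 yield the bounds 14112 = 14² · 72 and
  -- 64512 = 4² · 72 · 56 = 72 · 896 on the scaled numbers of exceptions.
  module Greedy (large : 10700 ℕ.≤ n) where

    private
      -- Here 42336 = 3 · 14112 belongs to the three exceptional sets of `step₁`, and 2n is the size
      -- of the coset from which a₀ is taken.
      16-few : 42336 ℕ.< 2 ℕ.* (2 ℕ.* n)
      16-few = ℕₚ.≤-trans (ℕₚ.≤ᵇ⇒≤ 42337 (2 ℕ.* (2 ℕ.* 10700)) _) (ℕₚ.*-monoʳ-≤ 2 (ℕₚ.*-monoʳ-≤ 2 large))

      bad₁ : Fin 4 → Fin 4 → Fin q → ℕ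
      bad₁ i j x = ind (Bad? (In i) (λ b → idem (In-01 i b)) 14 j x)

      bad₁-few : ∀ i j → 2 ℕ.* sum (bad₁ i j) ℕ.≤ 14112
      bad₁-few i j = few-bad′ (In i) (λ b → idem (In-01 i b)) 14 j 2 1
        (subst (0 ℕ.<_) (sym (class-size i)) (ℕₚ.≤-trans 0<n (ℕₚ.m≤m+n n _)))
        (ℕₚ.≤-reflexive (trans (sym (class-size i)) (sym (ℕₚ.*-identityˡ _))))

      abstract
        -- The classes aimed at are i for a_i, 0 for a₀ - a₁, 3 for a₂ - a₃, 1 for both a₀ - a₂ and
        -- a₀ - a₃, and 2 for both a₁ - a₂ and a₁ - a₃. Then the pure and the mixed differences each
        -- meet all four classes.
        step₁ : ∃[ x ] (In 0F x ≡ 1 × bad₁ 1F 0F x ℕ.+ (bad₁ 2F 1F x ℕ.+ bad₁ 3F 1F x) ≡ 0)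
        step₁ = pick (In 0F) _ (In-01 0F) (scaled-< 2 few (subst (λ s → 42336 ℕ.< 2 ℕ.* s) (sym (class-size 0F)) 16-few))
          where
          few : 2 ℕ.* sum (λ x → bad₁ 1F 0F x ℕ.+ (bad₁ 2F 1F x ℕ.+ bad₁ 3F 1F x)) ℕ.≤ 42336
          few = ℕₚ.≤-trans (ℕₚ.≤-reflexive (trans (cong (2 ℕ.*_) (trans (sum-+ (bad₁ 1F 0F) _) (cong (sum (bad₁ 1F 0F) ℕ.+_) (sum-+ (bad₁ 2F 1F) (bad₁ 3F 1F)))))
            (eq (sum (bad₁ 1F 0F)) (sum (bad₁ 2F 1F)) (sum (bad₁ 3F 1F)))))
            (+-bound (bad₁-few 1F 0F) (+-bound {C = 28224} (bad₁-few 2F 1F) (bad₁-few 3F 1F) refl) refl)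
            where
            eq : ∀ a b c → 2 ℕ.* (a ℕ.+ (b ℕ.+ c)) ≡ 2 ℕ.* a ℕ.+ (2 ℕ.* b ℕ.+ 2 ℕ.* c)
            eq = solve-∀

    a₀ : Fin q
    a₀ = proj₁ step₁

    a₀∈ : In 0F a₀ ≡ 1
    a₀∈ = proj₁ (proj₂ step₁)

    private
      -- Of the 2n elements of a coset more than 1/4 · 13/14 survive, that is, more than 26n / 56.
      many₁ : ∀ i j → 0F ≢ i → bad₁ i j a₀ ≡ 0 → 26 ℕ.* n ℕ.< 56 ℕ.* sum (λ b → In i b ℕ.* In j (a₀ - b))
      many₁ i j 0≢i not-bad = ℕₚ.+-cancelˡ-< (2 ℕ.* n) _ _ (subst₂ ℕ._<_ (e₁ n) (e₂ n (sum (λ b → In i b ℕ.* In j (a₀ - b))))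
        (subst (λ s → 14 ℕ.* s ℕ.< s ℕ.+ 14 ℕ.* (4 ℕ.* sum (λ b → In i b ℕ.* In j (a₀ - b)))) (class-size i)
          (good (In i) (λ b → idem (In-01 i b)) 14 j a₀ (disjoint 0F i 0≢i a₀∈) not-bad)))
        where
        e₁ : ∀ n → 14 ℕ.* (2 ℕ.* n) ≡ 2 ℕ.* n ℕ.+ 26 ℕ.* n
        e₁ = solve-∀
        e₂ : ∀ n s → 2 ℕ.* n ℕ.+ 14 ℕ.* (4 ℕ.* s) ≡ 2 ℕ.* n ℕ.+ 56 ℕ.* s
        e₂ = solve-∀

      β : Fin 4 → Fin 4 → Fin q → ℕ
      β i j x = In i x ℕ.* In j (a₀ - x)

      β-01 : ∀ i j x → Is01 (β i j x)
      β-01 i j x = *-01 (In-01 i x) (In-01 j (a₀ - x))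

      many₁₁ : 26 ℕ.* n ℕ.< 56 ℕ.* sum (β 1F 0F)
      many₁₁ = many₁ 1F 0F (λ ()) (proj₁ (zeros (proj₂ (proj₂ step₁))))

      many₁₂ : 26 ℕ.* n ℕ.< 56 ℕ.* sum (β 2F 1F)
      many₁₂ = many₁ 2F 1F (λ ()) (proj₁ (zeros (proj₂ (zeros {bad₁ 1F 0F a₀} (proj₂ (proj₂ step₁))))))

      many₁₃ : 26 ℕ.* n ℕ.< 56 ℕ.* sum (β 3F 1F)
      many₁₃ = many₁ 3F 1F (λ ()) (proj₂ (zeros {bad₁ 2F 1F a₀} (proj₂ (zeros {bad₁ 1F 0F a₀} (proj₂ (proj₂ step₁))))))

      >⇒positive : ∀ u {s t} → t ℕ.< u ℕ.* s → 0 ℕ.< s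
      >⇒positive u {zero} {t} lt = ⊥-elim (ℕₚ.n≮0 (subst (t ℕ.<_) (ℕₚ.*-zeroʳ u) lt))
      >⇒positive u {suc s} _ = s≤s z≤n

      bad₂ : Fin 4 → Fin q → ℕ
      bad₂ i x = ind (Bad? (β i 1F) (λ b → idem (β-01 i 1F b)) 4 2F x)

      bad₂-few : ∀ i → 26 ℕ.* n ℕ.< 56 ℕ.* sum (β i 1F) → 26 ℕ.* sum (bad₂ i) ℕ.≤ 64512
      bad₂-few i many = few-bad′ (β i 1F) (λ b → idem (β-01 i 1F b)) 4 2F 26 56 (>⇒positive 56 many) (ℕₚ.<⇒≤ many)

      abstract
        -- This step dictates the threshold: more than 26n / 56 candidates must outnumber 129024 /
        -- 26 exceptions, and 56 · 129024 / 26² is about 10688. The first step alone would need n >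
        -- 10584.
        step₂ : ∃[ x ] (β 1F 0F x ≡ 1 × bad₂ 2F x ℕ.+ bad₂ 3F x ≡ 0)
        step₂ = pick (β 1F 0F) _ (β-01 1F 0F) (scaled-<₂ 56 26 (ℕₚ.*-monoʳ-≤ 56 few) (ℕₚ.<-≤-trans
          (ℕₚ.≤-<-trans (ℕₚ.≤-trans (ℕₚ.≤ᵇ⇒≤ (56 ℕ.* 129024) (26 ℕ.* (26 ℕ.* 10700)) _) (ℕₚ.*-monoʳ-≤ 26 (ℕₚ.*-monoʳ-≤ 26 large)))
          (ℕₚ.*-monoʳ-< 26 many₁₁)) (ℕₚ.≤-reflexive (exchange 26 56 (sum (β 1F 0F))))))
          where
          few : 26 ℕ.* sum (λ x → bad₂ 2F x ℕ.+ bad₂ 3F x) ℕ.≤ 129024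
          few = ℕₚ.≤-trans (ℕₚ.≤-reflexive (trans (cong (26 ℕ.*_) (sum-+ (bad₂ 2F) (bad₂ 3F))) (ℕₚ.*-distribˡ-+ 26 (sum (bad₂ 2F)) (sum (bad₂ 3F)))))
            (+-bound (bad₂-few 2F many₁₂) (bad₂-few 3F many₁₃) refl)

    a₁ : Fin q
    a₁ = proj₁ step₂

    a₁∈ : In 1F a₁ ≡ 1 × In 0F (a₀ - a₁) ≡ 1
    a₁∈ = factors (In-01 1F a₁) (In-01 0F (a₀ - a₁)) (proj₁ (proj₂ step₂))

    private
      γ : Fin 4 → Fin q → ℕ
      γ i x = β i 1F x ℕ.* In 2F (a₁ - x)

      γ-01 : ∀ i x → Is01 (γ i x)
      γ-01 i x = *-01 (β-01 i 1F x) (In-01 2F (a₁ - x))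

      -- Tolerance 1/4 keeps more than 1/4 · 3/4 of the candidates, and 3/16 · 26n / 56 = 78n / 896.
      many₂ : ∀ i → 1F ≢ i → bad₂ i a₁ ≡ 0 → 26 ℕ.* n ℕ.< 56 ℕ.* sum (β i 1F) → 78 ℕ.* n ℕ.< 896 ℕ.* sum (γ i)
      many₂ i 1≢i not-bad many = ℕₚ.<-trans (subst₂ ℕ._<_ (merge 3 26 78 n refl) refl (ℕₚ.*-monoʳ-< 3 many)) (subst₂ ℕ._<_ (exchange 56 3 (sum (β i 1F))) (merge 56 16 896 (sum (γ i)) refl) (ℕₚ.*-monoʳ-< 56
        (ℕₚ.+-cancelˡ-< (sum (β i 1F)) _ _ (subst₂ ℕ._<_ (e₁ (sum (β i 1F))) (e₂ (sum (β i 1F)) (sum (γ i)))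
          (good (β i 1F) (λ b → idem (β-01 i 1F b)) 4 2F a₁ (cong (ℕ._* In 1F (a₀ - a₁)) (disjoint 1F i 1≢i (proj₁ a₁∈))) not-bad)))))
        where
        e₁ : ∀ s → 4 ℕ.* s ≡ s ℕ.+ 3 ℕ.* s
        e₁ = solve-∀
        e₂ : ∀ s t → s ℕ.+ 4 ℕ.* (4 ℕ.* t) ≡ s ℕ.+ 16 ℕ.* t
        e₂ = solve-∀

      many₂₂ : 78 ℕ.* n ℕ.< 896 ℕ.* sum (γ 2F)
      many₂₂ = many₂ 2F (λ ()) (proj₁ (zeros (proj₂ (proj₂ step₂)))) many₁₂

      many₂₃ : 78 ℕ.* n ℕ.< 896 ℕ.* sum (γ 3F)
      many₂₃ = many₂ 3F (λ ()) (proj₂ (zeros {bad₂ 2F a₁} (proj₂ (proj₂ step₂)))) many₁₃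

      -- For a₃ a single remaining candidate is enough. With k = 1 an element outside the set that
      -- is not bad satisfies just N > 0.
      bad₃ : Fin q → ℕ
      bad₃ x = ind (Bad? (γ 3F) (λ b → idem (γ-01 3F b)) 1 3F x)

      abstract
        step₃ : ∃[ x ] (γ 2F x ≡ 1 × bad₃ x ≡ 0)
        step₃ = pick (γ 2F) bad₃ (γ-01 2F) (scaled-<₂ 896 78 (ℕₚ.*-monoʳ-≤ 896 few)
          (ℕₚ.<-≤-trans (ℕₚ.≤-<-trans
            (ℕₚ.≤-trans (ℕₚ.≤ᵇ⇒≤ (896 ℕ.* 64512) (78 ℕ.* (78 ℕ.* 10700)) _) (ℕₚ.*-monoʳ-≤ 78 (ℕₚ.*-monoʳ-≤ 78 large)))
            (ℕₚ.*-monoʳ-< 78 many₂₂)) (ℕₚ.≤-reflexive (exchange 78 896 (sum (γ 2F))))))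
          where
          few : 78 ℕ.* sum bad₃ ℕ.≤ 64512
          few = few-bad′ (γ 3F) (λ b → idem (γ-01 3F b)) 1 3F 78 896 (>⇒positive 896 many₂₃) (ℕₚ.<⇒≤ many₂₃)

    a₂ : Fin q
    a₂ = proj₁ step₃

    private
      a₂∈′ : β 2F 1F a₂ ≡ 1 × In 2F (a₁ - a₂) ≡ 1
      a₂∈′ = factors (β-01 2F 1F a₂) (In-01 2F (a₁ - a₂)) (proj₁ (proj₂ step₃))

    a₂∈ : In 2F a₂ ≡ 1 × In 1F (a₀ - a₂) ≡ 1
    a₂∈ = factors (In-01 2F a₂) (In-01 1F (a₀ - a₂)) (proj₁ a₂∈′)

    private
      abstract
        step₄ : ∃[ x ] (γ 3F x ℕ.* In 3F (a₂ - x) ≡ 1 × 0 ≡ 0)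
        step₄ = pick (λ x → γ 3F x ℕ.* In 3F (a₂ - x)) (λ _ → 0) (λ x → *-01 (γ-01 3F x) (In-01 3F (a₂ - x)))
          (ℕₚ.≤-<-trans (ℕₚ.≤-reflexive (sum-zero {q} (λ _ → 0) (λ _ → refl))) (>⇒positive 4 (ℕₚ.+-cancelˡ-< (sum (γ 3F)) 0 _ (subst₂ ℕ._<_
            (e₁ (sum (γ 3F))) (cong (sum (γ 3F) ℕ.+_) (ℕₚ.*-identityˡ _))
            (good (γ 3F) (λ b → idem (γ-01 3F b)) 1 3F a₂
              (cong (λ z → z ℕ.* In 1F (a₀ - a₂) ℕ.* In 2F (a₁ - a₂)) (disjoint 2F 3F (λ ()) (proj₁ a₂∈))) (proj₂ (proj₂ step₃)))))))
          where
          e₁ : ∀ s → 1 ℕ.* s ≡ s ℕ.+ 0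
          e₁ = solve-∀

    a₃ : Fin q
    a₃ = proj₁ step₄

    private
      a₃∈ : γ 3F a₃ ≡ 1 × In 3F (a₂ - a₃) ≡ 1
      a₃∈ = factors (γ-01 3F a₃) (In-01 3F (a₂ - a₃)) (proj₁ (proj₂ step₄))

      a₃∈′ : β 3F 1F a₃ ≡ 1 × In 2F (a₁ - a₃) ≡ 1
      a₃∈′ = factors (β-01 3F 1F a₃) (In-01 2F (a₁ - a₃)) (proj₁ a₃∈)

      a₃∈″ : In 3F a₃ ≡ 1 × In 1F (a₀ - a₃) ≡ 1
      a₃∈″ = factors (In-01 3F a₃) (In-01 1F (a₀ - a₃)) (proj₁ a₃∈′)

    large-witness : Witness
    large-witness = witness I²≡-1 a₀ a₁ a₂ a₃ 0F 1F 2F 3F 0F 1F 2F 1F 2F 3F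
      (In⇒≡ 0F a₀∈) (In⇒≡ 1F (proj₁ a₁∈)) (In⇒≡ 2F (proj₁ a₂∈)) (In⇒≡ 3F (proj₁ a₃∈″))
      (In⇒≡ 0F (proj₂ a₁∈)) (In⇒≡ 1F (proj₂ a₂∈)) (In⇒≡ 2F (proj₂ a₂∈′))
      (In⇒≡ 1F (proj₂ a₃∈″)) (In⇒≡ 2F (proj₂ a₃∈′)) (In⇒≡ 3F (proj₂ a₃∈))
      cover cover cover′
      where
      cover : ∀ m → ind (m ≟ 0F) ℕ.+ (ind (m ≟ 1F) ℕ.+ (ind (m ≟ 2F) ℕ.+ ind (m ≟ 3F))) ≡ 1
      cover 0F = refl
      cover 1F = refl
      cover 2F = refl
      cover 3F = refl
      cover′ : ∀ m → ind (m ≟ 1F) ℕ.+ (ind (m ≟ 2F) ℕ.+ (ind (m ≟ 3F) ℕ.+ ind (m ≟ 0F))) ≡ 1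
      cover′ 0F = refl
      cover′ 1F = refl
      cover′ 2F = refl
      cover′ 3F = refl

-- Verification of witnesses for small q

∧-true : ∀ {a b} → a ∧ b ≡ true → a ≡ true × b ≡ true
∧-true {true} e = refl , e

conjunction : ∀ {m} → (Fin m → Bool) → Bool
conjunction {zero} f = true
conjunction {suc m} f = f zero ∧ conjunction (f ∘ suc)

conjunction-true : ∀ {m} (f : Fin m → Bool) → conjunction f ≡ true → ∀ i → f i ≡ true
conjunction-true f e zero = proj₁ (∧-true e)
conjunction-true f e (suc i) = conjunction-true (f ∘ suc) (proj₂ (∧-true {f zero} e)) i

≡ᵇ-true : ∀ m n → (m ℕ.≡ᵇ n) ≡ true → m ≡ n
≡ᵇ-true m n e = ℕₚ.≡ᵇ⇒≡ m n (subst Bool.T (sym e) _)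

-- A set with computable ring operations, in which candidate witnesses are tested.
record Arithmetic : Set₁ where
  field
    Carrier : Set
    one : Carrier
    mul sub : Carrier → Carrier → Carrier
    eq : Carrier → Carrier → Bool

module Test (A : Arithmetic) where
  open Arithmetic A

  -- exponents are lists of binary digits, least significant first
  power : Carrier → List Bool → Carrier
  power b [] = one
  power b (false ∷ bs) = power (mul b b) bs
  power b (true ∷ bs) = mul b (power (mul b b) bs)

  minus-one : Carrier
  minus-one = sub (sub one one) one

  root : Carrier → Fin 4 → Carrier
  root J 0F = one
  root J 1F = J
  root J 2F = minus-one
  root J 3F = sub (sub one one) J

  -- Only a guess, with 3 as the default: `classified` verifies it afterwards, so a wrong default
  -- makes the test fail but cannot make it unsound.
  class : Carrier → Carrier → Fin 4
  class J y = if eq y one then 0F else if eq y J then 1F else if eq y minus-one then 2F else 3F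

  hit-once : Fin 4 → Fin 4 → Fin 4 → Fin 4 → Fin 4 → Bool
  hit-once i j k l m = (ind (m ≟ i) ℕ.+ (ind (m ≟ j) ℕ.+ (ind (m ≟ k) ℕ.+ ind (m ≟ l)))) ℕ.≡ᵇ 1

  covers : Fin 4 → Fin 4 → Fin 4 → Fin 4 → Bool
  covers i j k l = conjunction (hit-once i j k l)

  classified : Carrier → Carrier → Fin 4 → Bool
  classified J y i = eq y (root J i)

  module _ (J y₀ y₁ y₂ y₃ y₀₁ y₀₂ y₁₂ y₀₃ y₁₃ y₂₃ : Carrier) where
    -- The powers are arguments, so that the guessed classes and the checks refer to the same
    -- values. The vector form lets `test-sound` retrieve every single check by its index.
    checks-for : (i₀ i₁ i₂ i₃ j₀₁ j₀₂ j₁₂ j₀₃ j₁₃ j₂₃ : Fin 4) → Vec Bool 14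
    checks-for i₀ i₁ i₂ i₃ j₀₁ j₀₂ j₁₂ j₀₃ j₁₃ j₂₃ =
      eq (mul J J) minus-one ∷
      classified J y₀ i₀ ∷ classified J y₁ i₁ ∷ classified J y₂ i₂ ∷ classified J y₃ i₃ ∷
      classified J y₀₁ j₀₁ ∷ classified J y₀₂ j₀₂ ∷ classified J y₁₂ j₁₂ ∷
      classified J y₀₃ j₀₃ ∷ classified J y₁₃ j₁₃ ∷ classified J y₂₃ j₂₃ ∷
      covers i₀ i₁ i₂ i₃ ∷ covers j₀₁ j₀₂ j₁₂ j₂₃ ∷ covers j₀₃ j₁₃ j₂₃ j₀₁ ∷ []

    checks : Vec Bool 14
    checks = checks-for (class J y₀) (class J y₁) (class J y₂) (class J y₃)
      (class J y₀₁) (class J y₀₂) (class J y₁₂) (class J y₀₃) (class J y₁₃) (class J y₂₃)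

  -- In a witness starting with 1, the power of a₁ or of a₂ is a square root of -1.
  choose-J : Carrier → Carrier → Carrier
  choose-J y₁ y₂ = if eq (mul y₁ y₁) minus-one then y₁ else y₂

  test-J : Carrier → Carrier → List Bool → Carrier → Carrier → Carrier → Vec Bool 14
  test-J y₁ y₂ bs a₁ a₂ a₃ = checks (choose-J y₁ y₂) (power one bs) y₁ y₂ (power a₃ bs)
    (power (sub one a₁) bs) (power (sub one a₂) bs) (power (sub a₁ a₂) bs)
    (power (sub one a₃) bs) (power (sub a₁ a₃) bs) (power (sub a₂ a₃) bs)

  test : List Bool → Carrier → Carrier → Carrier → Bool
  test bs a₁ a₂ a₃ = conjunction (Vec.lookup (test-J (power a₁ bs) (power a₂ bs) bs a₁ a₂ a₃))

value : List Bool → ℕ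
value [] = 0
value (false ∷ bs) = 2 ℕ.* value bs
value (true ∷ bs) = suc (2 ℕ.* value bs)

-- A witness consists of equations alone, so it is enough that a positive answer of `eq` is sound;
-- the map may identify elements that `eq` tells apart.
record Interpretation (A : Arithmetic) {q : ℕ} (F : FieldOn q) : Set where
  open Arithmetic A
  open FieldTheory F
  field
    ⟦_⟧ : Carrier → Fin q
    ⟦one⟧ : ⟦ one ⟧ ≡ 1#
    ⟦mul⟧ : ∀ a b → ⟦ mul a b ⟧ ≡ ⟦ a ⟧ * ⟦ b ⟧
    ⟦sub⟧ : ∀ a b → ⟦ sub a b ⟧ ≡ ⟦ a ⟧ - ⟦ b ⟧
    ⟦eq⟧ : ∀ a b → eq a b ≡ true → ⟦ a ⟧ ≡ ⟦ b ⟧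

module Soundness (A : Arithmetic) (n : ℕ) (0<n : 0 ℕ.< n) (F : FieldOn (8 ℕ.* n ℕ.+ 1)) (M : Interpretation A F) where
  open Arithmetic A
  open Test A
  open Interpretation M
  open QuarticClasses n 0<n F

  private
    square : ∀ b m → ⟦ mul b b ⟧ ^ m ≡ ⟦ b ⟧ ^ (2 ℕ.* m)
    square b m = trans (cong (_^ m) (trans (⟦mul⟧ b b) (cong (⟦ b ⟧ *_) (sym (*-identityʳ ⟦ b ⟧))))) (^-assocʳ ⟦ b ⟧ 2 m)

  ⟦power⟧ : ∀ b bs → ⟦ power b bs ⟧ ≡ ⟦ b ⟧ ^ value bs
  ⟦power⟧ b [] = ⟦one⟧
  ⟦power⟧ b (false ∷ bs) = trans (⟦power⟧ (mul b b) bs) (square b (value bs))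
  ⟦power⟧ b (true ∷ bs) = trans (⟦mul⟧ b (power (mul b b) bs)) (cong (⟦ b ⟧ *_) (trans (⟦power⟧ (mul b b) bs) (square b (value bs))))

  ⟦minus-one⟧ : ⟦ minus-one ⟧ ≡ - 1#
  ⟦minus-one⟧ = trans (⟦sub⟧ (sub one one) one) (trans (cong₂ _-_ (trans (⟦sub⟧ one one) (-‿inverseʳ ⟦ one ⟧)) ⟦one⟧) (+-identityˡ (- 1#)))

  covers-sound : ∀ i j k l → covers i j k l ≡ true → ∀ m → ind (m ≟ i) ℕ.+ (ind (m ≟ j) ℕ.+ (ind (m ≟ k) ℕ.+ ind (m ≟ l))) ≡ 1
  covers-sound i j k l e m = ≡ᵇ-true _ _ (conjunction-true (hit-once i j k l) e m)

  test-sound : ∀ bs a₁ a₂ a₃ → value bs ≡ 2 ℕ.* n → test bs a₁ a₂ a₃ ≡ true → Witness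
  test-sound bs a₁ a₂ a₃ bs≡ e = witness JJ≡-1 ⟦ one ⟧ ⟦ a₁ ⟧ ⟦ a₂ ⟧ ⟦ a₃ ⟧
      (cl one) (cl a₁) (cl a₂) (cl a₃) (cl (sub one a₁)) (cl (sub one a₂)) (cl (sub a₁ a₂)) (cl (sub one a₃)) (cl (sub a₁ a₃)) (cl (sub a₂ a₃))
      (element one (holds 1F)) (element a₁ (holds 2F)) (element a₂ (holds 3F)) (element a₃ (holds 4F))
      (difference one a₁ (holds 5F)) (difference one a₂ (holds 6F)) (difference a₁ a₂ (holds 7F))
      (difference one a₃ (holds 8F)) (difference a₁ a₃ (holds 9F)) (difference a₂ a₃ (holds (suc 9F)))
      (covers-sound (cl one) (cl a₁) (cl a₂) (cl a₃) (holds (suc (suc 9F))))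
      (covers-sound (cl (sub one a₁)) (cl (sub one a₂)) (cl (sub a₁ a₂)) (cl (sub a₂ a₃)) (holds (suc (suc (suc 9F)))))
      (covers-sound (cl (sub one a₃)) (cl (sub a₁ a₃)) (cl (sub a₂ a₃)) (cl (sub one a₁)) (holds (suc (suc (suc (suc 9F))))))
    where
    holds : ∀ i → Vec.lookup (test-J (power a₁ bs) (power a₂ bs) bs a₁ a₂ a₃) i ≡ true
    holds = conjunction-true (Vec.lookup (test-J (power a₁ bs) (power a₂ bs) bs a₁ a₂ a₃)) e
    J : Carrier
    J = choose-J (power a₁ bs) (power a₂ bs)
    cl : Carrier → Fin 4
    cl a = class J (power a bs)
    JJ≡-1 : ⟦ J ⟧ * ⟦ J ⟧ ≡ - 1#
    JJ≡-1 = trans (sym (⟦mul⟧ J J)) (trans (⟦eq⟧ (mul J J) minus-one (holds 0F)) ⟦minus-one⟧)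
    open FourthRoots ⟦ J ⟧ JJ≡-1 using () renaming (ρ to ρᴶ)
    ⟦root⟧ : ∀ i → ⟦ root J i ⟧ ≡ ρᴶ i
    ⟦root⟧ 0F = ⟦one⟧
    ⟦root⟧ 1F = refl
    ⟦root⟧ 2F = ⟦minus-one⟧
    ⟦root⟧ 3F = trans (⟦sub⟧ (sub one one) J) (trans (cong (_- ⟦ J ⟧) (trans (⟦sub⟧ one one) (-‿inverseʳ ⟦ one ⟧))) (+-identityˡ (- ⟦ J ⟧)))
    element : ∀ a → classified J (power a bs) (cl a) ≡ true → φ ⟦ a ⟧ ≡ ρᴶ (cl a)
    element a e = trans (φ-def ⟦ a ⟧) (trans (cong (⟦ a ⟧ ^_) (sym bs≡)) (trans (sym (⟦power⟧ a bs)) (trans (⟦eq⟧ (power a bs) (root J (cl a)) e) (⟦root⟧ (cl a)))))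
    difference : ∀ a b → classified J (power (sub a b) bs) (cl (sub a b)) ≡ true → φ (⟦ a ⟧ - ⟦ b ⟧) ≡ ρᴶ (cl (sub a b))
    difference a b e = trans (cong φ (sym (⟦sub⟧ a b))) (element (sub a b) e)

-- Computable models of the small fields

module Characteristic {q p : ℕ} (k : ℕ) (p^k≡q : p ℕ.^ k ≡ q) (F : FieldOn q) where
  open FieldTheory F

  ι : ℕ → Fin q
  ι m = m · 1#

  -- Adding 1 permutes the field, so the sum of all elements is unchanged.
  ι-q : ι q ≡ 0#
  ι-q = begin
    ι q ≡⟨ solve 2 (λ s m → m := (s :+ m) :- s) refl s (ι q) ⟩
    (s + ι q) - s ≡⟨ cong (_- s) (trans (cong (s +_) (sym (sumF-replicate q {1#}))) (sym (sumF-+ {q} (λ x → x) (λ _ → 1#)))) ⟩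
    sumF (λ x → x + 1#) - s ≡⟨ cong (_- s) (sumF-permute (λ x → x) translation) ⟨
    s - s ≡⟨ -‿inverseʳ s ⟩
    0# ∎
    where
    open ≡-Reasoning
    open Algebra.Properties.CommutativeMonoid.Sum (CommutativeRing.+-commutativeMonoid F-ring) using () renaming
      (sum to sumF; sum-replicate to sumF-replicate; ∑-distrib-+ to sumF-+; ∑-permute to sumF-permute)
    s : Fin q
    s = sumF {q} (λ x → x)
    translation : Permutation q q
    translation = permutation (_+ 1#) (_- 1#) (λ x → solve 2 (λ x e → (x :- e) :+ e := x) refl x 1#) (λ x → solve 2 (λ x e → (x :+ e) :- e := x) refl x 1#)

  ι-^ : ∀ m → ι (p ℕ.^ m) ≡ ι p ^ m
  ι-^ zero = +-identityʳ 1#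
  ι-^ (suc m) = trans (×1-homo-* p (p ℕ.^ m)) (cong (ι p *_) (ι-^ m))

  -- The k-th power of ι p is ι q = 0, and a field has no nilpotent elements except 0.
  ι-p : ι p ≡ 0#
  ι-p = ^-≡0 k (trans (sym (ι-^ k)) (trans (cong ι p^k≡q) ι-q))

  ι-* : ∀ a b → ι (a ℕ.* b) ≡ ι a * ι b
  ι-* = ×1-homo-*

  ι-+ : ∀ a b → ι (a ℕ.+ b) ≡ ι a + ι b
  ι-+ = ×-homo-+ 1#

module Characteristic⁺ {q p′ : ℕ} (k : ℕ) (p^k≡q : suc p′ ℕ.^ k ≡ q) (F : FieldOn q) where
  open FieldTheory F
  open Characteristic k p^k≡q F public

  ι-% : ∀ m → ι (m ℕ.% suc p′) ≡ ι m
  ι-% m = sym (begin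
    ι m ≡⟨ cong ι (ℕ÷.m≡m%n+[m/n]*n m (suc p′)) ⟩
    ι (m ℕ.% suc p′ ℕ.+ (m ℕ./ suc p′) ℕ.* suc p′) ≡⟨ trans (ι-+ (m ℕ.% suc p′) _) (cong (ι (m ℕ.% suc p′) +_) (ι-* (m ℕ./ suc p′) (suc p′))) ⟩
    ι (m ℕ.% suc p′) + ι (m ℕ./ suc p′) * ι (suc p′) ≡⟨ cong (λ z → ι (m ℕ.% suc p′) + ι (m ℕ./ suc p′) * z) ι-p ⟩
    ι (m ℕ.% suc p′) + ι (m ℕ./ suc p′) * 0# ≡⟨ trans (cong (ι (m ℕ.% suc p′) +_) (zeroʳ _)) (+-identityʳ _) ⟩
    ι (m ℕ.% suc p′) ∎)
    where open ≡-Reasoning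

  ι-p′ : ι p′ ≡ - 1#
  ι-p′ = difference≡0⇒≡ (trans (solve 2 (λ e m → m :- :- e := e :+ m) refl 1# (ι p′)) ι-p)

  ι-minus : ∀ a b → ι (a ℕ.+ b ℕ.* p′) ≡ ι a - ι b
  ι-minus a b = trans (ι-+ a (b ℕ.* p′)) (cong (ι a +_) (trans (ι-* b p′) (trans (cong (ι b *_) ι-p′)
    (trans (sym (-‿distribʳ-* (ι b) 1#)) (cong -_ (*-identityʳ (ι b)))))))

-- Modulo p = p′ + 1 the number p′ is -1, so b * p′ acts as - b and truncated subtraction is
-- avoided.
prime-arithmetic : ℕ → Arithmetic
prime-arithmetic p′ = record
  { Carrier = ℕ
  ; one = 1
  ; mul = λ a b → (a ℕ.* b) ℕ.% suc p′
  ; sub = λ a b → (a ℕ.+ b ℕ.* p′) ℕ.% suc p′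
  ; eq = ℕ._≡ᵇ_ }

prime-interpretation : ∀ {q p′} k → suc p′ ℕ.^ k ≡ q → (F : FieldOn q) → Interpretation (prime-arithmetic p′) F
prime-interpretation {p′ = p′} k p^k≡q F = record
  { ⟦_⟧ = ι
  ; ⟦one⟧ = +-identityʳ 1#
  ; ⟦mul⟧ = λ a b → trans (ι-% (a ℕ.* b)) (ι-* a b)
  ; ⟦sub⟧ = λ a b → trans (ι-% (a ℕ.+ b ℕ.* p′)) (ι-minus a b)
  ; ⟦eq⟧ = λ a b e → cong ι (≡ᵇ-true a b e) }
  where
  open FieldTheory F
  open Characteristic⁺ k p^k≡q F

-- Polynomials of degree below k over ℤ/p, constant term first, modulo x ^ k = c.
module Extension (p′ : ℕ) where
  -- One operation for three purposes: reduction of the leading term by x ^ k = c, accumulation in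
  -- `product`, and subtraction, with the multiplier p′ standing for -1.
  add-multiple : ∀ {k} → ℕ → Vec ℕ k → Vec ℕ k → Vec ℕ k
  add-multiple t [] [] = []
  add-multiple t (a ∷ l) (c ∷ cs) = ((a ℕ.+ t ℕ.* c) ℕ.% suc p′) ∷ add-multiple t l cs

  -- the lower coefficients and the leading coefficient of v + x l
  shift : ∀ {k} → ℕ → Vec ℕ k → Vec ℕ k × ℕ
  shift v [] = [] , v
  shift v (a ∷ l) with shift a l
  ... | l′ , t = (v ∷ l′) , t

  times-x : ∀ {k} → Vec ℕ k → Vec ℕ k → Vec ℕ k
  times-x c l with shift 0 l
  ... | l′ , t = add-multiple t l′ c

  -- Horner's scheme in the first factor, with a reduction after every multiplication by x.
  product : ∀ {m k} → Vec ℕ k → Vec ℕ m → Vec ℕ k → Vec ℕ k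
  product c [] b = Vec.replicate _ 0
  product c (a ∷ as) b = add-multiple a (times-x c (product c as b)) b

  equal : ∀ {k} → Vec ℕ k → Vec ℕ k → Bool
  equal [] [] = true
  equal (a ∷ l) (b ∷ m) = (a ℕ.≡ᵇ b) ∧ equal l m

  extension-arithmetic : ∀ {k} → Vec ℕ (suc k) → Arithmetic
  extension-arithmetic {k} c = record
    { Carrier = Vec ℕ (suc k)
    ; one = 1 ∷ Vec.replicate k 0
    ; mul = product c
    ; sub = add-multiple p′
    ; eq = equal }

  iterate-x : ∀ {k} → ℕ → Vec ℕ k → Vec ℕ k → Vec ℕ k
  iterate-x zero c l = l
  iterate-x (suc j) c l = iterate-x j c (times-x c l)

  -- x ^ (2 + k + j) = x modulo x ^ (2 + k) = c
  splits : ∀ {k} → ℕ → Vec ℕ (suc (suc k)) → Bool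
  splits {k} j c = equal (iterate-x j c c) (0 ∷ 1 ∷ Vec.replicate k 0)

  module _ {q m} (p^m≡q : suc p′ ℕ.^ m ≡ q) (F : FieldOn q) where
    open FieldTheory F
    open Characteristic⁺ m p^m≡q F

    eval : ∀ {k} → Fin q → Vec ℕ k → Fin q
    eval y [] = 0#
    eval y (a ∷ l) = ι a + y * eval y l

    eval-zero : ∀ y k → eval y (Vec.replicate k 0) ≡ 0#
    eval-zero y zero = refl
    eval-zero y (suc k) = trans (+-identityˡ _) (trans (cong (y *_) (eval-zero y k)) (zeroʳ y))

    eval-add-multiple : ∀ {k} y t (l c : Vec ℕ k) → eval y (add-multiple t l c) ≡ eval y l + ι t * eval y c
    eval-add-multiple y t [] [] = sym (trans (+-identityˡ _) (zeroʳ (ι t)))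
    eval-add-multiple y t (a ∷ l) (c ∷ cs) = trans
      (cong₂ (λ z w → z + y * w) (trans (ι-% (a ℕ.+ t ℕ.* c)) (trans (ι-+ a (t ℕ.* c)) (cong (ι a +_) (ι-* t c)))) (eval-add-multiple y t l cs))
      (solve 6 (λ a t c y l s → (a :+ t :* c) :+ y :* (l :+ t :* s) := (a :+ y :* l) :+ t :* (c :+ y :* s)) refl (ι a) (ι t) (ι c) y (eval y l) (eval y cs))

    eval-shift : ∀ {k} y v (l : Vec ℕ k) → eval y (proj₁ (shift v l)) + ι (proj₂ (shift v l)) * y ^ k ≡ ι v + y * eval y l
    eval-shift y v [] = trans (+-identityˡ _) (trans (*-identityʳ (ι v)) (sym (trans (cong (ι v +_) (zeroʳ y)) (+-identityʳ (ι v)))))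
    eval-shift {suc k} y v (a ∷ l) = trans
      (solve 5 (λ v y e t z → (v :+ y :* e) :+ t :* (y :* z) := v :+ y :* (e :+ t :* z)) refl (ι v) y (eval y (proj₁ (shift a l))) (ι (proj₂ (shift a l))) (y ^ k))
      (cong (λ z → ι v + y * z) (eval-shift y a l))

    -- The multiple of y ^ k - c(y) that the reduction discards is kept. It vanishes at a root θ,
    -- and for arbitrary y its factor t becomes a coefficient of the quotient in `root-exists`.
    eval-times-x : ∀ {k} y (c l : Vec ℕ k) → ∃[ t ] y * eval y l ≡ (y ^ k - eval y c) * ι t + eval y (times-x c l)
    eval-times-x {k} y c l = t , sym (begin
      (y ^ k - eval y c) * ι t + eval y (add-multiple t l′ c) ≡⟨ cong ((y ^ k - eval y c) * ι t +_) (eval-add-multiple y t l′ c) ⟩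
      (y ^ k - eval y c) * ι t + (eval y l′ + ι t * eval y c) ≡⟨ solve 4 (λ z c t l → (z :- c) :* t :+ (l :+ t :* c) := l :+ t :* z) refl (y ^ k) (eval y c) (ι t) (eval y l′) ⟩
      eval y l′ + ι t * y ^ k ≡⟨ eval-shift y 0 l ⟩
      0# + y * eval y l ≡⟨ +-identityˡ _ ⟩
      y * eval y l ∎)
      where
      open ≡-Reasoning
      l′ = proj₁ (shift 0 l)
      t = proj₂ (shift 0 l)

    equal-sound : ∀ {k} y (a b : Vec ℕ k) → equal a b ≡ true → eval y a ≡ eval y b
    equal-sound y [] [] e = refl
    equal-sound y (a ∷ l) (b ∷ m) e = cong₂ (λ z w → z + y * w) (cong ι (≡ᵇ-true a b (proj₁ (∧-true e)))) (equal-sound y l m (proj₂ (∧-true e)))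

    module _ {k} (c : Vec ℕ (suc k)) (θ : Fin q) (θ-root : θ ^ suc k ≡ eval θ c) where

      eval-times-θ : ∀ l → eval θ (times-x c l) ≡ θ * eval θ l
      eval-times-θ l = sym (trans (proj₂ (eval-times-x θ c l)) (trans (cong (_+ eval θ (times-x c l))
        (trans (cong (_* ι t) (≡⇒difference≡0 θ-root)) (zeroˡ (ι t)))) (+-identityˡ _)))
        where
        t : ℕ
        t = proj₁ (eval-times-x θ c l)

      eval-product : ∀ {m} (a : Vec ℕ m) b → eval θ (product c a b) ≡ eval θ a * eval θ b
      eval-product [] b = trans (eval-zero θ (suc k)) (sym (zeroˡ (eval θ b)))
      eval-product (a ∷ as) b = trans (eval-add-multiple θ a (times-x c (product c as b)) b)
        (trans (cong (_+ ι a * eval θ b) (trans (eval-times-θ (product c as b)) (cong (θ *_) (eval-product as b))))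
        (solve 4 (λ t s b a → t :* (s :* b) :+ a :* b := (a :+ t :* s) :* b) refl θ (eval θ as) (eval θ b) (ι a)))

      extension-interpretation : Interpretation (extension-arithmetic c) F
      extension-interpretation = record
        { ⟦_⟧ = eval θ
        ; ⟦one⟧ = trans (cong₂ _+_ (+-identityʳ 1#) (trans (cong (θ *_) (eval-zero θ k)) (zeroʳ θ))) (+-identityʳ 1#)
        ; ⟦mul⟧ = eval-product
        ; ⟦sub⟧ = λ a b → trans (eval-add-multiple θ p′ a b) (cong (eval θ a +_) (trans (cong (_* eval θ b) ι-p′)
            (trans (sym (-‿distribˡ-* 1# (eval θ b))) (cong -_ (*-identityˡ (eval θ b))))))
        ; ⟦eq⟧ = equal-sound θ }

    -- Since y ^ q = y for all y, the polynomial x ^ q - x = (x ^ k - c) g vanishes everywhere, but g has degree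
    -- q - k and cannot.
    root-exists : ∀ {k} j (c : Vec ℕ (suc (suc k))) → suc (suc k) ℕ.+ j ≡ q → splits j c ≡ true →
      ∃[ θ ] θ ^ suc (suc k) ≡ eval θ c
    root-exists {k} j c k+j≡q e = from-nonroot (monic-nonroot (ℕₚ.≤-trans (ℕ.s≤s (ℕₚ.m≤n+m j (suc k))) (ℕₚ.≤-reflexive k+j≡q)) quotient)
      where
      K = suc (suc k)
      -- Long division of powers of x by x ^ K - c, with monic quotient g and remainder l.
      -- Multiplying by x moves the leading coefficient cut off from x l into g as its new constant
      -- term.
      divide : ∀ j l {d} (g : Vec (Fin q) d) → (∀ y → y ^ (K ℕ.+ d) ≡ (y ^ K - eval y c) * monic g y + eval y l) →
        Σ (Vec (Fin q) (j ℕ.+ d)) λ g → ∀ y → y ^ (K ℕ.+ (j ℕ.+ d)) ≡ (y ^ K - eval y c) * monic g y + eval y (iterate-x j c l)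
      divide zero l g inv = g , inv
      divide (suc j) l {d} g inv = subst
        (λ d′ → Σ (Vec (Fin q) d′) λ g → ∀ y → y ^ (K ℕ.+ d′) ≡ (y ^ K - eval y c) * monic g y + eval y (iterate-x j c (times-x c l)))
        (ℕₚ.+-suc j d)
        (divide j (times-x c l) (ι (proj₂ (shift 0 l)) ∷ g) λ y → begin
          y ^ (K ℕ.+ suc d) ≡⟨ cong (y ^_) (ℕₚ.+-suc K d) ⟩
          y * y ^ (K ℕ.+ d) ≡⟨ cong (y *_) (inv y) ⟩
          y * ((y ^ K - eval y c) * monic g y + eval y l) ≡⟨ distribˡ y _ _ ⟩
          y * ((y ^ K - eval y c) * monic g y) + y * eval y l ≡⟨ cong (y * ((y ^ K - eval y c) * monic g y) +_) (proj₂ (eval-times-x y c l)) ⟩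
          y * ((y ^ K - eval y c) * monic g y) + ((y ^ K - eval y c) * ι (proj₂ (shift 0 l)) + eval y (times-x c l))
            ≡⟨ solve 5 (λ y f m t r → y :* (f :* m) :+ (f :* t :+ r) := f :* (t :+ y :* m) :+ r) refl y (y ^ K - eval y c) (monic g y) (ι (proj₂ (shift 0 l))) (eval y (times-x c l)) ⟩
          (y ^ K - eval y c) * (ι (proj₂ (shift 0 l)) + y * monic g y) + eval y (times-x c l) ∎)
        where open ≡-Reasoning
      start : ∀ y → y ^ (K ℕ.+ 0) ≡ (y ^ K - eval y c) * 1# + eval y c
      start y = trans (cong (y ^_) (ℕₚ.+-identityʳ K)) (trans (solve 2 (λ z c → z := (z :- c) :+ c) refl (y ^ K) (eval y c))
        (cong (_+ eval y c) (sym (*-identityʳ (y ^ K - eval y c)))))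
      division : Σ (Vec (Fin q) j) λ g → ∀ y → y ^ (K ℕ.+ j) ≡ (y ^ K - eval y c) * monic g y + eval y (iterate-x j c c)
      division = subst (λ d → Σ (Vec (Fin q) d) λ g → ∀ y → y ^ (K ℕ.+ d) ≡ (y ^ K - eval y c) * monic g y + eval y (iterate-x j c c))
        (ℕₚ.+-identityʳ j) (divide j c [] start)
      quotient = proj₁ division
      eval-x : ∀ y → eval y (0 ∷ 1 ∷ Vec.replicate k 0) ≡ y
      eval-x y = begin
        0# + y * ((1# + 0#) + y * eval y (Vec.replicate k 0)) ≡⟨ +-identityˡ _ ⟩
        y * ((1# + 0#) + y * eval y (Vec.replicate k 0)) ≡⟨ cong₂ (λ a b → y * (a + y * b)) (+-identityʳ 1#) (eval-zero y k) ⟩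
        y * (1# + y * 0#) ≡⟨ cong (λ z → y * (1# + z)) (zeroʳ y) ⟩
        y * (1# + 0#) ≡⟨ cong (y *_) (+-identityʳ 1#) ⟩
        y * 1# ≡⟨ *-identityʳ y ⟩
        y ∎
        where open ≡-Reasoning
      vanish : ∀ y → monic quotient y * (y ^ K - eval y c) ≡ 0#
      vanish y = begin
        monic quotient y * (y ^ K - eval y c) ≡⟨ solve 3 (λ m f r → m :* f := (f :* m :+ r) :- r) refl (monic quotient y) (y ^ K - eval y c) (eval y (iterate-x j c c)) ⟩
        ((y ^ K - eval y c) * monic quotient y + eval y (iterate-x j c c)) - eval y (iterate-x j c c)
          ≡⟨ cong₂ _-_ (trans (sym (proj₂ division y)) (trans (cong (y ^_) k+j≡q) (x^q≡x y))) (trans (equal-sound y (iterate-x j c c) (0 ∷ 1 ∷ Vec.replicate k 0) e) (eval-x y)) ⟩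
        y - y ≡⟨ -‿inverseʳ y ⟩
        0# ∎
        where open ≡-Reasoning
      from-nonroot : ∃[ y ] monic quotient y ≢ 0# → ∃[ θ ] θ ^ K ≡ eval θ c
      from-nonroot (y , nonroot) = y , difference≡0⇒≡ (integral (vanish y) nonroot)

    -- If r ^ (m + 1) = 1 with k (m + 1) = q - 1 and y ^ k ≠ r for all y, then the cofactor of y ^ k - r in
    -- (y ^ k) ^ (m + 1) - r ^ (m + 1) has too many roots.
    binomial-root-exists : ∀ {k} m r → suc k ℕ.* suc m ℕ.+ 1 ≡ q → ι r ^ suc m ≡ 1# → ∃[ θ ] θ ^ suc k ≡ ι r
    -- The prepended coefficient 0 multiplies the cofactor by y, so the nonroot is itself nonzero
    -- and its power with exponent q - 1 is 1.
    binomial-root-exists {k} m r km+1≡q r^m≡1 = from-nonroot (monic-nonroot degree< (0# ∷ proj₁ (cofactor m)))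
      where
      K = suc k
      monic-shift : ∀ j {d} (v : Vec (Fin q) d) y → monic (Vec.replicate j 0# Vec.++ v) y ≡ y ^ j * monic v y
      monic-shift zero v y = sym (*-identityˡ _)
      monic-shift (suc j) v y = trans (+-identityˡ _) (trans (cong (y *_) (monic-shift j v y)) (sym (*-assoc y (y ^ j) _)))
      cofactor : ∀ m → Σ (Vec (Fin q) (m ℕ.* K)) λ g → ∀ y → (y ^ K) ^ suc m - ι r ^ suc m ≡ (y ^ K - ι r) * monic g y
      cofactor zero = [] , λ y → solve 3 (λ z r e → z :* e :- r :* e := (z :- r) :* e) refl (y ^ K) (ι r) 1#
      cofactor (suc m) = (ι r ^ suc m ∷ (Vec.replicate k 0# Vec.++ g)) , λ y → begin
        y ^ K * (y ^ K) ^ suc m - ι r * ι r ^ suc m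
          ≡⟨ solve 4 (λ z w r s → z :* w :- r :* s := (z :- r) :* s :+ z :* (w :- s)) refl (y ^ K) ((y ^ K) ^ suc m) (ι r) (ι r ^ suc m) ⟩
        (y ^ K - ι r) * ι r ^ suc m + y ^ K * ((y ^ K) ^ suc m - ι r ^ suc m)
          ≡⟨ cong (λ z → (y ^ K - ι r) * ι r ^ suc m + y ^ K * z) (proj₂ (cofactor m) y) ⟩
        (y ^ K - ι r) * ι r ^ suc m + (y * y ^ k) * ((y ^ K - ι r) * monic g y)
          ≡⟨ solve 5 (λ f s y z g → f :* s :+ (y :* z) :* (f :* g) := f :* (s :+ y :* (z :* g))) refl (y ^ K - ι r) (ι r ^ suc m) y (y ^ k) (monic g y) ⟩
        (y ^ K - ι r) * (ι r ^ suc m + y * (y ^ k * monic g y))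
          ≡⟨ cong (λ z → (y ^ K - ι r) * (ι r ^ suc m + y * z)) (monic-shift k g y) ⟨
        (y ^ K - ι r) * (ι r ^ suc m + y * monic (Vec.replicate k 0# Vec.++ g) y) ∎
        where
        open ≡-Reasoning
        g : Vec (Fin q) (m ℕ.* K)
        g = proj₁ (cofactor m)
      degree< : suc (m ℕ.* K) ℕ.< q
      degree< = ℕₚ.≤-trans (ℕ.s≤s (ℕ.s≤s (ℕₚ.m≤n+m (m ℕ.* K) k))) (ℕₚ.≤-reflexive (trans (eq k m) km+1≡q))
        where
        eq : ∀ k m → suc (suc (k ℕ.+ m ℕ.* suc k)) ≡ suc k ℕ.* suc m ℕ.+ 1
        eq = solve-∀
      from-nonroot : ∃[ y ] 0# + y * monic (proj₁ (cofactor m)) y ≢ 0# → ∃[ θ ] θ ^ K ≡ ι r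
      from-nonroot (y , nonroot) = y , difference≡0⇒≡ (integral (trans (*-comm _ _) (trans (sym (proj₂ (cofactor m) y))
        (≡⇒difference≡0 (trans (^-assocʳ y K (suc m)) (trans y^km≡1 (sym r^m≡1)))))) g≢0)
        where
        yg≢0 : y * monic (proj₁ (cofactor m)) y ≢ 0#
        yg≢0 = nonroot ∘ trans (+-identityˡ _)
        g≢0 : monic (proj₁ (cofactor m)) y ≢ 0#
        g≢0 g≡0 = yg≢0 (trans (cong (y *_) g≡0) (zeroʳ y))
        y^km≡1 : y ^ (K ℕ.* suc m) ≡ 1#
        y^km≡1 = *-cancelˡ (factorˡ≢0 yg≢0) (trans (cong (y ^_) (ℕₚ.+-comm 1 (K ℕ.* suc m))) (trans (cong (y ^_) km+1≡q) (trans (x^q≡x y) (sym (*-identityʳ y)))))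

-- Tables of witnesses

∨-true : ∀ {a b} → a ∨ b ≡ true → a ≡ true ⊎ b ≡ true
∨-true {true} e = inj₁ refl
∨-true {false} e = inj₂ e

<ᵇ-true : ∀ m n → (m ℕ.<ᵇ n) ≡ true → m ℕ.< n
<ᵇ-true m n e = ℕₚ.<ᵇ⇒< m n (subst Bool.T (sym e) _)

-- The trial divisors are d + 1, d + 1 + s, d + 1 + 2 s, ...
has-divisor : ℕ → ℕ → ℕ → ℕ → Bool
has-divisor zero d s m = false
has-divisor (suc fuel) d s m = ((0 ℕ.<ᵇ d) ∧ ((suc d ℕ.<ᵇ m) ∧ (m ℕ.% suc d ℕ.≡ᵇ 0))) ∨ has-divisor fuel (d ℕ.+ s) s m

has-divisor-sound : ∀ fuel d s m → has-divisor fuel d s m ≡ true → ¬ Prime m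
has-divisor-sound (suc fuel) d s m e m-prime with ∨-true {(0 ℕ.<ᵇ d) ∧ ((suc d ℕ.<ᵇ m) ∧ (m ℕ.% suc d ℕ.≡ᵇ 0))} e
... | inj₂ e′ = has-divisor-sound fuel (d ℕ.+ s) s m e′ m-prime
... | inj₁ e′ with ∧-true {0 ℕ.<ᵇ d} e′
... | 0<d , e″ with ∧-true {suc d ℕ.<ᵇ m} e″
... | d<m , d∣m with prime⇒irreducible m-prime (m%n≡0⇒n∣m m (suc d) (≡ᵇ-true _ _ d∣m))
... | inj₁ d≡1 = ℕₚ.<-irrefl (sym (ℕₚ.suc-injective d≡1)) (<ᵇ-true 0 d 0<d)
... | inj₂ d≡m = ℕₚ.<-irrefl d≡m (<ᵇ-true (suc d) m d<m)

digits : ℕ → ℕ → List Bool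
digits zero m = []
digits (suc fuel) m = (m ℕ.% 2 ℕ.≡ᵇ 1) ∷ digits fuel (m ℕ./ 2)

-- The exponent (q - 1) / 4 = 2n of φ. Eighteen binary digits are ample for q ≤ 85600, and the tests
-- compare `value` with q anyway, so soundness does not rest on this.
quarter : ℕ → List Bool
quarter q = digits 18 ((q ℕ.∸ 1) ℕ./ 4)

value-quarter : ∀ {n bs} → value bs ℕ.* 4 ℕ.+ 1 ≡ 8 ℕ.* n ℕ.+ 1 → value bs ≡ 2 ℕ.* n
value-quarter {n} {bs} e = ℕₚ.*-cancelʳ-≡ (value bs) (2 ℕ.* n) 4 (trans (ℕₚ.+-cancelʳ-≡ 1 _ _ e) (eq n))
  where
  eq : ∀ n → 8 ℕ.* n ≡ 2 ℕ.* n ℕ.* 4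
  eq = solve-∀

-- The decimal number 10000 a₁ + 100 a₂ + a₃ encodes the witness 1, a₁, a₂, a₃.
prime-test : ℕ → ℕ → Bool
prime-test n t = (value bs ℕ.* 4 ℕ.+ 1 ℕ.≡ᵇ 8 ℕ.* n ℕ.+ 1) ∧
  Test.test (prime-arithmetic (8 ℕ.* n)) bs (t ℕ./ 10000) (t ℕ./ 100 ℕ.% 100) (t ℕ.% 100)
  where
  bs = quarter (8 ℕ.* n ℕ.+ 1)

prime-test-sound : ∀ n 0<n (F : FieldOn (8 ℕ.* n ℕ.+ 1)) t → prime-test n t ≡ true → QuarticClasses.Witness n 0<n F
prime-test-sound n 0<n F t e = Soundness.test-sound (prime-arithmetic (8 ℕ.* n)) n 0<n F (prime-interpretation 1 (eq n) F)
    (quarter (8 ℕ.* n ℕ.+ 1)) (t ℕ./ 10000) (t ℕ./ 100 ℕ.% 100) (t ℕ.% 100)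
    (value-quarter {n} {quarter (8 ℕ.* n ℕ.+ 1)} (≡ᵇ-true _ _ (proj₁ both))) (proj₂ both)
  where
  both = ∧-true {value (quarter (8 ℕ.* n ℕ.+ 1)) ℕ.* 4 ℕ.+ 1 ℕ.≡ᵇ 8 ℕ.* n ℕ.+ 1}
    {Test.test (prime-arithmetic (8 ℕ.* n)) (quarter (8 ℕ.* n ℕ.+ 1)) (t ℕ./ 10000) (t ℕ./ 100 ℕ.% 100) (t ℕ.% 100)} e
  eq : ∀ n → suc (8 ℕ.* n) ℕ.^ 1 ≡ 8 ℕ.* n ℕ.+ 1
  eq n = trans (ℕₚ.*-identityʳ (suc (8 ℕ.* n))) (ℕₚ.+-comm 1 (8 ℕ.* n))

-- The table carries no keys: each n that is not excluded consumes the next witness, so the order of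
-- the list determines which n a witness belongs to.
module Sweep (excluded : ℕ → Bool) (accepted : ℕ → ℕ → Bool) where

  sweep : ℕ → ℕ → List ℕ → Bool
  sweep zero n ts = true
  sweep (suc l) n [] = excluded n ∧ sweep l (suc n) []
  sweep (suc l) n (t ∷ ts) = if excluded n then sweep l (suc n) (t ∷ ts) else accepted n t ∧ sweep l (suc n) ts

  sweep-sound : ∀ l n ts → sweep l n ts ≡ true → ∀ i → i ℕ.< l → excluded (n ℕ.+ i) ≡ true ⊎ ∃[ t ] accepted (n ℕ.+ i) t ≡ true
  sweep-sound (suc l) n ts e i i<l = at i i<l
    where
    step : ∀ ts → sweep (suc l) n ts ≡ true → (excluded n ≡ true ⊎ ∃[ t ] accepted n t ≡ true) × ∃[ ts′ ] sweep l (suc n) ts′ ≡ true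
    step [] e with ∧-true {excluded n} e
    ... | d , e′ = inj₁ d , [] , e′
    step (t ∷ ts) e with excluded n
    ... | true = inj₁ refl , t ∷ ts , e
    ... | false with ∧-true {accepted n t} e
    ...   | e₁ , e₂ = inj₂ (t , e₁) , ts , e₂
    at : ∀ i → i ℕ.< suc l → excluded (n ℕ.+ i) ≡ true ⊎ ∃[ t ] accepted (n ℕ.+ i) t ≡ true
    at zero _ = subst (λ m → excluded m ≡ true ⊎ ∃[ t ] accepted m t ≡ true) (sym (ℕₚ.+-identityʳ n)) (proj₁ (step ts e))
    at (suc i) (s≤s i<l) = subst (λ m → excluded m ≡ true ⊎ ∃[ t ] accepted m t ≡ true) (sym (ℕₚ.+-suc n i))
      (sweep-sound l (suc n) (proj₁ (proj₂ (step ts e))) (proj₂ (proj₂ (step ts e))) i i<l)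

-- The odd trial divisors 3, 5, ..., 301 detect every composite 8n + 1 in the range swept, as 301²
-- exceeds 85600.
composite : ℕ → Bool
composite n = has-divisor 150 2 2 (8 ℕ.* n ℕ.+ 1)

-- Each number packs up to 19 witnesses, the first one in its last six decimal digits.
prime-table : List ℕ
prime-table =
  121020060309110714231422060309150514121117150217090621210310120721280327181015050710171120080510141726120511172028 ∷
  241015230522120607080306411038060309051215070608121720181122060309220617070306220617301929100617301334060309080306 ∷
  242128340618051827140718201521110514130309080306080726181020111218121421100618310534140609150511181326180607051215 ∷
  102930222128031314211020120927150511121421060309200217211320140613380937181020301939051215150313150718140224140607 ∷
  60309091319080306031724120515072639260518080306150718080306231047202233382535182234080306140613021520100515420634 ∷
  150712271133070306110720121117271015080306200714480927290617140315340531140708081326140317140607071719231113141125 ∷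
  140708120508291431140309183437140322392235060309140613031020070822200330101525381041070323131214391023150207180712 ∷
  121017080306201521070306230213310539090621051419140708180712140510302547130314150724141117120511241123222124151128 ∷
  80314142526061519320714200817262037301934050710472146121819120915061720140822180327060309100618112835082022262334 ∷
  121020140613080306281827061920080510070608190639140313220915140708201521140613050710180714381534181122140708060309 ∷
  100515262338120927080314240721112025120510191526231128231033141521071233070608181533291334110514201924060309110507 ∷
  302342130318100515140708241020211029022233080733080510050710200219141521150318230620130309070608140223270926302233 ∷
  242128382241273436181015200327421341070608080510240721282730201827300313181326111015130309280927390329200810180633 ∷
  380534200910241020060730301122060309070822220318121117231831131214080510090621181320120721200622071524383055301429 ∷
  143747341322120508121420150525190609222031121117120211301747180321131924101114150714070306301429351521230213070306 ∷
  231130100617081428050710080306120515140612381035080306150714081214050710070608171520381251122128220623130612281229 ∷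
  200729140313070608311030240923141521463067181120150313150527141521110813291428291025060309060309231142150514180514 ∷
  391942230330150313200819050710210210182433100617140708060309110514100618382352110525140607070306080306060309080510 ∷
  321122150326121520311324200919051419251546141520421137060309201322190627321122060309290720191227140609111422372247 ∷
  181015140317070306191130110814150313281521181315301428070306141315142233351424060309181326191218152328061213220912 ∷
  71233060927150210090621351734060309120211140213071419240529050710231020150207251020070608301934222127130320070608 ∷
  31429070608101417231035060309180711080306622967383142300939220912390826090621130212070608070306080306120211130309 ∷
  200708581451060309311419231437232235100515143134051215120620110507232033311730200609151318522253070617220924263747 ∷
  100515080510150207120513020730200819181421141318121020552736091231050710201941130309200721241023120508120211070306 ∷
  60309141521122122300715101227232035150714282730060309081224100618071730080726181524211024472259070608241421080306 ∷
  111314241023071522451150140708241421280327120721140609061720120914241015422349300729071522061720181020100515411852 ∷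
  140617311845150514150207230329384463120510060309152834150318200323563157060309592158321122260522180712200813140708 ∷
  150318120714100517182346060720140708140708180613220621280327150210150511380726180510200729130309140609241926201525 ∷
  60309150511081326130314241123080510120817181122121326182027080306321122230618353447061819262235240927301321220617 ∷
  60717230733060309140612190623271015250524140519140708080306202627391238060309311023241421254071060309080306140609 ∷
  70306070219260549220333201326182357150511200927181133120714220318261215051419211023060309220730080322190612473561 ∷
  141921462952140718130309080306391133150712250324140613232439152835050710151434231128130318340637140310242128200615 ∷
  80510070306070608140708100515500534080306110718302029070306351449070608060309231122060714120211080510220334050710 ∷
  50710121133220617191215120717282736141923181315200615061420180712060309100515441233060309060309120511122939311239 ∷
  140613060714101227150313140708050710140613120508140708301734120721260518121720200721150514381435051215220923112835 ∷
  120511140609231841281521120515141318100515120508200615200615060927121117321122141535120915110814110525100515321122 ∷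
  80510243451220523290526122122191526200323391134060309070822110514220514270515201338241421281521120211061734230310 ∷
  201122101823070306071522122122270321100618603959060309140708140313070608060309122122281830381130201827471241080306 ∷
  150511180321382233081428150525090621141521181938311030120607140613470741130309391133221227242930130309250524112224 ∷
  211025060309072942060812351734200219270633141535210314151018120926201023120211140213060309121117031314140213220721 ∷
  261929070306232025351323060309060309230819121921100515514562440637220621501437051224231033202538210310120927202338 ∷
  120211201525290724130309140317100515211023231033070608150714080306441743111015080510193238200817292134180321210310 ∷
  31830141521241321202124130212200615031830140708070608220617081020173956141319080306080510441043111822141118210314 ∷
  120511071214180613191215211025070822060309051215100618220721681067100515150712210724140217181326602347140613312960 ∷
  231328080306070822270515060309070620270322121117202430501041582352100515150313120515321428140613070608282027180721 ∷
  150714190921110507220617321734060309070608201338381920250620382237140217080306512535140609190612290724120915050710 ∷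
  332245180510220221381029200615401938181922061213230213224259142124150927110514234244301429201521140708281827120515 ∷
  151426100515623843382342150318271122091227120607060309060714061417150514081428192427100515100618110527141520200912 ∷
  140317201011060309231020150207181133180514220221402939521229080306080510351746080510150313190515170320141521300924 ∷
  71119190608110535181520050710110525371534060714150927130309190515222124271020100618281133201215130309111033531960 ∷
  522439240718151425101421441437100515262942141518070306512544220518210320130309301429060309382140081220080510431142 ∷
  130318070608071719150207242023290741060309150525060309512547210822150313070306381029070822150318140213181524091219 ∷
  310510150210060309210314231330080510141520842383070306201525240726060309140708070608150511241326101227220721061417 ∷
  60309281831231033393538271837140708241315211023201419140718122122080510060309180334271344181015130511130309110507 ∷
  231122130629071522130321321122210310280927460945311418141521280927130522231033141226302135270721072639100515221112 ∷
  220221251020060309190215440333101720241326501053202124141118190614382233141526110718080306150525471746141521060714 ∷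
  140313141315151331141526471538241115200813120211090621120515080306180727320714060309201115141535150210231118181922 ∷
  150511384261220321151425170315230819310534101225120515142028200721130612140708070306100618230222141525221428180510 ∷
  70306080306201922341122210314120511261949190618282124121020140613110514180321111015232033140708122730061938112025 ∷
  230915111015243843280529080510060812120511140317360527070822150314231128060309291227120511420535230233101525382441 ∷
  71419120510120607231730211025070608230219150210211536200721230915120914121117270330140213150207141122101217050710 ∷
  70306140607150318201734091320421947080306471146150525151227150718070608290519080306110813140309311029150712141521 ∷
  72639152834121318220740120915141315140708122122472643081020051215122122441326102939531338221218230633121117222031 ∷
  351521202338120922080510140708181030321734261215080510140708591158140620200714220621231015301429070306251239241331 ∷
  352244263775080510386083101845241751050710260549080306060309301323351521190609220621150714120211060309351734100515 ∷
  193842291738050710662667340535200813060309281115070608421535140318472067221447260534200721060920150525070306101227 ∷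
  70306070620151424140309200615080306051215271213190515471035220721120914120508100618091219060309050710140313140708 ∷
  241020181934180714050710141922404152281827060927302946150511220217140822131120081326100618070306121326080306232035 ∷
  80306150511411945112033080510180510060309340337140313081428190912060309301229211320704669070822080306140607140613 ∷
  380346211023120511060309131214151431140315260922180327181326270721090620120915350531120508101123141339060309221431 ∷
  51215151227060309250523092227311030130314271326120714080306120721180510110714181326080510131124150714282736290619 ∷
  70608182233500542060309070617121117291435310527100515290628270515060714530252170623234259280327100623470546081020 ∷
  593374192427111314380762091221180523120714231827301428111015181320180613140708090621120511201929122255110514020720 ∷
  60714140708120511223234681067060309140708061319120721200222180321200721110507110507070306070608312235140613141526 ∷
  240515150511170322210749130309250620070608151425381920201521261929060309260923121133051215230510302033381339050710 ∷
  70608120914080306201215201014070608141125301123473973281129422239100618313842300522130314321122150511151018060309 ∷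
  220535060309201125080306471371220518152125073842180514181938100618151424050710270519113440384259140613141525230522 ∷
  211020200219201125061319100515241425140607070306432134100618150313140708130314060309050710682657050710061420070617 ∷
  171423200729181926261225310315130511222033061213240931120915031722582930070306201217443771220326080306080510120513 ∷
  70306150207130309070822201217110813080510202934140213140322120211230927340629080306202338100314070608140217180321 ∷
  90621270937191218120510120915221021324158031845141526241339270721101225123143140313080306260522080306211020220617 ∷
  150318381763150320050710100618190627220535060812080306150525062233150511111219150714050710151037051215191526150207 ∷
  112025130309081428100515381130381425301927190921301429141315381519140613120510342235060309144347111015171429080510 ∷
  141724050710120508101525594758122122071119140708200714181015062325170612130320120211142239070306101525140217281321 ∷
  180712200912593168080510141521070608180511203742150318140613101114181326141315120721391327060920080306120510301428 ∷
  321734311742150714120511260525060309201227070620625259301736581953231122120211220721150313110518140613050710120511 ∷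
  253045140310353447201014321734690774230618230213070608300326180514111822101114140318200823391831051215080306061017 ∷
  80306592667080510060309100517101525601353060309260518381227380719220320140319150514060309301321200721080306101225 ∷
  201723180712321326100515150525140309131124070608071522130309150313112839121133140223521743391327140708182338181015 ∷
  81120100618060309130314120817251546110219101130421153070608260735291726201525081020180512051419260733200615571948 ∷
  301429381023120511220721140609080306101525311538110507120511120511591158120513071522201924220309380334060309180613 ∷
  121520070617220720321122221021180712060309232144080306141521200919310539100618441734031830080306150927251020440643 ∷
  120511272128130309080306111520120508221021070306220714181922384758140607050710270515321957100515232033241015140317 ∷
  292134181133200619140708230222180613061523201125141521120511301133211320140708230519512073070608832877100515080510 ∷
  422546120914111429260738121117070608071522371451181922080510200714120511220714210322323153141521110518060309120211 ∷
  120511071522070306141521120211181122200817100515081020471335120511310313110718090621141521060309522061282139112226 ∷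
  202138080510061420200217341124051215130309060725110814311027060309220217050710251214150511270628823869351134230618 ∷
  60309270926210220181122111822222127110507080306280929624057110814282736231122743471060309140322382643140708070306 ∷
  151018290628060309273952350726271133272128110219180730221421080510130511240923191227070817300518060309140822110814 ∷
  61920301927111523060812420943181326200919080510120508121133422352151423170612381573230618141535140313080306120721 ∷
  50710170314141315131520371138140708361037150525120211381726220720050710230915422341351521070608152649391133381227 ∷
  60714120714101114301429150927151018280618210310351334150207120922251120181020240510122128180321200714260522080306 ∷
  542233070608120513251020683867120607661555080510080510131122110507080306110514080306120515635871060309231122221421 ∷
  303355060309120219150927230629130309051215151018220721130924140609070306060812111520220721090621070608272233080510 ∷
  270715181326060309140708100314080306402542080306060309100618120914241015140708190609470239061420141520240930130333 ∷
  70306080314120515433053180712140708050710140313251439180711251439072035051215111314390645100515321428270628311550 ∷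
  241023120211382542050710271734130924120211092231080306120508531546211023220621141222531552383346220221120515060309 ∷
  71522081214391327050710241123202124200919070306211023060309120607070608120510352547301417281827432134101525101227 ∷
  240931120515523148291837080306211020181122060812281521 ∷ []

unpack : ℕ → ℕ → List ℕ → List ℕ
unpack zero t ts = ts
unpack (suc fuel) t ts = if t ℕ.≡ᵇ 0 then ts else (t ℕ.% 1000000) ∷ unpack fuel (t ℕ./ 1000000) ts

prime-witnesses : List ℕ
prime-witnesses = foldr (unpack 19) [] prime-table

-- The range starts at n = 3, just after q = 17, and its 10697 values end at n = 10699, just below
-- the threshold of the greedy choice.
primes-checked : Sweep.sweep composite prime-test 10697 3 prime-witnesses ≡ true
primes-checked = refl

-- A witness 1, a₁, a₂, a₃ in 𝔽_p[x] / (x ^ (k + 2) - c), where p = p′ + 1. Polynomials are written as decimal numbers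
-- whose digits are the coefficients, the constant term being the last digit.
record Entry : Set where
  constructor entry
  field
    p′ k c a₁ a₂ a₃ : ℕ

power-table : List Entry
power-table =
  entry 2 2 11 1000 10 111 ∷
  entry 2 4 11 100 1110 1101 ∷
  entry 2 6 101 100 1110 1111 ∷
  entry 2 8 102 2012 1010 2221 ∷
  entry 4 0 2 10 14 43 ∷
  entry 4 2 2 10 1101 111 ∷
  entry 4 4 22 1000 100 1220 ∷
  entry 6 0 3 32 21 12 ∷
  entry 6 2 21 1000 101 2112 ∷
  entry 10 0 2 12 10 33 ∷
  entry 10 2 31 10 100 1001 ∷
  entry 12 0 2 20 10 11 ∷
  entry 12 2 2 1000 10 1111 ∷
  entry 16 0 3 20 21 3 ∷
  entry 16 1 41 210 200 112 ∷
  entry 16 2 3 1010 1000 11 ∷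
  entry 18 0 2 21 10 12 ∷
  entry 22 0 5 12 41 32 ∷
  entry 28 0 2 32 20 21 ∷
  entry 30 0 3 13 23 14 ∷
  entry 36 0 2 30 31 33 ∷
  entry 40 0 3 31 10 22 ∷
  entry 40 1 11 120 201 122 ∷
  entry 42 0 2 30 22 32 ∷
  entry 46 0 5 12 31 22 ∷
  entry 52 0 2 11 12 24 ∷
  entry 58 0 2 20 21 33 ∷
  entry 60 0 2 10 2 42 ∷
  entry 66 0 2 23 11 13 ∷
  entry 70 0 7 33 43 34 ∷
  entry 72 0 5 20 31 5 ∷
  entry 78 0 3 23 31 13 ∷
  entry 82 0 2 21 10 12 ∷
  entry 88 0 3 32 41 14 ∷
  entry 96 0 5 51 10 50 ∷
  entry 100 0 2 10 30 14 ∷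
  entry 102 0 3 12 31 22 ∷
  entry 106 0 2 10 12 32 ∷
  entry 108 0 2 32 20 21 ∷
  entry 112 0 3 31 10 30 ∷
  entry 126 0 3 51 13 24 ∷
  entry 130 0 2 21 10 12 ∷
  entry 136 0 3 11 30 32 ∷
  entry 138 0 2 21 10 12 ∷
  entry 148 0 2 11 10 30 ∷
  entry 150 0 3 42 12 44 ∷
  entry 156 0 2 20 10 11 ∷
  entry 162 0 2 12 10 33 ∷
  entry 166 0 5 44 12 43 ∷
  entry 172 0 2 20 10 11 ∷
  entry 178 0 2 13 30 33 ∷
  entry 180 0 2 20 10 11 ∷
  entry 190 0 7 14 32 43 ∷
  entry 192 0 5 21 50 52 ∷
  entry 196 0 2 20 14 44 ∷
  entry 198 0 3 12 41 53 ∷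
  entry 210 0 2 10 12 32 ∷
  entry 222 0 3 23 51 33 ∷
  entry 226 0 2 21 10 12 ∷
  entry 228 0 2 20 10 11 ∷
  entry 232 0 3 31 10 43 ∷
  entry 238 0 7 23 33 24 ∷
  entry 240 0 7 30 15 56 ∷
  entry 250 0 2 21 10 12 ∷
  entry 256 0 3 50 41 14 ∷
  entry 262 0 5 33 41 23 ∷
  entry 268 0 2 20 10 11 ∷
  entry 270 0 3 12 21 33 ∷
  entry 276 0 2 20 11 31 ∷
  entry 280 0 3 31 30 3 ∷
  entry 282 0 2 20 21 33 ∷ []

polynomial : ∀ k → ℕ → Vec ℕ k
polynomial zero t = []
polynomial (suc k) t = (t ℕ.% 10) ∷ polynomial k (t ℕ./ 10)

module EntryTest (e : Entry) where
  open Entry e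
  open Extension p′

  q : ℕ
  q = suc p′ ℕ.^ suc (suc k)

  root-digits : List Bool
  root-digits = digits 18 ((q ℕ.∸ 1) ℕ./ suc (suc k))

  binomial-test : Bool
  binomial-test = (suc (suc k) ℕ.* value root-digits ℕ.+ 1 ℕ.≡ᵇ q) ∧
    ((0 ℕ.<ᵇ value root-digits) ∧ (Test.power (prime-arithmetic p′) c root-digits ℕ.≡ᵇ 1))

  general-test : Bool
  general-test = (suc (suc k) ℕ.+ (q ℕ.∸ suc (suc k)) ℕ.≡ᵇ q) ∧ splits (q ℕ.∸ suc (suc k)) (polynomial (suc (suc k)) c)

  -- A single digit c stands for the binomial x ^ (k + 2) - c, for which one modular power
  -- guarantees a root in F. Any other polynomial is tested by raising x step by step to x ^ q, at a
  -- cost proportional to q.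
  modulus : Bool → Vec ℕ (suc (suc k))
  modulus true = c ∷ Vec.replicate (suc k) 0
  modulus false = polynomial (suc (suc k)) c

  root-test : Bool → Bool
  root-test true = binomial-test
  root-test false = general-test

  witness-test : Bool → Bool
  witness-test b = (value (quarter q) ℕ.* 4 ℕ.+ 1 ℕ.≡ᵇ q) ∧ Test.test (extension-arithmetic (modulus b)) (quarter q)
    (polynomial (suc (suc k)) a₁) (polynomial (suc (suc k)) a₂) (polynomial (suc (suc k)) a₃)

  entry-test : Bool
  entry-test = root-test (c ℕ.<ᵇ 10) ∧ witness-test (c ℕ.<ᵇ 10)

  module _ (n : ℕ) (0<n : 0 ℕ.< n) (q≡8n+1 : q ≡ 8 ℕ.* n ℕ.+ 1) (F : FieldOn (8 ℕ.* n ℕ.+ 1)) where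
    open FieldTheory F

    root-test-sound : ∀ b → root-test b ≡ true → ∃[ θ ] θ ^ suc (suc k) ≡ eval {m = suc (suc k)} q≡8n+1 F θ (modulus b)
    root-test-sound false e with ∧-true {suc (suc k) ℕ.+ (q ℕ.∸ suc (suc k)) ℕ.≡ᵇ q} e
    ... | e₁ , e₂ = root-exists {m = suc (suc k)} q≡8n+1 F {k = k} (q ℕ.∸ suc (suc k)) (polynomial (suc (suc k)) c) (trans (≡ᵇ-true _ _ e₁) q≡8n+1) e₂
    root-test-sound true e with ∧-true {suc (suc k) ℕ.* value root-digits ℕ.+ 1 ℕ.≡ᵇ q} e
    ... | e₁ , e₂ with ∧-true {0 ℕ.<ᵇ value root-digits} e₂
    ...   | e₃ , e₄ = from-root (binomial-root-exists {m = suc (suc k)} q≡8n+1 F {k = suc k} m c (trans (cong (λ v → suc (suc k) ℕ.* v ℕ.+ 1) (sym v≡)) (trans (≡ᵇ-true _ _ e₁) q≡8n+1)) r^m≡1)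
      where
      open Characteristic⁺ (suc (suc k)) q≡8n+1 F
      pos : ∃[ m ] value root-digits ≡ suc m
      pos = go (value root-digits) (<ᵇ-true 0 _ e₃)
        where
        go : ∀ v → 0 ℕ.< v → ∃[ m ] v ≡ suc m
        go (suc m) _ = m , refl
      m = proj₁ pos
      v≡ = proj₂ pos
      r^m≡1 : ι c ^ suc m ≡ 1#
      r^m≡1 = trans (cong (ι c ^_) (sym v≡)) (trans (sym (Soundness.⟦power⟧ (prime-arithmetic p′) n 0<n F (prime-interpretation (suc (suc k)) q≡8n+1 F) c root-digits))
        (trans (cong ι (≡ᵇ-true (Test.power (prime-arithmetic p′) c root-digits) 1 e₄)) (+-identityʳ 1#)))
      from-root : ∃[ θ ] θ ^ suc (suc k) ≡ ι c → ∃[ θ ] θ ^ suc (suc k) ≡ eval {m = suc (suc k)} q≡8n+1 F θ (c ∷ Vec.replicate (suc k) 0)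
      from-root (θ , e) = θ , trans e (sym (trans (cong (λ z → ι c + θ * z) (eval-zero {m = suc (suc k)} q≡8n+1 F θ (suc k))) (trans (cong (ι c +_) (zeroʳ θ)) (+-identityʳ (ι c)))))

    witness-test-sound : ∀ b → ∃[ θ ] θ ^ suc (suc k) ≡ eval {m = suc (suc k)} q≡8n+1 F θ (modulus b) → witness-test b ≡ true → QuarticClasses.Witness n 0<n F
    witness-test-sound b (θ , θ-root) e = Soundness.test-sound (extension-arithmetic (modulus b)) n 0<n F
      (extension-interpretation {m = suc (suc k)} q≡8n+1 F (modulus b) θ θ-root) (quarter q)
      (polynomial (suc (suc k)) a₁) (polynomial (suc (suc k)) a₂) (polynomial (suc (suc k)) a₃)
      (value-quarter {n} {quarter q} (trans (≡ᵇ-true _ _ (proj₁ both)) q≡8n+1)) (proj₂ both)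
      where
      both = ∧-true {value (quarter q) ℕ.* 4 ℕ.+ 1 ℕ.≡ᵇ q} {Test.test (extension-arithmetic (modulus b)) (quarter q)
        (polynomial (suc (suc k)) a₁) (polynomial (suc (suc k)) a₂) (polynomial (suc (suc k)) a₃)} e

    entry-test-sound : entry-test ≡ true → QuarticClasses.Witness n 0<n F
    entry-test-sound e = witness-test-sound (c ℕ.<ᵇ 10) (root-test-sound (c ℕ.<ᵇ 10) (proj₁ both)) (proj₂ both)
      where
      both = ∧-true {root-test (c ℕ.<ᵇ 10)} {witness-test (c ℕ.<ᵇ 10)} e

some : (Entry → Bool) → List Entry → Bool
some f [] = false
some f (e ∷ es) = f e ∨ some f es

some-true : ∀ f es → some f es ≡ true → ∃[ e ] f e ≡ true
some-true f (e ∷ es) t with ∨-true {f e} t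
... | inj₁ fe = e , fe
... | inj₂ t′ = some-true f es t′

matches : ℕ → ℕ → Entry → Bool
matches p k e = (suc (Entry.p′ e) ℕ.≡ᵇ p) ∧ ((suc (suc (Entry.k e)) ℕ.≡ᵇ k) ∧ EntryTest.entry-test e)

-- The bound 85600 is 8 · 10700, above every q left by the greedy choice. The trial divisors 2, ...,
-- 21 detect all composite p below 293.
covered : ℕ → ℕ → Bool
covered p k = (k ℕ.<ᵇ 2) ∨ ((85600 ℕ.<ᵇ p ℕ.^ k) ∨ ((p ℕ.^ k ℕ.<ᵇ 10) ∨ (not (p ℕ.^ k ℕ.% 8 ℕ.≡ᵇ 1) ∨ (has-divisor 20 1 1 p ∨ some (matches p k) power-table))))

-- As 293² and 2^17 exceed 85600, a proper prime power up to that bound has p < 293 and k < 17.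
covered-row : Fin 293 → Bool
covered-row p = conjunction {17} λ k → covered (toℕ p) (toℕ k)

powers-checked : conjunction covered-row ≡ true
powers-checked = refl

module SmallFields (n : ℕ) (0<n : 0 ℕ.< n) (F : FieldOn (8 ℕ.* n ℕ.+ 1)) (9<q : 9 ℕ.< 8 ℕ.* n ℕ.+ 1) (small : n ℕ.< 10700) where

  private
    q≤85600 : 8 ℕ.* n ℕ.+ 1 ℕ.≤ 85600
    q≤85600 = ℕₚ.≤-trans (ℕₚ.+-monoˡ-≤ 1 (ℕₚ.*-monoʳ-≤ 8 (ℕₚ.≤-pred small))) (ℕₚ.≤ᵇ⇒≤ (8 ℕ.* 10699 ℕ.+ 1) 85600 _)

    n≥3 : n ≢ 2 → ∃[ i ] 3 ℕ.+ i ≡ n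
    n≥3 n≢2 = go n n≢2 9<q
      where
      go : ∀ n → n ≢ 2 → 9 ℕ.< 8 ℕ.* n ℕ.+ 1 → ∃[ i ] 3 ℕ.+ i ≡ n
      go 0 _ (s≤s ())
      go 1 _ 9<9 = ⊥-elim (ℕₚ.<-irrefl refl 9<9)
      go 2 n≢2 _ = ⊥-elim (n≢2 refl)
      go (suc (suc (suc i))) _ _ = i , refl

  prime-witness : n ≢ 2 → Prime (8 ℕ.* n ℕ.+ 1) → QuarticClasses.Witness n 0<n F
  prime-witness n≢2 q-prime = [ (λ e → ⊥-elim (has-divisor-sound 150 2 2 (8 ℕ.* n ℕ.+ 1) e q-prime))
    , (λ (t , e) → prime-test-sound n 0<n F t e) ]′ found
    where
    i = proj₁ (n≥3 n≢2)
    i<l : i ℕ.< 10697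
    i<l = ℕₚ.+-cancelˡ-< 3 i 10697 (subst (ℕ._< 10700) (sym (proj₂ (n≥3 n≢2))) small)
    found : composite n ≡ true ⊎ ∃[ t ] prime-test n t ≡ true
    found = subst (λ m → composite m ≡ true ⊎ ∃[ t ] prime-test m t ≡ true) (proj₂ (n≥3 n≢2))
      (Sweep.sweep-sound composite prime-test 10697 3 prime-witnesses primes-checked i i<l)

  module _ {p k : ℕ} (p-prime : Prime p) (2≤k : 2 ℕ.≤ k) (p^k≡q : p ℕ.^ k ≡ 8 ℕ.* n ℕ.+ 1) where
    private
      2≤p : 2 ℕ.≤ p
      2≤p = ℕ.nonTrivial⇒n>1 p {{prime⇒nonTrivial p-prime}}

      p^k≤85600 : p ℕ.^ k ℕ.≤ 85600
      p^k≤85600 = ℕₚ.≤-trans (ℕₚ.≤-reflexive p^k≡q) q≤85600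

      p<293 : p ℕ.< 293
      p<293 = ℕₚ.≰⇒> λ 293≤p → ℕₚ.<⇒≱ (ℕₚ.<ᵇ⇒< 85600 (293 ℕ.^ 2) _) (ℕₚ.≤-trans (ℕₚ.^-monoˡ-≤ 2 293≤p)
        (ℕₚ.≤-trans (ℕₚ.^-monoʳ-≤ p {{ℕ.>-nonZero (ℕₚ.≤-trans (s≤s z≤n) 2≤p)}} 2≤k) p^k≤85600))

      k<17 : k ℕ.< 17
      k<17 = ℕₚ.≰⇒> λ 17≤k → ℕₚ.<⇒≱ (ℕₚ.<ᵇ⇒< 85600 (2 ℕ.^ 17) _) (ℕₚ.≤-trans (ℕₚ.^-monoˡ-≤ 17 2≤p)
        (ℕₚ.≤-trans (ℕₚ.^-monoʳ-≤ p {{ℕ.>-nonZero (ℕₚ.≤-trans (s≤s z≤n) 2≤p)}} 17≤k) p^k≤85600))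

      p^k%8≡1 : p ℕ.^ k ℕ.% 8 ≡ 1
      p^k%8≡1 = trans (cong (ℕ._% 8) (trans p^k≡q (eq n))) (ℕ÷.[m+kn]%n≡m%n 1 n 8)
        where
        eq : ∀ n → 8 ℕ.* n ℕ.+ 1 ≡ 1 ℕ.+ n ℕ.* 8
        eq = solve-∀

      is-covered : covered p k ≡ true
      is-covered = subst₂ (λ p k → covered p k ≡ true) (toℕ-fromℕ< p<293) (toℕ-fromℕ< k<17)
        (conjunction-true (λ k → covered (toℕ (fromℕ< p<293)) (toℕ k))
          (conjunction-true covered-row powers-checked (fromℕ< p<293)) (fromℕ< k<17))

      not-true : ∀ {b} → not b ≡ true → b ≡ true → ⊥
      not-true {true} () _
      not-true {false} _ ()

      ≡ᵇ-refl : ∀ {a b} → a ≡ b → (a ℕ.≡ᵇ b) ≡ true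
      ≡ᵇ-refl {zero} refl = refl
      ≡ᵇ-refl {suc a} refl = ≡ᵇ-refl {a} refl

      matching-entry : ∃[ e ] matches p k e ≡ true
      matching-entry = some-true (matches p k) power-table
        (right {has-divisor 20 1 1 p} (λ e → has-divisor-sound 20 1 1 p e p-prime)
        (right {not (p ℕ.^ k ℕ.% 8 ℕ.≡ᵇ 1)} (λ e → not-true e (≡ᵇ-refl p^k%8≡1))
        (right {p ℕ.^ k ℕ.<ᵇ 10} (λ e → ℕₚ.<⇒≱ (<ᵇ-true (p ℕ.^ k) 10 e) (ℕₚ.≤-trans 9<q (ℕₚ.≤-reflexive (sym p^k≡q))))
        (right {85600 ℕ.<ᵇ p ℕ.^ k} (λ e → ℕₚ.<⇒≱ (<ᵇ-true 85600 (p ℕ.^ k) e) p^k≤85600)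
        (right {k ℕ.<ᵇ 2} (λ e → ℕₚ.<⇒≱ (<ᵇ-true k 2 e) 2≤k) is-covered)))))
        where
        right : ∀ {a b} → ¬ (a ≡ true) → a ∨ b ≡ true → b ≡ true
        right {true} ¬a e = ⊥-elim (¬a refl)
        right {false} ¬a e = e

    power-witness : QuarticClasses.Witness n 0<n F
    power-witness = EntryTest.entry-test-sound e n 0<n
      (trans (cong₂ ℕ._^_ (≡ᵇ-true (suc (Entry.p′ e)) p (proj₁ m₁)) (≡ᵇ-true (suc (suc (Entry.k e))) k (proj₁ m₂))) p^k≡q) F (proj₂ m₂)
      where
      e = proj₁ matching-entry
      m₁ = ∧-true {suc (Entry.p′ e) ℕ.≡ᵇ p} {(suc (suc (Entry.k e)) ℕ.≡ᵇ k) ∧ EntryTest.entry-test e} (proj₂ matching-entry)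
      m₂ = ∧-true {suc (suc (Entry.k e)) ℕ.≡ᵇ k} {EntryTest.entry-test e} (proj₂ m₁)

  small-witness : ∀ {p k} → n ≢ 2 → Prime p → 1 ℕ.≤ k → p ℕ.^ k ≡ 8 ℕ.* n ℕ.+ 1 → QuarticClasses.Witness n 0<n F
  small-witness {p} {suc zero} n≢2 p-prime _ p^1≡q = prime-witness n≢2 (subst Prime (trans (sym (ℕₚ.*-identityʳ p)) p^1≡q) p-prime)
  small-witness {p} {suc (suc k)} _ p-prime _ p^k≡q = power-witness {k = suc (suc k)} p-prime (s≤s (s≤s z≤n)) p^k≡q

-- The field of order 17

module OrderSeventeen (F : FieldOn 17) where
  open FieldTheory F
  open Characteristic⁺ {q = 17} {p′ = 16} 1 refl F
  open Differences F

  residue : ℕ → Fin 17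
  residue a = fromℕ< (ℕ÷.m%n<n a 17)

  _⊝₁₇_ : Fin 17 → Fin 17 → Fin 17
  i ⊝₁₇ j = residue (toℕ i ℕ.+ toℕ j ℕ.* 16)

  _⊖₀_ : Γ 17 → Γ 17 → Γ 17
  (a , i) ⊖₀ (b , j) = (a +₂ b) , (i ⊝₁₇ j)

  -- The isomorphism from the residues modulo 17 to the additive group of F. Exact counts are
  -- transported along it, so it has to be bijective.
  ψ : Fin 17 → Fin 17
  ψ i = ι (toℕ i)

  ψ-⊝ : ∀ i j → ψ (i ⊝₁₇ j) ≡ ψ i - ψ j
  ψ-⊝ i j = trans (cong ι (toℕ-fromℕ< (ℕ÷.m%n<n (toℕ i ℕ.+ toℕ j ℕ.* 16) 17)))
    (trans (ι-% (toℕ i ℕ.+ toℕ j ℕ.* 16)) (ι-minus (toℕ i) (toℕ j)))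

  private
    invertible : Fin 17 → Bool
    invertible i = (toℕ i ℕ.≡ᵇ 0) ∨ ((toℕ i ℕ.* toℕ i ℕ.^ 15) ℕ.% 17 ℕ.≡ᵇ 1)

    all-invertible : conjunction invertible ≡ true
    all-invertible = refl

    zero-difference : Fin 17 → Fin 17 → Bool
    zero-difference i j = not (toℕ (i ⊝₁₇ j) ℕ.≡ᵇ 0) ∨ (toℕ i ℕ.≡ᵇ toℕ j)

    zero-differences : conjunction {17} (λ i → conjunction {17} (zero-difference i)) ≡ true
    zero-differences = refl

  -- By Fermat a nonzero residue i has the inverse i^15 modulo 17, so its image in F is a unit.
  ψ-zero : ∀ i → ψ i ≡ 0# → toℕ i ≡ 0
  ψ-zero i ψi≡0 = go (toℕ i ℕ.≡ᵇ 0) refl (conjunction-true invertible all-invertible i)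
    where
    go : ∀ b → (toℕ i ℕ.≡ᵇ 0) ≡ b → b ∨ ((toℕ i ℕ.* toℕ i ℕ.^ 15) ℕ.% 17 ℕ.≡ᵇ 1) ≡ true → toℕ i ≡ 0
    go true e _ = ≡ᵇ-true (toℕ i) 0 e
    go false _ e = ⊥-elim (0≢1# (begin
      0# ≡⟨ zeroˡ (ι (toℕ i ℕ.^ 15)) ⟨
      0# * ι (toℕ i ℕ.^ 15) ≡⟨ cong (_* ι (toℕ i ℕ.^ 15)) ψi≡0 ⟨
      ι (toℕ i) * ι (toℕ i ℕ.^ 15) ≡⟨ ι-* (toℕ i) (toℕ i ℕ.^ 15) ⟨
      ι (toℕ i ℕ.* toℕ i ℕ.^ 15) ≡⟨ ι-% (toℕ i ℕ.* toℕ i ℕ.^ 15) ⟨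
      ι ((toℕ i ℕ.* toℕ i ℕ.^ 15) ℕ.% 17) ≡⟨ cong ι (≡ᵇ-true ((toℕ i ℕ.* toℕ i ℕ.^ 15) ℕ.% 17) 1 e) ⟩
      ι 1 ≡⟨ +-identityʳ 1# ⟩
      1# ∎))
      where open ≡-Reasoning

  ψ-injective : ∀ {i j} → ψ i ≡ ψ j → i ≡ j
  ψ-injective {i} {j} e = go (toℕ (i ⊝₁₇ j)) (ψ-zero (i ⊝₁₇ j) (trans (ψ-⊝ i j) (≡⇒difference≡0 e)))
    (conjunction-true (zero-difference i) (conjunction-true (λ i → conjunction {17} (zero-difference i)) zero-differences i) j)
    where
    go : ∀ d → d ≡ 0 → not (d ℕ.≡ᵇ 0) ∨ (toℕ i ℕ.≡ᵇ toℕ j) ≡ true → i ≡ j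
    go zero _ t = Finₚ.toℕ-injective (≡ᵇ-true (toℕ i) (toℕ j) t)

  ψ-surjective : ∀ x → ∃[ i ] ψ i ≡ x
  ψ-surjective x with any? (λ i → ψ i ≟ x)
  ... | yes hit = hit
  ... | no miss with pigeonhole (ℕₚ.n<1+n 16) (λ i → punchOut (x≢ψ i))
    where
    x≢ψ : ∀ i → x ≢ ψ i
    x≢ψ i e = miss (i , sym e)
  ...   | i , j , i<j , e = ⊥-elim (Finₚ.<⇒≢ i<j (ψ-injective (punchOut-injective (λ e → miss (i , sym e)) (λ e → miss (j , sym e)) e)))

  ψΓ : Γ 17 → Γ 17
  ψΓ (c , i) = c , ψ i

  ψΓ-injective : ∀ {g h} → ψΓ g ≡ ψΓ h → g ≡ h
  ψΓ-injective {c , i} {d , j} e = cong₂ _,_ (cong proj₁ e) (ψ-injective (cong proj₂ e))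

  pairs₀ : Γ 17 → Block 17 → ℕ
  pairs₀ g B = total (λ u → total (λ v → ind (¬? (v ≟Γ u)) ℕ.* ind (g ≟Γ (u ⊖₀ v))) B) B

  pairs-ψ : ∀ g B → pairs (ψΓ g) (map ψΓ B) ≡ pairs₀ g B
  pairs-ψ g B = trans (total-map _ ψΓ B) (total-cong (λ u → trans (total-map _ ψΓ B) (total-cong (λ v → cong₂ ℕ._*_
    (ind-⇔ (¬? (ψΓ v ≟Γ ψΓ u)) (¬? (v ≟Γ u)) (λ ne e → ne (cong ψΓ e)) (λ ne e → ne (ψΓ-injective e)))
    (ind-⇔ (ψΓ g ≟Γ (ψΓ u ⊖ ψΓ v)) (g ≟Γ (u ⊖₀ v)) (λ e → ψΓ-injective (trans e (sym (difference u v)))) (λ e → trans (cong ψΓ e) (difference u v)))) B)) B)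
    where
    difference : ∀ u v → ψΓ (u ⊖₀ v) ≡ ψΓ u ⊖ ψΓ v
    difference (a , i) (b , j) = cong ((a +₂ b) ,_) (ψ-⊝ i j)

  count-ψ : ∀ g B → count (ψΓ g) (map ψΓ B) ≡ count g B
  count-ψ g B = trans (count-total (ψΓ g) (map ψΓ B)) (trans (total-map _ ψΓ B) (trans
    (total-cong (λ y → ind-⇔ (ψΓ g ≟Γ ψΓ y) (g ≟Γ y) ψΓ-injective (cong ψΓ)) B) (sym (count-total g B))))

  -- Four pairs and two quadruples, as the sizes for n = 2 demand. One quadruple is split 3 + 1 over
  -- the two copies of F and the other 2 + 2, so they are not multiples of each other as in the
  -- general construction.
  L₀ : Class 17
  L₀ = map (map (λ (c , a) → c , residue a))
    ( ((0F , 5) ∷ (0F , 15) ∷ []) ∷ ((0F , 6) ∷ (0F , 14) ∷ [])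
    ∷ ((0F , 9) ∷ (0F , 12) ∷ []) ∷ ((0F , 10) ∷ (1F , 16) ∷ [])
    ∷ ((0F , 1) ∷ (0F , 2) ∷ (1F , 3) ∷ (0F , 7) ∷ [])
    ∷ ((0F , 4) ∷ (0F , 8) ∷ (1F , 11) ∷ (1F , 13) ∷ []) ∷ [])

  L : Class 17
  L = map (map ψΓ) L₀

  private
    cover₀ : Fin 17 → Bool
    cover₀ i = (count (0F , i) (concat L₀) ℕ.+ count (1F , i) (concat L₀)) ℕ.≡ᵇ ind (¬? (i ≟ 0F))

    all-covered : conjunction cover₀ ≡ true
    all-covered = refl

    differences₀ : Fin 2 → Fin 17 → Bool
    differences₀ c i = total (pairs₀ (c , i)) L₀ ℕ.≡ᵇ ind (¬? (i ≟ 0F))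

    all-differences : conjunction {2} (λ c → conjunction {17} (differences₀ c)) ≡ true
    all-differences = refl

    nonzero : ∀ i → ind (¬? (ψ i ≟ 0#)) ≡ ind (¬? (i ≟ 0F))
    nonzero i = ind-⇔ (¬? (ψ i ≟ 0#)) (¬? (i ≟ 0F)) (λ ne e → ne (cong ψ e)) (λ ne e → ne (ψ-injective {i} {0F} e))

  isHalfSystem : IsHalfSystem F 2 L
  isHalfSystem = record
    { sizes = ↭-refl
    ; cover = λ x → cover (ψ-surjective x)
    ; differences = λ c d → differences c (ψ-surjective d) }
    where
    cover : ∀ {x} → ∃[ i ] ψ i ≡ x → count (0F , x) (concat L) ℕ.+ count (1F , x) (concat L) ≡ ind (¬? (x ≟ 0#))
    cover (i , refl) = trans (cong₂ ℕ._+_ (point 0F) (point 1F)) (trans (≡ᵇ-true _ _ (conjunction-true cover₀ all-covered i)) (sym (nonzero i)))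
      where
      point : ∀ c → count (c , ψ i) (concat L) ≡ count (c , i) (concat L₀)
      point c = trans (cong (count (c , ψ i)) (concat-map {f = ψΓ} L₀)) (count-ψ (c , i) (concat L₀))
    differences : ∀ c {d} → ∃[ i ] ψ i ≡ d → count (c , d) (concatMap (Δ F) L) ≡ ind (¬? (d ≟ 0#))
    differences c (i , refl) = trans (count-Δs (c , ψ i) L) (trans (total-map (pairs (c , ψ i)) (map ψΓ) L₀)
      (trans (total-cong (pairs-ψ (c , i)) L₀) (trans
        (≡ᵇ-true _ _ (conjunction-true (differences₀ c) (conjunction-true (λ c → conjunction {17} (differences₀ c)) all-differences c) i))
        (sym (nonzero i)))))

half-system : ∀ n → IsPrimePower (8 ℕ.* n ℕ.+ 1) → 9 ℕ.< 8 ℕ.* n ℕ.+ 1 → (F : FieldOn (8 ℕ.* n ℕ.+ 1)) →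
  Σ (Class (8 ℕ.* n ℕ.+ 1)) (IsHalfSystem F n)
half-system n (p , k , p-prime , 1≤k , p^k≡q) 9<q F = by-cases (n ℕ.≟ 2) (10700 ℕ.≤? n)
  where
  0<n : 0 ℕ.< n
  0<n = ℕₚ.n≢0⇒n>0 λ { refl → case 9<q of λ { (s≤s ()) } }
  by-witness : QuarticClasses.Witness n 0<n F → Σ (Class (8 ℕ.* n ℕ.+ 1)) (IsHalfSystem F n)
  by-witness W = Construction.L n 0<n F W , Construction.isHalfSystem n 0<n F W
  seventeen : ∀ {n} → n ≡ 2 → (F : FieldOn (8 ℕ.* n ℕ.+ 1)) → Σ (Class (8 ℕ.* n ℕ.+ 1)) (IsHalfSystem F n)
  seventeen refl F = OrderSeventeen.L F , OrderSeventeen.isHalfSystem F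
  by-cases : Dec (n ≡ 2) → Dec (10700 ℕ.≤ n) → Σ (Class (8 ℕ.* n ℕ.+ 1)) (IsHalfSystem F n)
  by-cases (yes n≡2) _ = seventeen n≡2 F
  by-cases (no _) (yes large) = by-witness (Distribution.Greedy.large-witness n 0<n F large)
  by-cases (no n≢2) (no ¬large) = by-witness (SmallFields.small-witness n 0<n F 9<q (ℕₚ.≰⇒> ¬large) n≢2 p-prime 1≤k p^k≡q)

open import Data.Nat using (_+_; _*_; _<_)

theorem6p1 : (n : ℕ) → IsPrimePower (8 * n + 1) → 9 < 8 * n + 1
    → (F : FieldOn (8 * n + 1))
    → Σ (Class (8 * n + 1)) λ P →
    IsPDF F P (replicate (4 * n + 1) 2 ++ replicate (2 * n) 4) 2
    × IsHSBase F P (replicate (4 * n + 1) 2 ++ replicate (2 * n) 4)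
theorem6p1 n q-prime-power 9<q F = HalfSystem.P F n L half , HalfSystem.isPDF F n L half , HalfSystem.isHSBase F n L half
  where
  L = proj₁ (half-system n q-prime-power 9<q F)
  half = proj₂ (half-system n q-prime-power 9<q F)
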